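{- Every nonempty simple matroid $M\in\mathcal{ME}$ has a divisional atom $e$ such that $\mathrm{si}(M/e)\in\mathcal{ME}$.
   Context: All matroids are finite. For a simple matroid $M$ on ground set $E$ with rank function $r$, flats ordered by inclusion form the lattice $L(M)$, with $X\vee Y=\mathrm{cl}(X\cup Y)$. Elements of $E$ are atoms; a coatom is a flat of rank $r(E)-1$. A flat $X$ is modular if $r(X)+r(Y)=r(X\cap Y)+r(X\vee Y)$ for all flats $Y$. $M/e$ is contraction and $\mathrm{si}$ simplification. The characteristic polynomial is $\chi(M,t)=\sum_{X\in L(M)}\mu(X)t^{r(E)-r(X)}$ with $\mu$ the Möbius function from the bottom, computed for contractions from their lattice of flats. An atom $e$ is divisional if $\chi(M/e,t)$ divides $\chi(M,t)$. A simple matroid $M$ is a modular join if $E=E_1\cup E_2$ for proper modular flats $E_1,E_2$; one writes $M=P_X(M|E_1,M|E_2)$ with $X=E_1\cap E_2$. A matroid is round if its ground set is not the union of two proper flats; a flat $S$ is round if $M|S$ is round. $\mathcal{ME}$ is the smallest class of simple matroids such that: (i) the empty matroid is in $\mathcal{ME}$; (ii) if a simple matroid $M$ has a modular coatom $X$ with $M|X\in\mathcal{ME}$, then $M\in\mathcal{ME}$; (iii) if $M$ is a modular join $P_X(M_1,M_2)$ over a round flat $X$ with $M_1,M_2\in\mathcal{ME}$, then $M\in\mathcal{ME}$. -}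

module Defs where

open import Data.Nat using (ℕ; zero; suc; _≤_; _+_; _∸_; _<ᵇ_; _≡ᵇ_)
open import Data.Integer using (ℤ; _*_; -_) renaming (_+_ to _+ℤ_; 0ℤ to 0ℤ; 1ℤ to 1ℤ)
open import Data.Bool using (Bool; true; false; _∧_; _∨_; not; if_then_else_)
open import Data.Fin using (Fin; toℕ)
open import Data.Fin.Subset using (Subset; _⊆_; _∩_; _∪_; _-_; ⁅_⁆; ∣_∣; _∈_)
  renaming (⊥ to ∅)
open import Data.List using (List; []; _∷_; map; foldr; _++_; allFin; upTo)
open import Data.Vec using (Vec; []; _∷_; lookup; tabulate)
open import Data.Vec.Properties using (≡-dec)
import Data.Bool.Properties as BoolP
open import Data.Product using (Σ; _×_; ∃; ∃-syntax)
open import Relation.Binary.PropositionalEquality using (_≡_; _≢_)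
open import Relation.Nullary using (¬_; Dec)
open import Relation.Nullary.Decidable using (⌊_⌋)

allSubsets : (n : ℕ) → List (Subset n)
allSubsets zero = [] ∷ []
allSubsets (suc n) = map (true ∷_) (allSubsets n) ++ map (false ∷_) (allSubsets n)

_==ˢ_ : ∀ {n} → Subset n → Subset n → Bool
X ==ˢ Y = ⌊ ≡-dec BoolP._≟_ X Y ⌋

_⊆ᵇ_ : ∀ {n} → Subset n → Subset n → Bool
[] ⊆ᵇ [] = true
(x ∷ xs) ⊆ᵇ (y ∷ ys) = (not x ∨ y) ∧ (xs ⊆ᵇ ys)

_⊊ᵇ_ : ∀ {n} → Subset n → Subset n → Bool
X ⊊ᵇ Y = (X ⊆ᵇ Y) ∧ not (X ==ˢ Y)

filterᵇ : ∀ {A : Set} → (A → Bool) → List A → List A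
filterᵇ p [] = []
filterᵇ p (x ∷ xs) = if p x then x ∷ filterᵇ p xs else filterᵇ p xs

allᵇ : ∀ {A : Set} → (A → Bool) → List A → Bool
allᵇ p = foldr (λ x b → p x ∧ b) true

sumℤ : List ℤ → ℤ
sumℤ = foldr _+ℤ_ 0ℤ

-- Matroids, given by a rank function on the subsets of a ground set
-- E ⊆ Fin N (so restrictions, contractions and simplifications stay
-- inside the same universe Fin N).  The rank function is only relevant
-- on subsets of E.

record RawMatroid (N : ℕ) : Set where
  constructor mkM
  field
    E : Subset N
    r : Subset N → ℕ

open RawMatroid public

module _ {N : ℕ} (M : RawMatroid N) where

  record IsMatroid : Set where
    field
      r-card : ∀ X → X ⊆ E M → r M X ≤ ∣ X ∣
      r-mono : ∀ X Y → Y ⊆ E M → X ⊆ Y → r M X ≤ r M Y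
      r-submod : ∀ X Y → X ⊆ E M → Y ⊆ E M →
                 r M (X ∪ Y) + r M (X ∩ Y) ≤ r M X + r M Y

  record IsSimple : Set where
    field
      isMatroid : IsMatroid
      noLoop : ∀ e → e ∈ E M → r M ⁅ e ⁆ ≡ 1
      noParallel : ∀ e f → e ∈ E M → f ∈ E M → e ≢ f → r M (⁅ e ⁆ ∪ ⁅ f ⁆) ≡ 2

  cl : Subset N → Subset N
  cl X = tabulate (λ f → lookup (E M) f ∧ (r M (X ∪ ⁅ f ⁆) ≡ᵇ r M X))

  isFlatᵇ : Subset N → Bool
  isFlatᵇ X = (X ⊆ᵇ E M) ∧ (cl X ==ˢ X)

  Flat : Subset N → Set
  Flat X = X ⊆ E M × cl X ≡ X

  flats : List (Subset N)
  flats = filterᵇ isFlatᵇ (allSubsets N)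

  _∨L_ : Subset N → Subset N → Subset N
  X ∨L Y = cl (X ∪ Y)

  bottom : Subset N
  bottom = cl ∅

  -- Möbius function μ(bottom, X), by the standard recursion
  --   μ(bottom) = 1,  μ(X) = - Σ_{Y flat, Y ⊊ X} μ(Y);
  -- computed with fuel N+1, which exceeds the length of every chain of
  -- flats (chains of flats have at most r(E)+1 ≤ N+1 elements).
  μ-fuel : ℕ → Subset N → ℤ
  μ-fuel zero X = 0ℤ
  μ-fuel (suc k) X =
    if X ==ˢ bottom then 1ℤ
    else - sumℤ (map (μ-fuel k) (filterᵇ (λ Y → Y ⊊ᵇ X) flats))

  μ : Subset N → ℤ
  μ = μ-fuel (suc N)

  -- characteristic polynomial, as its coefficient function:
  -- coefficient of t^k is Σ_{X ∈ L(M), r(E) - r(X) = k} μ(X)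
  χ : ℕ → ℤ
  χ k = sumℤ (map μ (filterᵇ (λ X → (r M (E M) ∸ r M X) ≡ᵇ k) flats))

  Modular : Subset N → Set
  Modular X = Flat X × (∀ Y → Flat Y → r M X + r M Y ≡ r M (X ∩ Y) + r M (X ∨L Y))

  Coatom : Subset N → Set
  Coatom X = Flat X × suc (r M X) ≡ r M (E M)

  ProperFlat : Subset N → Set
  ProperFlat X = Flat X × X ≢ E M

  Round : Set
  Round = ¬ (∃[ F₁ ] ∃[ F₂ ] (ProperFlat F₁ × ProperFlat F₂ × F₁ ∪ F₂ ≡ E M))

  _∣_ : Subset N → RawMatroid N
  _∣_ X = mkM X (r M)

  _/_ : Fin N → RawMatroid N
  _/_ e = mkM (E M - e) (λ X → r M (X ∪ ⁅ e ⁆) ∸ r M ⁅ e ⁆)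

  -- simplification: delete loops and keep, in each parallel class, the
  -- element of least index
  si : RawMatroid N
  si = mkM E' (r M)
    where
    nonloop : Fin N → Bool
    nonloop f = lookup (E M) f ∧ not (r M ⁅ f ⁆ ≡ᵇ 0)
    parallel : Fin N → Fin N → Bool
    parallel g f = nonloop g ∧ nonloop f ∧ (r M (⁅ g ⁆ ∪ ⁅ f ⁆) ≡ᵇ 1)
    E' : Subset N
    E' = tabulate (λ f → nonloop f ∧
           allᵇ (λ g → not ((toℕ g <ᵇ toℕ f) ∧ parallel g f)) (allFin N))

RoundFlat : ∀ {N} → RawMatroid N → Subset N → Set
RoundFlat M S = Flat M S × Round (M ∣ S)

-- Polynomials over ℤ, as coefficient functions; a polynomial with
-- finitely many coefficients is given by a list (constant term first).

coeffs : List ℤ → ℕ → ℤ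
coeffs [] k = 0ℤ
coeffs (a ∷ as) zero = a
coeffs (a ∷ as) (suc k) = coeffs as k

_⊛_ : (ℕ → ℤ) → (ℕ → ℤ) → ℕ → ℤ
(p ⊛ q) k = sumℤ (map (λ i → p i * q (k ∸ i)) (upTo (suc k)))

_∣ₚ_ : (ℕ → ℤ) → (ℕ → ℤ) → Set
p ∣ₚ q = ∃[ c ] (∀ k → q k ≡ (p ⊛ coeffs c) k)

Divisional : ∀ {N} → RawMatroid N → Fin N → Set
Divisional M e = χ (M / e) ∣ₚ χ M

data ME {N : ℕ} : RawMatroid N → Set where
  me-empty : ∀ {M} → IsSimple M → E M ≡ ∅ → ME M
  me-coatom : ∀ {M} X → IsSimple M → Coatom M X → Modular M X →
              ME (M ∣ X) → ME M
  -- (iii) modular join P_X(M|E₁, M|E₂) over the round flat X = E₁ ∩ E₂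
  me-join : ∀ {M} E₁ E₂ → IsSimple M →
            ProperFlat M E₁ → Modular M E₁ →
            ProperFlat M E₂ → Modular M E₂ →
            E₁ ∪ E₂ ≡ E M → RoundFlat M (E₁ ∩ E₂) →
            ME (M ∣ E₁) → ME (M ∣ E₂) → ME M

{-# OPTIONS --safe #-}

-- A modular flat S splits the Möbius function of M: writing a flat V as the join of V ∩ S with a flat Y avoiding S
-- gives χ(M) = χ(M|S) · B(M, S), where B(M, S) = ∑ μ(Y) t^(r(E) - r(S) - r(Y)) over the flats Y with Y ∩ S = ∅.
-- If E = E₁ ∪ E₂ with both sides modular and Z = E₁ ∩ E₂, then B(M, E₁) = B(M|E₂, Z), so a divisional atom of M|E₂
-- outside Z is divisional in M.  By induction on the construction of M, for every round modular flat X ≠ E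
-- there is a divisional atom e ∉ X with si(M/e) ∈ ME.  If M is a join, X lies in one side and e is taken from the other.
-- If H is a modular coatom, either some e lies outside H ∪ X and si(M/e) ≅ M|H, or M is the join of X and H along
-- the round flat X ∩ H.
module Submission where

-- To stay divisional in M, an atom of M|E₂ must lie off E₁. Hence what is asked of M|E₂ is an atom
-- off Z = E₁ ∩ E₂, which is modular in M|E₂ and round; this is the origin of the flat X. Roundness
-- serves three times: a round X cannot be split between the two sides of a join; X ∩ H stays round
-- when X and a modular coatom H cover E; and the image of Z stays round in si(M/e), so that rule
-- (iii) applies there again.
--
-- The factorization is needed for M/e as well as for M. In M/e points become parallel, and a
-- modular flat S of M need not be closed any more. It is therefore stated for loopless matroids and
-- for sets S subject to a rank condition on the flats disjoint from S.
--
-- Membership in ME speaks of concrete subsets, and si keeps the least element of each parallel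
-- class, so E₁ and its image in si(M/e) can consist of different elements. They are matched by an
-- isomorphism, and ME is shown to be invariant under isomorphism.

open import Defs
open import Data.Nat as ℕ using (ℕ; zero; suc; _≤_; _<_; _∸_; z≤n; s≤s; s≤s⁻¹; _≡ᵇ_)
import Data.Nat.Properties as ℕP
open import Data.Nat.Induction using (<-wellFounded)
open import Induction.WellFounded using (Acc; acc)
open import Data.Integer using (ℤ; 0ℤ; 1ℤ; ≢-nonZero) renaming (_+_ to _+ℤ_; _*_ to _*ℤ_; -_ to -ℤ_)
import Data.Integer.Properties as ℤP
open import Data.Nat.Tactic.RingSolver using () renaming (solve-∀ to ℕ-solve-∀)
open import Data.Integer.Tactic.RingSolver using (solve-∀)
open import Data.Bool using (Bool; true; false; _∧_; not; if_then_else_; T)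
import Data.Bool.Properties as BoolP
open import Data.Fin using (Fin; zero; suc; toℕ)
open import Data.Fin.Subset using (Subset; _⊆_; _∩_; _∪_; _-_; ⁅_⁆; ∣_∣; _∈_; _∉_)
  renaming (⊥ to ∅)
open import Data.Fin.Subset.Properties
open import Data.List using (List; []; _∷_; map; _++_; upTo; applyUpTo; allFin)
import Data.List.Properties as ListP
open import Data.Vec using ([]; _∷_; lookup; tabulate; here; there)
open import Data.Vec.Properties using (≡-dec; lookup∘tabulate; []=⇒lookup; lookup⇒[]=)
open import Data.Product using (_×_; _,_; proj₁; proj₂; ∃; ∃-syntax)
import Data.Sum as Sum
open import Data.Sum using (_⊎_; inj₁; inj₂)
open import Data.Empty using (⊥; ⊥-elim)
open import Relation.Binary.PropositionalEquality
open import Relation.Nullary using (¬_; Dec; yes; no)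
open import Relation.Nullary.Decidable using (¬?; _×-dec_)
open import Relation.Binary.Definitions using (tri<; tri≈; tri>)
import Data.Fin.Properties as FinP
open import Data.List.Membership.Propositional using () renaming (_∈_ to _∈ᴸ_)
open import Data.List.Membership.Propositional.Properties using (∈-allFin)
import Data.List.Relation.Unary.Any as Any
open import Function using (_∘_; id)
open import Algebra.Properties.AbelianGroup ℤP.+-0-abelianGroup using () renaming (∙-cancelʳ to ℤ-cancelʳ; ∙-cancelˡ to ℤ-cancelˡ)

-- Finite sums

∑ : {A : Set} → List A → (A → ℤ) → ℤ
∑ L f = sumℤ (map f L)

-- Sums over flats become sums over all subsets weighted by these indicators, so that the order of
-- summation can be exchanged freely.
⟦_⟧ : Bool → ℤ
⟦ true ⟧ = 1ℤ
⟦ false ⟧ = 0ℤ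

⟦∧⟧ : ∀ a b → ⟦ a ∧ b ⟧ ≡ ⟦ a ⟧ *ℤ ⟦ b ⟧
⟦∧⟧ true b = sym (ℤP.*-identityˡ ⟦ b ⟧)
⟦∧⟧ false b = sym (ℤP.*-zeroˡ ⟦ b ⟧)

∑-cong : {A : Set} (L : List A) {f g : A → ℤ} → (∀ x → f x ≡ g x) → ∑ L f ≡ ∑ L g
∑-cong [] h = refl
∑-cong (x ∷ L) h = cong₂ _+ℤ_ (h x) (∑-cong L h)

∑-zero : {A : Set} (L : List A) {f : A → ℤ} → (∀ x → f x ≡ 0ℤ) → ∑ L f ≡ 0ℤ
∑-zero [] h = refl
∑-zero (x ∷ L) h = cong₂ _+ℤ_ (h x) (∑-zero L h)

∑-+ : {A : Set} (L : List A) (f g : A → ℤ) → ∑ L (λ x → f x +ℤ g x) ≡ ∑ L f +ℤ ∑ L g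
∑-+ [] f g = refl
∑-+ (x ∷ L) f g = trans (cong (λ z → (f x +ℤ g x) +ℤ z) (∑-+ L f g)) (swap (f x) (g x) _ _)
  where
  swap : ∀ a b c d → (a +ℤ b) +ℤ (c +ℤ d) ≡ (a +ℤ c) +ℤ (b +ℤ d)
  swap = solve-∀

∑-*ˡ : {A : Set} (L : List A) (c : ℤ) (f : A → ℤ) → ∑ L (λ x → c *ℤ f x) ≡ c *ℤ ∑ L f
∑-*ˡ [] c f = sym (ℤP.*-zeroʳ c)
∑-*ˡ (x ∷ L) c f = trans (cong ((c *ℤ f x) +ℤ_) (∑-*ˡ L c f)) (sym (ℤP.*-distribˡ-+ c (f x) _))

∑-*ʳ : {A : Set} (L : List A) (c : ℤ) (f : A → ℤ) → ∑ L (λ x → f x *ℤ c) ≡ ∑ L f *ℤ c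
∑-*ʳ L c f = trans (∑-cong L (λ x → ℤP.*-comm (f x) c)) (trans (∑-*ˡ L c f) (ℤP.*-comm c _))

∑-swap : {A B : Set} (L : List A) (K : List B) (f : A → B → ℤ) →
  ∑ L (λ x → ∑ K (f x)) ≡ ∑ K (λ y → ∑ L (λ x → f x y))
∑-swap [] K f = sym (∑-zero K (λ _ → refl))
∑-swap (x ∷ L) K f = trans (cong (∑ K (f x) +ℤ_) (∑-swap L K f)) (sym (∑-+ K (f x) _))

∑-++ : {A : Set} (L K : List A) (f : A → ℤ) → ∑ (L ++ K) f ≡ ∑ L f +ℤ ∑ K f
∑-++ [] K f = sym (ℤP.+-identityˡ _)
∑-++ (x ∷ L) K f = trans (cong (f x +ℤ_) (∑-++ L K f)) (sym (ℤP.+-assoc (f x) _ _))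

∑-map : {A B : Set} (h : A → B) (L : List A) (f : B → ℤ) → ∑ (map h L) f ≡ ∑ L (f ∘ h)
∑-map h L f = cong sumℤ (sym (ListP.map-∘ L))

∑-filter : {A : Set} (p : A → Bool) (L : List A) (f : A → ℤ) →
  ∑ (filterᵇ p L) f ≡ ∑ L (λ x → ⟦ p x ⟧ *ℤ f x)
∑-filter p [] f = refl
∑-filter p (x ∷ L) f with p x
... | true = cong₂ _+ℤ_ (sym (ℤP.*-identityˡ (f x))) (∑-filter p L f)
... | false = trans (∑-filter p L f) (sym (trans (cong (_+ℤ ∑ L (λ x → ⟦ p x ⟧ *ℤ f x)) (ℤP.*-zeroˡ (f x))) (ℤP.+-identityˡ (∑ L (λ x → ⟦ p x ⟧ *ℤ f x)))))

∑ˢ : ∀ {n} → (Subset n → ℤ) → ℤ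
∑ˢ {n} = ∑ (allSubsets n)

-- `allSubsets` lists each subset exactly once: the half whose head differs from that of A sums to
-- zero, and induction handles the other half.
∑ˢ-single : ∀ {n} (A : Subset n) (f : Subset n → ℤ) → (∀ X → X ≢ A → f X ≡ 0ℤ) → ∑ˢ f ≡ f A
∑ˢ-single [] f h = ℤP.+-identityʳ _
∑ˢ-single {suc n} (true ∷ A) f h = begin
  ∑ˢ f                                             ≡⟨ ∑-++ (map (true ∷_) (allSubsets n)) _ f ⟩
  ∑ (map (true ∷_) (allSubsets n)) f +ℤ ∑ (map (false ∷_) (allSubsets n)) f
    ≡⟨ cong₂ _+ℤ_ (∑-map (true ∷_) (allSubsets n) f) (∑-map (false ∷_) (allSubsets n) f) ⟩
  ∑ˢ (f ∘ (true ∷_)) +ℤ ∑ˢ (f ∘ (false ∷_))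
    ≡⟨ cong₂ _+ℤ_ (∑ˢ-single A _ (λ X ne → h _ (λ { refl → ne refl }))) (∑-zero (allSubsets n) (λ X → h _ λ ())) ⟩
  f (true ∷ A) +ℤ 0ℤ                               ≡⟨ ℤP.+-identityʳ _ ⟩
  f (true ∷ A) ∎
  where open ≡-Reasoning
∑ˢ-single {suc n} (false ∷ A) f h = begin
  ∑ˢ f                                             ≡⟨ ∑-++ (map (true ∷_) (allSubsets n)) _ f ⟩
  ∑ (map (true ∷_) (allSubsets n)) f +ℤ ∑ (map (false ∷_) (allSubsets n)) f
    ≡⟨ cong₂ _+ℤ_ (∑-map (true ∷_) (allSubsets n) f) (∑-map (false ∷_) (allSubsets n) f) ⟩
  ∑ˢ (f ∘ (true ∷_)) +ℤ ∑ˢ (f ∘ (false ∷_))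
    ≡⟨ cong₂ _+ℤ_ (∑-zero (allSubsets n) (λ X → h _ λ ())) (∑ˢ-single A _ (λ X ne → h _ (λ { refl → ne refl }))) ⟩
  0ℤ +ℤ f (false ∷ A)                              ≡⟨ ℤP.+-identityˡ _ ⟩
  f (false ∷ A) ∎
  where open ≡-Reasoning

-- Polynomials as coefficient functions

-- The monomial t^a; `δ 0` is the unit for `⊛`.
δ : ℕ → ℕ → ℤ
δ a k = ⟦ a ≡ᵇ k ⟧

-- The shift `p ∘ suc` is p without its constant term, divided by t. This recursion on the left
-- factor takes the place of the sum over `upTo` in the inductions on products.
⊛-suc : ∀ p q k → (p ⊛ q) (suc k) ≡ p 0 *ℤ q (suc k) +ℤ ((p ∘ suc) ⊛ q) k
⊛-suc p q k = cong (λ l → p 0 *ℤ q (suc k) +ℤ sumℤ l)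
  (trans (ListP.map-applyUpTo suc (λ i → p i *ℤ q (suc k ∸ i)) (suc k))
    (sym (ListP.map-applyUpTo id (λ i → p (suc i) *ℤ q (k ∸ i)) (suc k))))

⊛-cong : ∀ {p p′ q q′ : ℕ → ℤ} → (∀ k → p k ≡ p′ k) → (∀ k → q k ≡ q′ k) → ∀ k → (p ⊛ q) k ≡ (p′ ⊛ q′) k
⊛-cong hp hq k = ∑-cong (upTo (suc k)) (λ i → cong₂ _*ℤ_ (hp i) (hq (k ∸ i)))

⊛-distribʳ : ∀ s p q k → ((λ i → p i +ℤ q i) ⊛ s) k ≡ (p ⊛ s) k +ℤ (q ⊛ s) k
⊛-distribʳ s p q k = trans
  (∑-cong (upTo (suc k)) (λ i → ℤP.*-distribʳ-+ (s (k ∸ i)) (p i) (q i)))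
  (∑-+ (upTo (suc k)) (λ i → p i *ℤ s (k ∸ i)) (λ i → q i *ℤ s (k ∸ i)))

⊛-scaleˡ : ∀ c p s k → ((λ i → c *ℤ p i) ⊛ s) k ≡ c *ℤ (p ⊛ s) k
⊛-scaleˡ c p s k = trans
  (∑-cong (upTo (suc k)) (λ i → ℤP.*-assoc c (p i) (s (k ∸ i))))
  (∑-*ˡ (upTo (suc k)) c _)

⊛-zeroˡ : ∀ p s → (∀ i → p i ≡ 0ℤ) → ∀ k → (p ⊛ s) k ≡ 0ℤ
⊛-zeroˡ p s h k = ∑-zero (upTo (suc k)) (λ i → trans (cong (_*ℤ s (k ∸ i)) (h i)) (ℤP.*-zeroˡ (s (k ∸ i))))

⊛-assoc : ∀ p q s k → ((p ⊛ q) ⊛ s) k ≡ (p ⊛ (q ⊛ s)) k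
⊛-assoc p q s zero = lem (p 0) (q 0) (s 0)
  where
  lem : ∀ a b c → (a *ℤ b +ℤ 0ℤ) *ℤ c +ℤ 0ℤ ≡ a *ℤ (b *ℤ c +ℤ 0ℤ) +ℤ 0ℤ
  lem = solve-∀
⊛-assoc p q s (suc k) = begin
  ((p ⊛ q) ⊛ s) (suc k)
    ≡⟨ ⊛-suc (p ⊛ q) s k ⟩
  (p ⊛ q) 0 *ℤ s (suc k) +ℤ (((p ⊛ q) ∘ suc) ⊛ s) k
    ≡⟨ cong ((p ⊛ q) 0 *ℤ s (suc k) +ℤ_) (⊛-cong {q = s} (⊛-suc p q) (λ _ → refl) k) ⟩
  (p ⊛ q) 0 *ℤ s (suc k) +ℤ ((λ i → p 0 *ℤ q (suc i) +ℤ ((p ∘ suc) ⊛ q) i) ⊛ s) k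
    ≡⟨ cong ((p ⊛ q) 0 *ℤ s (suc k) +ℤ_) (⊛-distribʳ s (λ i → p 0 *ℤ q (suc i)) ((p ∘ suc) ⊛ q) k) ⟩
  (p ⊛ q) 0 *ℤ s (suc k) +ℤ (((λ i → p 0 *ℤ q (suc i)) ⊛ s) k +ℤ (((p ∘ suc) ⊛ q) ⊛ s) k)
    ≡⟨ cong₂ (λ x y → (p ⊛ q) 0 *ℤ s (suc k) +ℤ (x +ℤ y)) (⊛-scaleˡ (p 0) (q ∘ suc) s k) (⊛-assoc (p ∘ suc) q s k) ⟩
  (p ⊛ q) 0 *ℤ s (suc k) +ℤ (p 0 *ℤ ((q ∘ suc) ⊛ s) k +ℤ ((p ∘ suc) ⊛ (q ⊛ s)) k)
    ≡⟨ lem (p 0) (q 0) (s (suc k)) _ _ ⟩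
  p 0 *ℤ (q 0 *ℤ s (suc k) +ℤ ((q ∘ suc) ⊛ s) k) +ℤ ((p ∘ suc) ⊛ (q ⊛ s)) k
    ≡⟨ cong (λ x → p 0 *ℤ x +ℤ ((p ∘ suc) ⊛ (q ⊛ s)) k) (sym (⊛-suc q s k)) ⟩
  p 0 *ℤ (q ⊛ s) (suc k) +ℤ ((p ∘ suc) ⊛ (q ⊛ s)) k
    ≡⟨ sym (⊛-suc p (q ⊛ s) k) ⟩
  (p ⊛ (q ⊛ s)) (suc k) ∎
  where
  open ≡-Reasoning
  lem : ∀ a b c x y → (a *ℤ b +ℤ 0ℤ) *ℤ c +ℤ (a *ℤ x +ℤ y) ≡ a *ℤ (b *ℤ c +ℤ x) +ℤ y
  lem = solve-∀

⊛-δ0 : ∀ p k → (p ⊛ δ 0) k ≡ p k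
⊛-δ0 p zero = trans (ℤP.+-identityʳ _) (ℤP.*-identityʳ (p 0))
⊛-δ0 p (suc k) = trans (⊛-suc p (δ 0) k)
  (trans (cong₂ _+ℤ_ (ℤP.*-zeroʳ (p 0)) (⊛-δ0 (p ∘ suc) k)) (ℤP.+-identityˡ _))

⊛-comm-head : ∀ p q k → p 0 ≡ 0ℤ → (p ⊛ q) (suc k) ≡ ((p ∘ suc) ⊛ q) k
⊛-comm-head p q k h = trans (⊛-suc p q k)
  (trans (cong (_+ℤ ((p ∘ suc) ⊛ q) k) (trans (cong (_*ℤ q (suc k)) h) (ℤP.*-zeroˡ (q (suc k))))) (ℤP.+-identityˡ (((p ∘ suc) ⊛ q) k)))

-- Compare coefficients from below, starting at the lowest nonzero coefficient of p.
⊛-cancelˡ : ∀ n p f g → p n ≢ 0ℤ → (∀ k → (p ⊛ f) k ≡ (p ⊛ g) k) → ∀ k → f k ≡ g k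
⊛-cancelˡ n p f g pn≢0 h with p 0 ℤP.≟ 0ℤ
... | no p0≢0 = go
  where
  cancel0 : ∀ a b → p 0 *ℤ a ≡ p 0 *ℤ b → a ≡ b
  cancel0 a b = ℤP.*-cancelˡ-≡ (p 0) a b ⦃ ≢-nonZero p0≢0 ⦄
  go : ∀ k → f k ≡ g k
  go k = below (suc k) k ℕP.≤-refl
    where
    tail-eq : ∀ k (q : ℕ → ℤ) → (∀ j → j ≤ k → f j ≡ g j) → (q ⊛ f) k ≡ (q ⊛ g) k
    tail-eq zero q e = cong (λ z → q 0 *ℤ z +ℤ 0ℤ) (e 0 z≤n)
    tail-eq (suc k) q e = trans (⊛-suc q f k) (trans
      (cong₂ _+ℤ_ (cong (q 0 *ℤ_) (e (suc k) ℕP.≤-refl)) (tail-eq k (q ∘ suc) (λ j j≤ → e j (ℕP.m≤n⇒m≤1+n j≤))))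
      (sym (⊛-suc q g k)))
    below : ∀ m k → k < m → f k ≡ g k
    below (suc m) zero _ = cancel0 _ _ (trans (sym (ℤP.+-identityʳ _)) (trans (h 0) (ℤP.+-identityʳ _)))
    below (suc m) (suc k) (s≤s k<m) = cancel0 _ _ (ℤ-cancelʳ (((p ∘ suc) ⊛ f) k) _ _
      (trans (sym (⊛-suc p f k)) (trans (h (suc k)) (trans (⊛-suc p g k)
        (cong (p 0 *ℤ g (suc k) +ℤ_) (sym (tail-eq k (p ∘ suc) (λ j j≤k → below m j (ℕP.≤-<-trans j≤k k<m)))))))))
⊛-cancelˡ zero p f g pn≢0 h | yes p0≡0 = ⊥-elim (pn≢0 p0≡0)
⊛-cancelˡ (suc n) p f g pn≢0 h | yes p0≡0 = ⊛-cancelˡ n (p ∘ suc) f g pn≢0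
  (λ k → trans (sym (⊛-comm-head p f k p0≡0)) (trans (h (suc k)) (⊛-comm-head p g k p0≡0)))

-- The polynomial ∑ w(x) t^a(x).
gen : {A : Set} → List A → (A → ℕ) → (A → ℤ) → ℕ → ℤ
gen L a w k = ∑ L (λ x → w x *ℤ ⟦ a x ≡ᵇ k ⟧)

δ-⊛ : ∀ {A : Set} (L : List A) b v a k → (δ a ⊛ gen L b v) k ≡ gen L (λ y → a ℕ.+ b y) v k
δ-⊛ L b v zero zero = trans (ℤP.+-identityʳ _) (ℤP.*-identityˡ (gen L b v 0))
δ-⊛ L b v zero (suc k) = trans (⊛-suc (δ 0) (gen L b v) k)
  (trans (cong₂ _+ℤ_ (ℤP.*-identityˡ (gen L b v (suc k))) (⊛-zeroˡ _ (gen L b v) (λ _ → refl) k)) (ℤP.+-identityʳ _))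
δ-⊛ L b v (suc a) zero = trans (trans (ℤP.+-identityʳ _) (ℤP.*-zeroˡ (gen L b v 0)))
  (sym (∑-zero L (λ y → ℤP.*-zeroʳ (v y))))
δ-⊛ L b v (suc a) (suc k) = trans (⊛-comm-head (δ (suc a)) (gen L b v) k refl) (δ-⊛ L b v a k)

gen-⊛ : ∀ {A B : Set} (L : List A) (K : List B) a w b v k →
  (gen L a w ⊛ gen K b v) k ≡ ∑ L (λ x → ∑ K (λ y → (w x *ℤ v y) *ℤ ⟦ (a x ℕ.+ b y) ≡ᵇ k ⟧))
gen-⊛ [] K a w b v k = ⊛-zeroˡ _ (gen K b v) (λ _ → refl) k
gen-⊛ (x ∷ L) K a w b v k = trans (⊛-distribʳ (gen K b v) (λ i → w x *ℤ δ (a x) i) (gen L a w) k)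
  (cong₂ _+ℤ_
    (trans (⊛-scaleˡ (w x) (δ (a x)) (gen K b v) k)
      (trans (cong (w x *ℤ_) (δ-⊛ K b v (a x) k))
        (trans (sym (∑-*ˡ K (w x) _)) (∑-cong K (λ y → sym (ℤP.*-assoc (w x) (v y) _))))))
    (gen-⊛ L K a w b v k))

-- `_∣ₚ_` wants its quotient as a finite list; this supplies one for a coefficient function of
-- bounded degree.
coeffs-applyUpTo : ∀ (f : ℕ → ℤ) n → (∀ k → n ≤ k → f k ≡ 0ℤ) → ∀ k → coeffs (applyUpTo f n) k ≡ f k
coeffs-applyUpTo f zero h k = sym (h k z≤n)
coeffs-applyUpTo f (suc n) h zero = refl
coeffs-applyUpTo f (suc n) h (suc k) = coeffs-applyUpTo (f ∘ suc) n (λ j n≤j → h (suc j) (s≤s n≤j)) k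

-- Boolean tests

≡-from-⇔ : ∀ {a b} → (a ≡ true → b ≡ true) → (b ≡ true → a ≡ true) → a ≡ b
≡-from-⇔ {true} f g = sym (f refl)
≡-from-⇔ {false} {true} f g = g refl
≡-from-⇔ {false} {false} f g = refl

∧⁻ : ∀ {a b} → a ∧ b ≡ true → a ≡ true × b ≡ true
∧⁻ {true} {true} _ = refl , refl

∧⁺ : ∀ {a b} → a ≡ true → b ≡ true → a ∧ b ≡ true
∧⁺ refl refl = refl

≡ᵇ⇒≡ : ∀ {m n} → (m ≡ᵇ n) ≡ true → m ≡ n
≡ᵇ⇒≡ {m} {n} h = ℕP.≡ᵇ⇒≡ m n (subst T (sym h) _)

≡⇒≡ᵇ : ∀ {m n} → m ≡ n → (m ≡ᵇ n) ≡ true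
≡⇒≡ᵇ {zero} refl = refl
≡⇒≡ᵇ {suc m} refl = ≡⇒≡ᵇ {m} refl

⊆ᵇ⇒⊆ : ∀ {n} (X Y : Subset n) → (X ⊆ᵇ Y) ≡ true → X ⊆ Y
⊆ᵇ⇒⊆ (true ∷ X) (true ∷ Y) h here = here
⊆ᵇ⇒⊆ (true ∷ X) (true ∷ Y) h (there m) = there (⊆ᵇ⇒⊆ X Y h m)
⊆ᵇ⇒⊆ (false ∷ X) (y ∷ Y) h (there m) = there (⊆ᵇ⇒⊆ X Y h m)

⊆⇒⊆ᵇ : ∀ {n} (X Y : Subset n) → X ⊆ Y → (X ⊆ᵇ Y) ≡ true
⊆⇒⊆ᵇ [] [] h = refl
⊆⇒⊆ᵇ (true ∷ X) (true ∷ Y) h = ⊆⇒⊆ᵇ X Y (drop-∷-⊆ h)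
⊆⇒⊆ᵇ (true ∷ X) (false ∷ Y) h with () ← h here
⊆⇒⊆ᵇ (false ∷ X) (y ∷ Y) h = ⊆⇒⊆ᵇ X Y (drop-∷-⊆ h)

==ˢ⇒≡ : ∀ {n} (X Y : Subset n) → (X ==ˢ Y) ≡ true → X ≡ Y
==ˢ⇒≡ X Y h with ≡-dec BoolP._≟_ X Y
... | yes e = e

≡⇒==ˢ : ∀ {n} (X Y : Subset n) → X ≡ Y → (X ==ˢ Y) ≡ true
≡⇒==ˢ X Y h with ≡-dec BoolP._≟_ X Y
... | yes e = refl
... | no ne = ⊥-elim (ne h)

≢⇒==ˢ : ∀ {n} (X Y : Subset n) → X ≢ Y → (X ==ˢ Y) ≡ false
≢⇒==ˢ X Y h with ≡-dec BoolP._≟_ X Y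
... | yes e = ⊥-elim (h e)
... | no ne = refl

⊆∧≢⇒∣∣< : ∀ {n} (X Y : Subset n) → X ⊆ Y → X ≢ Y → ∣ X ∣ < ∣ Y ∣
⊆∧≢⇒∣∣< X Y X⊆Y X≢Y with Y ⊆? X
... | yes Y⊆X = ⊥-elim (X≢Y (⊆-antisym X⊆Y Y⊆X))
... | no Y⊈X = ℕP.≤∧≢⇒< (p⊆q⇒∣p∣≤∣q∣ X⊆Y) λ e → Y⊈X λ {x} x∈Y → lem e x∈Y
  where
  lem : ∣ X ∣ ≡ ∣ Y ∣ → ∀ {x} → x ∈ Y → x ∈ X
  lem e {x} x∈Y with x ∈? X
  ... | yes x∈X = x∈X
  ... | no x∉X = ⊥-elim (ℕP.<-irrefl e (p⊂q⇒∣p∣<∣q∣ (X⊆Y , x , x∈Y , x∉X)))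

⊊ᵇ⇒∣∣< : ∀ {n} (X Y : Subset n) → (X ⊊ᵇ Y) ≡ true → ∣ X ∣ < ∣ Y ∣
⊊ᵇ⇒∣∣< X Y h with ∧⁻ {X ⊆ᵇ Y} h
... | a , b = ⊆∧≢⇒∣∣< X Y (⊆ᵇ⇒⊆ X Y a) λ e → lem (≡⇒==ˢ X Y e) b
  where
  lem : ∀ {c} → c ≡ true → not c ≡ true → ⊥
  lem refl ()

⟦⊆⟧-split : ∀ {n} (V W : Subset n) → ⟦ V ⊆ᵇ W ⟧ ≡ ⟦ V ⊊ᵇ W ⟧ +ℤ ⟦ V ==ˢ W ⟧
⟦⊆⟧-split V W with ≡-dec BoolP._≟_ V W
... | yes refl rewrite ⊆⇒⊆ᵇ V V id = refl
... | no _ with V ⊆ᵇ W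
...   | true = refl
...   | false = refl

-- Möbius inversion

-- Imposed at every W satisfying p, this relation characterizes the Möbius function of the sets
-- satisfying p. The bottom element is taken to be ∅, which is right for the flats of a loopless
-- matroid.
MöbiusLaw : ∀ {n} → (Subset n → Bool) → (Subset n → ℤ) → Subset n → Set
MöbiusLaw p f W = ∑ˢ (λ V → ⟦ p V ⟧ *ℤ (⟦ V ⊆ᵇ W ⟧ *ℤ f V)) ≡ ⟦ W ==ˢ ∅ ⟧

∑-split : ∀ {n} (p : Subset n → Bool) (f : Subset n → ℤ) W → p W ≡ true →
  ∑ˢ (λ V → ⟦ p V ⟧ *ℤ (⟦ V ⊆ᵇ W ⟧ *ℤ f V)) ≡
  ∑ˢ (λ V → ⟦ p V ⟧ *ℤ (⟦ V ⊊ᵇ W ⟧ *ℤ f V)) +ℤ f W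
∑-split {n} p f W pW = begin
  ∑ˢ (λ V → ⟦ p V ⟧ *ℤ (⟦ V ⊆ᵇ W ⟧ *ℤ f V))
    ≡⟨ ∑-cong (allSubsets n) (λ V → trans (cong (λ z → ⟦ p V ⟧ *ℤ (z *ℤ f V)) (⟦⊆⟧-split V W)) (dist ⟦ p V ⟧ ⟦ V ⊊ᵇ W ⟧ ⟦ V ==ˢ W ⟧ (f V))) ⟩
  ∑ˢ (λ V → ⟦ p V ⟧ *ℤ (⟦ V ⊊ᵇ W ⟧ *ℤ f V) +ℤ ⟦ p V ⟧ *ℤ (⟦ V ==ˢ W ⟧ *ℤ f V))
    ≡⟨ ∑-+ (allSubsets n) (λ V → ⟦ p V ⟧ *ℤ (⟦ V ⊊ᵇ W ⟧ *ℤ f V)) (λ V → ⟦ p V ⟧ *ℤ (⟦ V ==ˢ W ⟧ *ℤ f V)) ⟩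
  ∑ˢ (λ V → ⟦ p V ⟧ *ℤ (⟦ V ⊊ᵇ W ⟧ *ℤ f V)) +ℤ ∑ˢ (λ V → ⟦ p V ⟧ *ℤ (⟦ V ==ˢ W ⟧ *ℤ f V))
    ≡⟨ cong (∑ˢ (λ V → ⟦ p V ⟧ *ℤ (⟦ V ⊊ᵇ W ⟧ *ℤ f V)) +ℤ_) (trans
         (∑ˢ-single W _ (λ V V≢W → trans (cong (λ b → ⟦ p V ⟧ *ℤ (⟦ b ⟧ *ℤ f V)) (≢⇒==ˢ V W V≢W)) (nil ⟦ p V ⟧ (f V))))
         (trans (cong₂ (λ a b → ⟦ a ⟧ *ℤ (⟦ b ⟧ *ℤ f W)) pW (≡⇒==ˢ W W refl)) (one (f W)))) ⟩
  ∑ˢ (λ V → ⟦ p V ⟧ *ℤ (⟦ V ⊊ᵇ W ⟧ *ℤ f V)) +ℤ f W ∎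
  where
  open ≡-Reasoning
  dist : ∀ a b c d → a *ℤ ((b +ℤ c) *ℤ d) ≡ a *ℤ (b *ℤ d) +ℤ a *ℤ (c *ℤ d)
  dist = solve-∀
  nil : ∀ a b → a *ℤ (0ℤ *ℤ b) ≡ 0ℤ
  nil = solve-∀
  one : ∀ a → 1ℤ *ℤ (1ℤ *ℤ a) ≡ a
  one = solve-∀

∑-strict-cong : ∀ {n} (p : Subset n → Bool) (f g : Subset n → ℤ) W →
  (∀ V → p V ≡ true → ∣ V ∣ < ∣ W ∣ → f V ≡ g V) →
  ∑ˢ (λ V → ⟦ p V ⟧ *ℤ (⟦ V ⊊ᵇ W ⟧ *ℤ f V)) ≡ ∑ˢ (λ V → ⟦ p V ⟧ *ℤ (⟦ V ⊊ᵇ W ⟧ *ℤ g V))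
∑-strict-cong {n} p f g W h = ∑-cong (allSubsets n) pt
  where
  pt : ∀ V → ⟦ p V ⟧ *ℤ (⟦ V ⊊ᵇ W ⟧ *ℤ f V) ≡ ⟦ p V ⟧ *ℤ (⟦ V ⊊ᵇ W ⟧ *ℤ g V)
  pt V with p V in e₁ | V ⊊ᵇ W in e₂
  ... | true | true = cong (λ z → 1ℤ *ℤ (1ℤ *ℤ z)) (h V e₁ (⊊ᵇ⇒∣∣< V W e₂))
  ... | true | false = cong (1ℤ *ℤ_) (trans (ℤP.*-zeroˡ (f V)) (sym (ℤP.*-zeroˡ (g V))))
  ... | false | b = trans (ℤP.*-zeroˡ (⟦ b ⟧ *ℤ f V)) (sym (ℤP.*-zeroˡ (⟦ b ⟧ *ℤ g V)))

-- Strong induction on `∣ W ∣`: once the values strictly below W agree, the law at W determines the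
-- last term. Möbius functions of different matroids are compared through this, without returning to
-- the fuel.
MöbiusLaw-unique : ∀ {n} (p : Subset n → Bool) (f g : Subset n → ℤ) →
  (∀ W → p W ≡ true → MöbiusLaw p f W) → (∀ W → p W ≡ true → MöbiusLaw p g W) →
  ∀ W → p W ≡ true → f W ≡ g W
MöbiusLaw-unique p f g hf hg W pW = go W pW (<-wellFounded ∣ W ∣)
  where
  go : ∀ W → p W ≡ true → Acc _<_ ∣ W ∣ → f W ≡ g W
  go W pW (acc rs) = ℤ-cancelˡ (∑ˢ (λ V → ⟦ p V ⟧ *ℤ (⟦ V ⊊ᵇ W ⟧ *ℤ f V))) _ _
    (trans (sym (∑-split p f W pW)) (trans (hf W pW) (trans (sym (hg W pW)) (trans (∑-split p g W pW)
      (cong (_+ℤ g W) (sym (∑-strict-cong p f g W (λ V pV V< → go V pV (rs V<)))))))))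

module _ {N : ℕ} (M : RawMatroid N) where

  μ-fuel-suc : ∀ k X → μ-fuel M (suc k) X ≡
    (if X ==ˢ bottom M then 1ℤ else -ℤ ∑ˢ (λ V → ⟦ isFlatᵇ M V ⟧ *ℤ (⟦ V ⊊ᵇ X ⟧ *ℤ μ-fuel M k V)))
  μ-fuel-suc k X = cong (λ z → if X ==ˢ bottom M then 1ℤ else -ℤ z)
    (trans (∑-filter (λ Y → Y ⊊ᵇ X) (flats M) (μ-fuel M k)) (∑-filter (isFlatᵇ M) (allSubsets N) _))

  -- Each recursive call passes to a strictly smaller set, so fuel above `∣ X ∣` never runs out.
  μ-fuel-stable : ∀ k l X → ∣ X ∣ < k → ∣ X ∣ < l → μ-fuel M k X ≡ μ-fuel M l X
  μ-fuel-stable (suc k) (suc l) X (s≤s X≤k) (s≤s X≤l) = trans (μ-fuel-suc k X) (trans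
    (cong (λ z → if X ==ˢ bottom M then 1ℤ else -ℤ z)
      (∑-strict-cong (isFlatᵇ M) (μ-fuel M k) (μ-fuel M l) X
        (λ V _ V<X → μ-fuel-stable k l V (ℕP.<-≤-trans V<X X≤k) (ℕP.<-≤-trans V<X X≤l))))
    (sym (μ-fuel-suc l X)))

  μ-rec : ∀ X → μ M X ≡
    (if X ==ˢ bottom M then 1ℤ else -ℤ ∑ˢ (λ V → ⟦ isFlatᵇ M V ⟧ *ℤ (⟦ V ⊊ᵇ X ⟧ *ℤ μ M V)))
  μ-rec X = trans (μ-fuel-suc N X) (cong (λ z → if X ==ˢ bottom M then 1ℤ else -ℤ z)
    (∑-strict-cong (isFlatᵇ M) (μ-fuel M N) (μ M) X
      -- Since ∣V∣ < ∣X∣ ≤ N, the fuel N left after one step is still enough.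
      (λ V _ V<X → μ-fuel-stable N (suc N) V (ℕP.<-≤-trans V<X (∣p∣≤n X)) (s≤s (∣p∣≤n V)))))

  -- For W ≠ ∅ the recursion makes μ(W) cancel the sum over the smaller flats; for W = ∅ that sum
  -- vanishes and μ(∅) = 1.
  μ-law : bottom M ≡ ∅ → ∀ W → isFlatᵇ M W ≡ true → MöbiusLaw (isFlatᵇ M) (μ M) W
  μ-law b W fW = trans (∑-split (isFlatᵇ M) (μ M) W fW) (trans (cong (strict +ℤ_) (μ-rec W))
    (trans (cong (λ B → strict +ℤ (if W ==ˢ B then 1ℤ else -ℤ strict)) b) (fin strict strict≡0)))
    where
    strict = ∑ˢ (λ V → ⟦ isFlatᵇ M V ⟧ *ℤ (⟦ V ⊊ᵇ W ⟧ *ℤ μ M V))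
    nil : ∀ a b → a *ℤ (0ℤ *ℤ b) ≡ 0ℤ
    nil = solve-∀
    strict≡0 : W ≡ ∅ → strict ≡ 0ℤ
    strict≡0 refl = ∑-zero (allSubsets N) λ V → trans (cong (λ z → ⟦ isFlatᵇ M V ⟧ *ℤ (⟦ z ⟧ *ℤ μ M V)) (not⊊ V))
      (nil ⟦ isFlatᵇ M V ⟧ (μ M V))
      where
      not⊊ : ∀ V → (V ⊊ᵇ ∅) ≡ false
      not⊊ V with V ⊊ᵇ ∅ in e
      ... | false = refl
      ... | true with () ← subst (∣ V ∣ <_) (∣⊥∣≡0 N) (⊊ᵇ⇒∣∣< V ∅ e)
    fin : ∀ s → (W ≡ ∅ → s ≡ 0ℤ) → s +ℤ (if W ==ˢ ∅ then 1ℤ else -ℤ s) ≡ ⟦ W ==ˢ ∅ ⟧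
    fin s s≡0 with W ==ˢ ∅ in e
    ... | true = cong (_+ℤ 1ℤ) (s≡0 (==ˢ⇒≡ W ∅ e))
    ... | false = ℤP.+-inverseʳ s

  χ-gen : ∀ k → χ M k ≡
    gen (allSubsets N) (λ V → r M (E M) ∸ r M V) (λ V → ⟦ isFlatᵇ M V ⟧ *ℤ μ M V) k
  χ-gen k = trans (∑-filter _ (flats M) (μ M)) (trans (∑-filter (isFlatᵇ M) (allSubsets N) _)
    (∑-cong (allSubsets N) (λ V → lem ⟦ isFlatᵇ M V ⟧ ⟦ (r M (E M) ∸ r M V) ≡ᵇ k ⟧ (μ M V))))
    where
    lem : ∀ a b c → a *ℤ (b *ℤ c) ≡ (a *ℤ c) *ℤ b
    lem = solve-∀

-- Subsets

∪-lub : ∀ {n} {A B C : Subset n} → A ⊆ C → B ⊆ C → A ∪ B ⊆ C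
∪-lub {A = A} {B} A⊆C B⊆C m with x∈p∪q⁻ A B m
... | inj₁ a = A⊆C a
... | inj₂ b = B⊆C b

⁅⁆-⊆ : ∀ {n} {A : Subset n} {x} → x ∈ A → ⁅ x ⁆ ⊆ A
⁅⁆-⊆ {A = A} {x} x∈A {y} m = subst (_∈ A) (sym (x∈⁅y⁆⇒x≡y x m)) x∈A

∪⁅⁆-lub : ∀ {n} {A C : Subset n} {x} → A ⊆ C → x ∈ C → A ∪ ⁅ x ⁆ ⊆ C
∪⁅⁆-lub {A = A} {C} {x} A⊆C x∈C = ∪-lub {A = A} {⁅ x ⁆} {C} A⊆C (⁅⁆-⊆ {A = C} x∈C)

∪-mono : ∀ {n} {A B C D : Subset n} → A ⊆ C → B ⊆ D → A ∪ B ⊆ C ∪ D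
∪-mono {A = A} {B} {C} {D} p q = ∪-lub {A = A} {B} {C ∪ D} (λ a → p⊆p∪q D (p a)) (λ b → q⊆p∪q C D (q b))

∈-tabulate⁻ : ∀ {n} {f : Fin n → Bool} {x} → x ∈ tabulate f → f x ≡ true
∈-tabulate⁻ {f = f} {x} m = trans (sym (lookup∘tabulate f x)) ([]=⇒lookup m)

∈-tabulate⁺ : ∀ {n} {f : Fin n → Bool} {x} → f x ≡ true → x ∈ tabulate f
∈-tabulate⁺ {f = f} {x} h = lookup⇒[]= x (tabulate f) (trans (lookup∘tabulate f x) h)

∈⇒lookup : ∀ {n} {A : Subset n} {x} → x ∈ A → lookup A x ≡ true
∈⇒lookup = []=⇒lookup

lookup⇒∈ : ∀ {n} {A : Subset n} {x} → lookup A x ≡ true → x ∈ A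
lookup⇒∈ {A = A} {x} = lookup⇒[]= x A

∈-⁻ : ∀ {n} {A : Subset n} {x y} → x ∈ A - y → x ∈ A × x ≢ y
∈-⁻ {A = A} {x} {y} m = p─q⊆p A ⁅ y ⁆ m , λ { refl → lem A y m }
  where
  lem : ∀ {n} (A : Subset n) y → y ∉ A - y
  lem (a ∷ A) zero ()
  lem (a ∷ A) (suc y) (there m) = lem A y m

Disjoint⇒∅ : ∀ {n} {A B : Subset n} → (∀ {x} → x ∈ A → x ∈ B → ⊥) → A ∩ B ≡ ∅
Disjoint⇒∅ {A = A} {B} h = Empty-unique λ (x , m) → h (proj₁ (x∈p∩q⁻ A B m)) (proj₂ (x∈p∩q⁻ A B m))

∅⇒Disjoint : ∀ {n} {A B : Subset n} {x} → A ∩ B ≡ ∅ → x ∈ A → x ∈ B → ⊥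
∅⇒Disjoint {x = x} e a b = ∉⊥ (subst (x ∈_) e (x∈p∩q⁺ (a , b)))

-- Closure and flats

module _ {N : ℕ} {M : RawMatroid N} where

  ∈-cl⁺ : ∀ {X f} → f ∈ E M → r M (X ∪ ⁅ f ⁆) ≡ r M X → f ∈ cl M X
  ∈-cl⁺ f∈E e = ∈-tabulate⁺ (∧⁺ (∈⇒lookup f∈E) (≡⇒≡ᵇ e))

  ∈-cl⁻ : ∀ {X f} → f ∈ cl M X → f ∈ E M × r M (X ∪ ⁅ f ⁆) ≡ r M X
  ∈-cl⁻ {X} {f} m with ∧⁻ {lookup (E M) f} (∈-tabulate⁻ m)
  ... | a , b = lookup⇒∈ a , ≡ᵇ⇒≡ b

  cl⊆E : ∀ {X} → cl M X ⊆ E M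
  cl⊆E m = proj₁ (∈-cl⁻ m)

  Flat⇒isFlatᵇ : ∀ {X} → Flat M X → isFlatᵇ M X ≡ true
  Flat⇒isFlatᵇ {X} (s , c) = ∧⁺ (⊆⇒⊆ᵇ X (E M) s) (≡⇒==ˢ (cl M X) X c)

  isFlatᵇ⇒Flat : ∀ {X} → isFlatᵇ M X ≡ true → Flat M X
  isFlatᵇ⇒Flat {X} h with ∧⁻ {X ⊆ᵇ E M} h
  ... | a , b = ⊆ᵇ⇒⊆ X (E M) a , ==ˢ⇒≡ (cl M X) X b

-- This is what the contraction of a simple matroid by a point retains, and it makes ∅ the bottom
-- flat.
Loopless : ∀ {N} → RawMatroid N → Set
Loopless M = ∀ e → e ∈ E M → r M ⁅ e ⁆ ≢ 0

module Rank {N : ℕ} {M : RawMatroid N} (mat : IsMatroid M) where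
  open IsMatroid mat

  mono : ∀ {X Y} → Y ⊆ E M → X ⊆ Y → r M X ≤ r M Y
  mono {X} {Y} = r-mono X Y

  r∅ : r M ∅ ≡ 0
  r∅ = ℕP.n≤0⇒n≡0 (subst (r M ∅ ≤_) (∣⊥∣≡0 N) (r-card ∅ ⊥⊆))

  submod-⊆ : ∀ {X Y C} → X ⊆ E M → Y ⊆ E M → C ⊆ X → C ⊆ Y → r M (X ∪ Y) ℕ.+ r M C ≤ r M X ℕ.+ r M Y
  submod-⊆ {X} {Y} {C} X⊆E Y⊆E C⊆X C⊆Y = ℕP.≤-trans
    (ℕP.+-monoʳ-≤ (r M (X ∪ Y)) (mono (λ m → X⊆E (p∩q⊆p X Y m)) (λ m → x∈p∩q⁺ (C⊆X m , C⊆Y m))))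
    (r-submod X Y X⊆E Y⊆E)

  subadd : ∀ {X Y} → X ⊆ E M → Y ⊆ E M → r M (X ∪ Y) ≤ r M X ℕ.+ r M Y
  subadd {X} {Y} X⊆E Y⊆E = ℕP.≤-trans (ℕP.m≤m+n _ (r M ∅)) (submod-⊆ {C = ∅} X⊆E Y⊆E ⊥⊆ ⊥⊆)

  r⁅⁆≤1 : ∀ {x} → x ∈ E M → r M ⁅ x ⁆ ≤ 1
  r⁅⁆≤1 {x} x∈E = subst (r M ⁅ x ⁆ ≤_) (∣⁅x⁆∣≡1 x) (r-card ⁅ x ⁆ (⁅⁆-⊆ x∈E))

  r-∪⁅⁆≤suc : ∀ {X x} → X ⊆ E M → x ∈ E M → r M (X ∪ ⁅ x ⁆) ≤ suc (r M X)
  r-∪⁅⁆≤suc {X} {x} X⊆E x∈E = ℕP.≤-trans (subadd X⊆E (⁅⁆-⊆ x∈E))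
    (subst (r M X ℕ.+ r M ⁅ x ⁆ ≤_) (ℕP.+-comm (r M X) 1) (ℕP.+-monoʳ-≤ (r M X) (r⁅⁆≤1 x∈E)))

  -- Submodularity for B and A ∪ Z, which both contain A.
  spanned-mono : ∀ {A B Z} → B ⊆ E M → Z ⊆ E M → A ⊆ B → r M (A ∪ Z) ≤ r M A → r M (B ∪ Z) ≤ r M B
  spanned-mono {A} {B} {Z} B⊆E Z⊆E A⊆B h = ℕP.+-cancelʳ-≤ (r M A) _ _ (begin
    r M (B ∪ Z) ℕ.+ r M A        ≤⟨ ℕP.+-monoˡ-≤ (r M A) (mono (∪-lub {A = B} B⊆E AZ⊆E) (∪-mono {A = B} {Z} id (q⊆p∪q A Z))) ⟩
    r M (B ∪ (A ∪ Z)) ℕ.+ r M A  ≤⟨ submod-⊆ B⊆E AZ⊆E A⊆B (p⊆p∪q Z) ⟩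
    r M B ℕ.+ r M (A ∪ Z)        ≤⟨ ℕP.+-monoʳ-≤ (r M B) h ⟩
    r M B ℕ.+ r M A              ∎)
    where
    open ℕP.≤-Reasoning
    AZ⊆E : A ∪ Z ⊆ E M
    AZ⊆E = ∪-lub {A = A} {Z} (λ m → B⊆E (A⊆B m)) Z⊆E

  -- B is adjoined one element at a time, along the list of all elements; `spanned-mono` carries the
  -- hypothesis on A over to A with the elements added so far.
  ∪-absorb : ∀ {A B} → A ⊆ E M → B ⊆ E M → (∀ b → b ∈ B → r M (A ∪ ⁅ b ⁆) ≤ r M A) → r M (A ∪ B) ≤ r M A
  ∪-absorb {A} {B} A⊆E B⊆E h = ℕP.≤-trans (mono AL⊆E (∪-mono {A = A} {B} id (λ m → covers (allFin N) (∈-allFin _) m)))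
      (go (allFin N))
    where
    pick : List (Fin N) → Subset N
    pick [] = ∅
    pick (x ∷ xs) = if lookup B x then pick xs ∪ ⁅ x ⁆ else pick xs
    pick⊆E : ∀ xs → pick xs ⊆ E M
    pick⊆E [] m = ⊥-elim (∉⊥ m)
    pick⊆E (x ∷ xs) with lookup B x in e
    ... | true = ∪⁅⁆-lub {A = pick xs} (pick⊆E xs) (B⊆E (lookup⇒∈ e))
    ... | false = pick⊆E xs
    covers : ∀ xs {x} → x ∈ᴸ xs → x ∈ B → x ∈ pick xs
    covers (y ∷ ys) (Any.here refl) x∈B rewrite ∈⇒lookup x∈B = q⊆p∪q (pick ys) ⁅ y ⁆ (x∈⁅x⁆ y)
    covers (y ∷ ys) (Any.there m) x∈B with lookup B y
    ... | true = p⊆p∪q ⁅ y ⁆ (covers ys m x∈B)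
    ... | false = covers ys m x∈B
    AL⊆E : A ∪ pick (allFin N) ⊆ E M
    AL⊆E = ∪-lub {A = A} A⊆E (pick⊆E (allFin N))
    go : ∀ xs → r M (A ∪ pick xs) ≤ r M A
    go [] = ℕP.≤-reflexive (cong (r M) (∪-identityʳ A))
    go (x ∷ xs) with lookup B x in e
    ... | false = go xs
    ... | true = ℕP.≤-trans (ℕP.≤-reflexive (cong (r M) (sym (∪-assoc A (pick xs) ⁅ x ⁆))))
        (ℕP.≤-trans (spanned-mono {A} {A ∪ pick xs} {⁅ x ⁆} (∪-lub {A = A} A⊆E (pick⊆E xs)) (⁅⁆-⊆ (B⊆E x∈B)) (p⊆p∪q (pick xs)) (h x x∈B)) (go xs))
      where x∈B = lookup⇒∈ e

  flat-intro : ∀ {X} → X ⊆ E M → (∀ f → f ∈ E M → r M (X ∪ ⁅ f ⁆) ≤ r M X → f ∈ X) → Flat M X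
  flat-intro {X} X⊆E h = X⊆E , ⊆-antisym
    (λ m → h _ (cl⊆E {M = M} m) (ℕP.≤-reflexive (proj₂ (∈-cl⁻ {M = M} m))))
    (λ m → ∈-cl⁺ {M = M} (X⊆E m) (cong (r M) (⊆-antisym (∪⁅⁆-lub {A = X} id m) (p⊆p∪q _))))

  flat-closed : ∀ {X f} → Flat M X → f ∈ E M → r M (X ∪ ⁅ f ⁆) ≤ r M X → f ∈ X
  flat-closed {X} {f} (X⊆E , c) f∈E h = subst (f ∈_) c (∈-cl⁺ {M = M} f∈E
    (ℕP.≤-antisym h (mono (∪⁅⁆-lub {A = X} X⊆E f∈E) (p⊆p∪q _))))

  flat-maximal : ∀ {X Y} → Flat M X → Y ⊆ E M → X ⊆ Y → r M Y ≤ r M X → Y ⊆ X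
  flat-maximal {X} {Y} FX Y⊆E X⊆Y h m = flat-closed FX (Y⊆E m)
    (ℕP.≤-trans (mono Y⊆E (∪⁅⁆-lub {A = X} X⊆Y m)) h)

  ⊆cl : ∀ {X} → X ⊆ E M → X ⊆ cl M X
  ⊆cl {X} X⊆E {x} m = ∈-cl⁺ {M = M} (X⊆E m) (cong (r M) (⊆-antisym (∪⁅⁆-lub {A = X} id m) (p⊆p∪q _)))

  r-cl : ∀ {X} → X ⊆ E M → r M (cl M X) ≡ r M X
  r-cl {X} X⊆E = ℕP.≤-antisym
    (ℕP.≤-trans (mono (∪-lub {A = X} X⊆E (cl⊆E {M = M})) (q⊆p∪q X _))
      (∪-absorb X⊆E (cl⊆E {M = M}) (λ b m → ℕP.≤-reflexive (proj₂ (∈-cl⁻ {M = M} m)))))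
    (mono (cl⊆E {M = M}) (⊆cl X⊆E))

  r-∪cl : ∀ {X Y} → X ⊆ E M → Y ⊆ E M → r M (X ∪ cl M Y) ≡ r M (X ∪ Y)
  r-∪cl {X} {Y} X⊆E Y⊆E = ℕP.≤-antisym
    (ℕP.≤-trans
      (mono (∪-lub {A = X ∪ Y} XY⊆E (cl⊆E {M = M})) (∪-mono {A = X} {cl M Y} (p⊆p∪q Y) id))
      (spanned-mono XY⊆E (cl⊆E {M = M}) (q⊆p∪q X Y)
        (ℕP.≤-trans (mono (cl⊆E {M = M}) (∪-lub {A = Y} (⊆cl Y⊆E) id)) (ℕP.≤-reflexive (r-cl Y⊆E)))))
    (mono (∪-lub {A = X} X⊆E (cl⊆E {M = M})) (∪-mono {A = X} {Y} id (⊆cl Y⊆E)))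
    where
    XY⊆E : X ∪ Y ⊆ E M
    XY⊆E = ∪-lub {A = X} X⊆E Y⊆E

  cl-least : ∀ {X F} → X ⊆ F → Flat M F → cl M X ⊆ F
  cl-least {X} {F} X⊆F FF m with ∈-cl⁻ {M = M} m
  ... | f∈E , e = flat-closed FF f∈E (spanned-mono (proj₁ FF) (⁅⁆-⊆ f∈E) X⊆F (ℕP.≤-reflexive e))

  cl-flat : ∀ {X} → X ⊆ E M → Flat M (cl M X)
  cl-flat {X} X⊆E = flat-intro (cl⊆E {M = M}) λ f f∈E h → ∈-cl⁺ {M = M} f∈E (ℕP.≤-antisym
    (ℕP.≤-trans (mono (∪⁅⁆-lub {A = cl M X} (cl⊆E {M = M}) f∈E) (∪-mono {A = X} {⁅ f ⁆} (⊆cl X⊆E) id))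
      (ℕP.≤-trans h (ℕP.≤-reflexive (r-cl X⊆E))))
    (mono (∪⁅⁆-lub {A = X} X⊆E f∈E) (p⊆p∪q _)))

  E-flat : Flat M (E M)
  E-flat = flat-intro id (λ f f∈E _ → f∈E)

  ∩-flat : ∀ {X Y} → Flat M X → Flat M Y → Flat M (X ∩ Y)
  ∩-flat {X} {Y} FX FY = flat-intro (λ m → proj₁ FX (p∩q⊆p X Y m)) λ f f∈E h → x∈p∩q⁺
    ( flat-closed FX f∈E (spanned-mono (proj₁ FX) (⁅⁆-⊆ f∈E) (p∩q⊆p X Y) h)
    , flat-closed FY f∈E (spanned-mono (proj₁ FY) (⁅⁆-⊆ f∈E) (p∩q⊆q X Y) h))

  r-flat∪⁅⁆ : ∀ {X x} → Flat M X → x ∈ E M → x ∉ X → r M (X ∪ ⁅ x ⁆) ≡ suc (r M X)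
  r-flat∪⁅⁆ {X} {x} FX x∈E x∉X = ℕP.≤-antisym (r-∪⁅⁆≤suc (proj₁ FX) x∈E)
    (ℕP.≰⇒> λ h → x∉X (flat-closed FX x∈E h))

  cl∅ : Loopless M → cl M ∅ ≡ ∅
  cl∅ ll = Empty-unique λ (x , m) → ll x (cl⊆E {M = M} m)
    (trans (cong (r M) (sym (∪-identityˡ ⁅ x ⁆))) (trans (proj₂ (∈-cl⁻ {M = M} m)) r∅))

  restrict : ∀ {X} → X ⊆ E M → IsMatroid (M ∣ X)
  restrict X⊆E = record
    { r-card = λ A A⊆X → r-card A (λ m → X⊆E (A⊆X m))
    ; r-mono = λ A B B⊆X → r-mono A B (λ m → X⊆E (B⊆X m))
    ; r-submod = λ A B A⊆X B⊆X → r-submod A B (λ m → X⊆E (A⊆X m)) (λ m → X⊆E (B⊆X m)) }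

module _ {N : ℕ} {M : RawMatroid N} (mat : IsMatroid M) where
  open Rank mat

  flat-restrict : ∀ {X F} → X ⊆ E M → Flat M F → Flat (M ∣ X) (F ∩ X)
  flat-restrict {X} {F} X⊆E FF = Rank.flat-intro (restrict X⊆E) (p∩q⊆q F X) λ f f∈X h → x∈p∩q⁺
    (flat-closed FF (X⊆E f∈X) (spanned-mono (proj₁ FF) (⁅⁆-⊆ (X⊆E f∈X)) (p∩q⊆p F X) h) , f∈X)

  flat-restrict-⊆ : ∀ {X F} → X ⊆ E M → F ⊆ X → Flat M F → Flat (M ∣ X) F
  flat-restrict-⊆ {X} {F} X⊆E F⊆X FF = subst (Flat (M ∣ X)) (⊆-antisym (p∩q⊆p F X) (λ m → x∈p∩q⁺ (m , F⊆X m)))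
    (flat-restrict X⊆E FF)

  flat-unrestrict : ∀ {X F} → Flat M X → Flat (M ∣ X) F → Flat M F
  flat-unrestrict {X} {F} FX FF = flat-intro (λ m → proj₁ FX (proj₁ FF m)) λ f f∈E h →
    Rank.flat-closed (restrict (proj₁ FX)) FF
      (flat-closed FX f∈E (spanned-mono (proj₁ FX) (⁅⁆-⊆ f∈E) (proj₁ FF) h)) h

-- Möbius functions under restriction and change of rank function

guard : ∀ a {x y} → (a ≡ true → x ≡ y) → ⟦ a ⟧ *ℤ x ≡ ⟦ a ⟧ *ℤ y
guard true h = cong (1ℤ *ℤ_) (h refl)
guard false {x} {y} h = trans (ℤP.*-zeroˡ x) (sym (ℤP.*-zeroˡ y))

MöbiusLaw-cong : ∀ {n} (p q : Subset n → Bool) (f : Subset n → ℤ) W →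
  (∀ V → V ⊆ W → p V ≡ q V) → MöbiusLaw p f W → MöbiusLaw q f W
MöbiusLaw-cong {n} p q f W h l = trans (∑-cong (allSubsets n) λ V →
  trans (ℤP.*-comm ⟦ q V ⟧ _) (trans (ℤP.*-assoc ⟦ V ⊆ᵇ W ⟧ (f V) ⟦ q V ⟧)
    (trans (guard (V ⊆ᵇ W) (λ e → cong (λ b → f V *ℤ ⟦ b ⟧) (sym (h V (⊆ᵇ⇒⊆ V W e)))))
      (trans (sym (ℤP.*-assoc ⟦ V ⊆ᵇ W ⟧ (f V) ⟦ p V ⟧)) (ℤP.*-comm _ ⟦ p V ⟧))))) l

module _ {N : ℕ} {S : Subset N} {r₁ r₂ : Subset N → ℕ} (eq : ∀ X → X ⊆ S → r₁ X ≡ r₂ X) where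
  private
    K₁ K₂ : RawMatroid N
    K₁ = mkM S r₁
    K₂ = mkM S r₂

  cl-cong : ∀ {X} → X ⊆ S → cl K₁ X ≡ cl K₂ X
  cl-cong {X} X⊆S = ⊆-antisym
    (λ m → let (a , b) = ∈-cl⁻ {M = K₁} m in ∈-cl⁺ {M = K₂} a
      (trans (sym (eq _ (∪⁅⁆-lub {A = X} X⊆S a))) (trans b (eq X X⊆S))))
    (λ m → let (a , b) = ∈-cl⁻ {M = K₂} m in ∈-cl⁺ {M = K₁} a
      (trans (eq _ (∪⁅⁆-lub {A = X} X⊆S a)) (trans b (sym (eq X X⊆S)))))

  isFlatᵇ-cong : ∀ X → isFlatᵇ K₁ X ≡ isFlatᵇ K₂ X
  isFlatᵇ-cong X with X ⊆ᵇ S in e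
  ... | true = cong (_==ˢ X) (cl-cong (⊆ᵇ⇒⊆ X S e))
  ... | false = refl

  -- The case in view is `M ∣ S` and `(M / e) ∣ S`, whose rank functions agree on the subsets of S
  -- but may differ elsewhere.
  χ-cong : bottom K₁ ≡ ∅ → ∀ k → χ K₁ k ≡ χ K₂ k
  χ-cong b k = trans (χ-gen K₁ k) (trans (∑-cong (allSubsets N) pt) (sym (χ-gen K₂ k)))
    where
    pt : ∀ V → (⟦ isFlatᵇ K₁ V ⟧ *ℤ μ K₁ V) *ℤ ⟦ (r₁ S ∸ r₁ V) ≡ᵇ k ⟧ ≡
               (⟦ isFlatᵇ K₂ V ⟧ *ℤ μ K₂ V) *ℤ ⟦ (r₂ S ∸ r₂ V) ≡ᵇ k ⟧
    pt V = trans (ℤP.*-assoc ⟦ isFlatᵇ K₁ V ⟧ (μ K₁ V) _) (trans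
      (guard (isFlatᵇ K₁ V) (λ e → cong₂ _*ℤ_
        (MöbiusLaw-unique (isFlatᵇ K₁) (μ K₁) (μ K₂) (μ-law K₁ b)
          (λ W fW → MöbiusLaw-cong (isFlatᵇ K₂) (isFlatᵇ K₁) (μ K₂) W (λ U _ → sym (isFlatᵇ-cong U))
            (μ-law K₂ (trans (sym (cl-cong ⊥⊆)) b) W (trans (sym (isFlatᵇ-cong W)) fW))) V e)
        (cong (λ z → ⟦ z ≡ᵇ k ⟧) (cong₂ _∸_ (eq S id) (eq V (proj₁ (isFlatᵇ⇒Flat {M = K₁} e)))))))
      (trans (cong (λ z → ⟦ z ⟧ *ℤ (μ K₂ V *ℤ ⟦ (r₂ S ∸ r₂ V) ≡ᵇ k ⟧)) (isFlatᵇ-cong V)) (sym (ℤP.*-assoc ⟦ isFlatᵇ K₂ V ⟧ (μ K₂ V) _))))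

Loopless-restrict : ∀ {N} {M : RawMatroid N} {X} → X ⊆ E M → Loopless M → Loopless (M ∣ X)
Loopless-restrict X⊆E ll e e∈X = ll e (X⊆E e∈X)

-- Below a flat of `M ∣ F` the flats of M and of `M ∣ F` are the same, so both functions satisfy the
-- same Möbius law.
μ-restrict : ∀ {N} {M : RawMatroid N} (mat : IsMatroid M) → Loopless M → ∀ {F} → Flat M F →
  ∀ W → Flat (M ∣ F) W → μ M W ≡ μ (M ∣ F) W
μ-restrict {M = M} mat ll {F} FF W FW = MöbiusLaw-unique (isFlatᵇ (M ∣ F)) (μ M) (μ (M ∣ F))
  (λ V fV → MöbiusLaw-cong (isFlatᵇ M) (isFlatᵇ (M ∣ F)) (μ M) V
    (λ U U⊆V → ≡-from-⇔
      (λ fU → Flat⇒isFlatᵇ {M = M ∣ F} (flat-restrict-⊆ mat (proj₁ FF)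
        (λ m → proj₁ (isFlatᵇ⇒Flat {M = M ∣ F} fV) (U⊆V m)) (isFlatᵇ⇒Flat {M = M} fU)))
      (λ fU → Flat⇒isFlatᵇ {M = M} (flat-unrestrict mat FF (isFlatᵇ⇒Flat {M = M ∣ F} fU))))
    (μ-law M (Rank.cl∅ mat ll) V (Flat⇒isFlatᵇ {M = M} (flat-unrestrict mat FF (isFlatᵇ⇒Flat {M = M ∣ F} fV)))))
  (μ-law (M ∣ F) (Rank.cl∅ (Rank.restrict mat (proj₁ FF)) (Loopless-restrict {M = M} (proj₁ FF) ll)))
  W (Flat⇒isFlatᵇ {M = M ∣ F} FW)

-- Factorization of the characteristic polynomial

-- For a modular set S, the cofactor of χ (M ∣ S) in χ M: the flats Y avoiding S contribute μ(Y) t^(r(E) - r(S) - r(Y)).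
cofactor : ∀ {N} → RawMatroid N → Subset N → ℕ → ℤ
cofactor {N} M S = gen (allSubsets N) (λ Y → (r M (E M) ∸ r M S) ∸ r M Y)
  (λ Y → ⟦ isFlatᵇ M Y ⟧ *ℤ (⟦ (Y ∩ S) ==ˢ ∅ ⟧ *ℤ μ M Y))

-- What modularity of S says about the flats disjoint from S. It is imposed on sets because it
-- passes to `M / e`, where S need not be closed: a further point on the line through e and a point
-- of S becomes parallel to the latter.
Skew : ∀ {N} → RawMatroid N → Subset N → Set
Skew M S = ∀ Y → Flat M Y → Y ∩ S ≡ ∅ → r M S ℕ.+ r M Y ≤ r M (S ∪ Y)

-- μ(V) is the sum of μ(U) μ(Y) over the pairs (U, Y), U ⊆ S, Y ∩ S = ∅, spanning V,
-- because this sum satisfies the recursion defining μ.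
module Factor {N : ℕ} {M : RawMatroid N} (mat : IsMatroid M) (ll : Loopless M)
              {S : Subset N} (S⊆E : S ⊆ E M) (skew : Skew M S) where
  open Rank mat
  private
    module S = Rank (restrict S⊆E)
    L = allSubsets N

    flS fl : Subset N → Bool
    flS = isFlatᵇ (M ∣ S)
    fl = isFlatᵇ M

    u v : Subset N → ℤ
    u U = ⟦ flS U ⟧ *ℤ μ (M ∣ S) U
    v Y = ⟦ fl Y ⟧ *ℤ (⟦ (Y ∩ S) ==ˢ ∅ ⟧ *ℤ μ M Y)

    ν : Subset N → ℤ
    ν V = ∑ L (λ U → ∑ L (λ Y → (u U *ℤ v Y) *ℤ ⟦ cl M (U ∪ Y) ==ˢ V ⟧))

    guard₃ : ∀ a b c m n {x y} → (a ≡ true → b ≡ true → c ≡ true → x ≡ y) →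
      ((⟦ a ⟧ *ℤ m) *ℤ (⟦ b ⟧ *ℤ (⟦ c ⟧ *ℤ n))) *ℤ x ≡ ((⟦ a ⟧ *ℤ m) *ℤ (⟦ b ⟧ *ℤ (⟦ c ⟧ *ℤ n))) *ℤ y
    guard₃ a b c m n {x} {y} h = trans (lem ⟦ a ⟧ ⟦ b ⟧ ⟦ c ⟧ m n x) (trans
      (guard a λ ea → guard b λ eb → guard c λ ec → cong ((m *ℤ n) *ℤ_) (h ea eb ec))
      (sym (lem ⟦ a ⟧ ⟦ b ⟧ ⟦ c ⟧ m n y)))
      where
      lem : ∀ a b c m n x → ((a *ℤ m) *ℤ (b *ℤ (c *ℤ n))) *ℤ x ≡ a *ℤ (b *ℤ (c *ℤ ((m *ℤ n) *ℤ x)))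
      lem = solve-∀

    -- Exchange of summation: a pair (U, Y) contributes to exactly one V, the flat `cl M (U ∪ Y)`.
    sum-ν : ∀ (φ : Subset N → ℤ) → ∑ˢ (λ V → ⟦ fl V ⟧ *ℤ (φ V *ℤ ν V)) ≡
      ∑ L (λ U → ∑ L (λ Y → (u U *ℤ v Y) *ℤ φ (cl M (U ∪ Y))))
    sum-ν φ = begin
      ∑ L (λ V → ⟦ fl V ⟧ *ℤ (φ V *ℤ ν V))
        ≡⟨ ∑-cong L (λ V → trans (sym (ℤP.*-assoc ⟦ fl V ⟧ (φ V) (ν V))) (trans (sym (∑-*ˡ L (⟦ fl V ⟧ *ℤ φ V) _))
             (∑-cong L (λ U → sym (∑-*ˡ L (⟦ fl V ⟧ *ℤ φ V) _))))) ⟩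
      ∑ L (λ V → ∑ L (λ U → ∑ L (λ Y → t V U Y)))
        ≡⟨ ∑-swap L L (λ V U → ∑ L (λ Y → t V U Y)) ⟩
      ∑ L (λ U → ∑ L (λ V → ∑ L (λ Y → t V U Y)))
        ≡⟨ ∑-cong L (λ U → ∑-swap L L (λ V Y → t V U Y)) ⟩
      ∑ L (λ U → ∑ L (λ Y → ∑ L (λ V → t V U Y)))
        ≡⟨ ∑-cong L (λ U → ∑-cong L (λ Y → point U Y)) ⟩
      ∑ L (λ U → ∑ L (λ Y → (u U *ℤ v Y) *ℤ φ (cl M (U ∪ Y)))) ∎
      where
      open ≡-Reasoning
      t : Subset N → Subset N → Subset N → ℤ
      t V U Y = (⟦ fl V ⟧ *ℤ φ V) *ℤ ((u U *ℤ v Y) *ℤ ⟦ cl M (U ∪ Y) ==ˢ V ⟧)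
      nil : ∀ a b → a *ℤ (b *ℤ 0ℤ) ≡ 0ℤ
      nil = solve-∀
      rot : ∀ a b c d → (a *ℤ b) *ℤ (c *ℤ d) ≡ c *ℤ (a *ℤ (d *ℤ b))
      rot = solve-∀
      one : ∀ a → 1ℤ *ℤ (1ℤ *ℤ a) ≡ a
      one = solve-∀
      point : ∀ U Y → ∑ L (λ V → t V U Y) ≡ (u U *ℤ v Y) *ℤ φ (cl M (U ∪ Y))
      point U Y = trans
        (∑ˢ-single (cl M (U ∪ Y)) (λ V → t V U Y) (λ V ne → trans
          (cong (λ b → (⟦ fl V ⟧ *ℤ φ V) *ℤ ((u U *ℤ v Y) *ℤ ⟦ b ⟧)) (≢⇒==ˢ _ V (λ e → ne (sym e))))
          (nil (⟦ fl V ⟧ *ℤ φ V) (u U *ℤ v Y))))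
        (trans (rot ⟦ fl (cl M (U ∪ Y)) ⟧ (φ (cl M (U ∪ Y))) (u U *ℤ v Y) ⟦ cl M (U ∪ Y) ==ˢ cl M (U ∪ Y) ⟧)
          (guard₃ (flS U) (fl Y) ((Y ∩ S) ==ˢ ∅) (μ (M ∣ S) U) (μ M Y) λ a b _ →
            trans (cong₂ (λ x y → ⟦ x ⟧ *ℤ (⟦ y ⟧ *ℤ φ (cl M (U ∪ Y))))
              (Flat⇒isFlatᵇ {M = M} (cl-flat (UY⊆E a b)))
              (≡⇒==ˢ (cl M (U ∪ Y)) _ refl)) (one (φ (cl M (U ∪ Y))))))
        where
        UY⊆E : flS U ≡ true → fl Y ≡ true → U ∪ Y ⊆ E M
        UY⊆E a b = ∪-lub {A = U} (λ m → S⊆E (proj₁ (isFlatᵇ⇒Flat {M = M ∣ S} a) m)) (proj₁ (isFlatᵇ⇒Flat {M = M} b))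

    ∑∑-* : ∀ (f g : Subset N → ℤ) → ∑ L (λ U → ∑ L (λ Y → f U *ℤ g Y)) ≡ ∑ L f *ℤ ∑ L g
    ∑∑-* f g = trans (∑-cong L (λ U → ∑-*ˡ L (f U) g)) (∑-*ʳ L (∑ L g) f)

    -- Since cl(U ∪ Y) ⊆ W exactly when U ⊆ S ∩ W and Y ⊆ W, the double sum is a product. Its first
    -- factor is the indicator of S ∩ W = ∅, by the law for `M ∣ S`. Where that is 1, every Y ⊆ W
    -- avoids S, and the second factor is the full sum in the law for M.
    ν-law : ∀ W → fl W ≡ true → MöbiusLaw fl ν W
    ν-law W fW = begin
      ∑ L (λ V → ⟦ fl V ⟧ *ℤ (⟦ V ⊆ᵇ W ⟧ *ℤ ν V))
        ≡⟨ sum-ν (λ V → ⟦ V ⊆ᵇ W ⟧) ⟩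
      ∑ L (λ U → ∑ L (λ Y → (u U *ℤ v Y) *ℤ ⟦ cl M (U ∪ Y) ⊆ᵇ W ⟧))
        ≡⟨ ∑-cong L (λ U → ∑-cong L (λ Y → trans
             (guard₃ (flS U) (fl Y) ((Y ∩ S) ==ˢ ∅) (μ (M ∣ S) U) (μ M Y) (λ a b _ → below U Y a b))
             (rot (u U) (v Y) ⟦ U ⊆ᵇ (S ∩ W) ⟧ ⟦ Y ⊆ᵇ W ⟧))) ⟩
      ∑ L (λ U → ∑ L (λ Y → (u U *ℤ ⟦ U ⊆ᵇ (S ∩ W) ⟧) *ℤ (v Y *ℤ ⟦ Y ⊆ᵇ W ⟧)))
        ≡⟨ ∑∑-* (λ U → u U *ℤ ⟦ U ⊆ᵇ (S ∩ W) ⟧) (λ Y → v Y *ℤ ⟦ Y ⊆ᵇ W ⟧) ⟩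
      ∑ L (λ U → u U *ℤ ⟦ U ⊆ᵇ (S ∩ W) ⟧) *ℤ ∑ L (λ Y → v Y *ℤ ⟦ Y ⊆ᵇ W ⟧)
        ≡⟨ cong (_*ℤ ∑ L (λ Y → v Y *ℤ ⟦ Y ⊆ᵇ W ⟧)) (trans
             (∑-cong L (λ U → mid ⟦ flS U ⟧ (μ (M ∣ S) U) ⟦ U ⊆ᵇ (S ∩ W) ⟧))
             (μ-law (M ∣ S) (S.cl∅ (Loopless-restrict {M = M} S⊆E ll)) (S ∩ W) (Flat⇒isFlatᵇ {M = M ∣ S} FSW))) ⟩
      ⟦ (S ∩ W) ==ˢ ∅ ⟧ *ℤ ∑ L (λ Y → v Y *ℤ ⟦ Y ⊆ᵇ W ⟧)
        ≡⟨ guard ((S ∩ W) ==ˢ ∅) (λ e → trans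
             (∑-cong L (λ Y → trans (mid₂ ⟦ fl Y ⟧ ⟦ (Y ∩ S) ==ˢ ∅ ⟧ (μ M Y) ⟦ Y ⊆ᵇ W ⟧) (cong (⟦ fl Y ⟧ *ℤ_)
               (guard (Y ⊆ᵇ W) (λ Y⊆W → trans (cong (λ b → ⟦ b ⟧ *ℤ μ M Y) (disj Y e Y⊆W)) (ℤP.*-identityˡ (μ M Y)))))))
             (μ-law M (cl∅ ll) W fW)) ⟩
      ⟦ (S ∩ W) ==ˢ ∅ ⟧ *ℤ ⟦ W ==ˢ ∅ ⟧
        ≡⟨ sym (⟦∧⟧ ((S ∩ W) ==ˢ ∅) (W ==ˢ ∅)) ⟩
      ⟦ ((S ∩ W) ==ˢ ∅) ∧ (W ==ˢ ∅) ⟧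
        ≡⟨ cong ⟦_⟧ (≡-from-⇔ {((S ∩ W) ==ˢ ∅) ∧ (W ==ˢ ∅)} (λ e → proj₂ (∧⁻ e))
             (λ e → ∧⁺ (≡⇒==ˢ (S ∩ W) ∅ (Disjoint⇒∅ λ _ w → ∉⊥ (subst (_ ∈_) (==ˢ⇒≡ W ∅ e) w))) e)) ⟩
      ⟦ W ==ˢ ∅ ⟧ ∎
      where
      open ≡-Reasoning
      FW : Flat M W
      FW = isFlatᵇ⇒Flat {M = M} fW
      FSW : Flat (M ∣ S) (S ∩ W)
      FSW = subst (Flat (M ∣ S)) (∩-comm W S) (flat-restrict mat S⊆E FW)
      rot : ∀ a b c d → (a *ℤ b) *ℤ (c *ℤ d) ≡ (a *ℤ c) *ℤ (b *ℤ d)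
      rot = solve-∀
      mid : ∀ a b c → (a *ℤ b) *ℤ c ≡ a *ℤ (c *ℤ b)
      mid = solve-∀
      mid₂ : ∀ a b c d → (a *ℤ (b *ℤ c)) *ℤ d ≡ a *ℤ (d *ℤ (b *ℤ c))
      mid₂ = solve-∀
      disj : ∀ Y → ((S ∩ W) ==ˢ ∅) ≡ true → (Y ⊆ᵇ W) ≡ true → ((Y ∩ S) ==ˢ ∅) ≡ true
      disj Y e Y⊆W = ≡⇒==ˢ (Y ∩ S) ∅ (Disjoint⇒∅ λ y s → ∅⇒Disjoint (==ˢ⇒≡ (S ∩ W) ∅ e) s (⊆ᵇ⇒⊆ Y W Y⊆W y))
      below : ∀ U Y → flS U ≡ true → fl Y ≡ true → ⟦ cl M (U ∪ Y) ⊆ᵇ W ⟧ ≡ ⟦ U ⊆ᵇ (S ∩ W) ⟧ *ℤ ⟦ Y ⊆ᵇ W ⟧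
      below U Y a b = trans (cong ⟦_⟧ (≡-from-⇔
        (λ e → let UY⊆W : U ∪ Y ⊆ W
                   UY⊆W = λ m → ⊆ᵇ⇒⊆ (cl M (U ∪ Y)) W e (⊆cl UY⊆E m)
               in ∧⁺ {U ⊆ᵇ (S ∩ W)} (⊆⇒⊆ᵇ U (S ∩ W) (λ m → x∈p∩q⁺ (U⊆S m , UY⊆W (p⊆p∪q Y m))))
                     (⊆⇒⊆ᵇ Y W (λ m → UY⊆W (q⊆p∪q U Y m))))
        (λ e → let (x , y) = ∧⁻ {U ⊆ᵇ (S ∩ W)} e in ⊆⇒⊆ᵇ (cl M (U ∪ Y)) W (cl-least {X = U ∪ Y}
          (∪-lub {A = U} (λ m → p∩q⊆q S W (⊆ᵇ⇒⊆ U (S ∩ W) x m)) (⊆ᵇ⇒⊆ Y W y)) FW))))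
        (⟦∧⟧ (U ⊆ᵇ (S ∩ W)) (Y ⊆ᵇ W))
        where
        U⊆S : U ⊆ S
        U⊆S = proj₁ (isFlatᵇ⇒Flat {M = M ∣ S} a)
        UY⊆E : U ∪ Y ⊆ E M
        UY⊆E = ∪-lub {A = U} (λ m → S⊆E (U⊆S m)) (proj₁ (isFlatᵇ⇒Flat {M = M} b))

  -- Submodularity for S and U ∪ Y, which both contain U, passes additivity of rank from S down to
  -- U.
  r-skew : ∀ {U Y} → U ⊆ S → Flat M Y → Y ∩ S ≡ ∅ → r M (U ∪ Y) ≡ r M U ℕ.+ r M Y
  r-skew {U} {Y} U⊆S FY d = ℕP.≤-antisym (subadd U⊆E (proj₁ FY)) (ℕP.+-cancelˡ-≤ (r M S) _ _ (begin
    r M S ℕ.+ (r M U ℕ.+ r M Y)  ≡⟨ cong (r M S ℕ.+_) (ℕP.+-comm (r M U) (r M Y)) ⟩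
    r M S ℕ.+ (r M Y ℕ.+ r M U)  ≡⟨ ℕP.+-assoc (r M S) (r M Y) (r M U) ⟨
    r M S ℕ.+ r M Y ℕ.+ r M U    ≤⟨ ℕP.+-monoˡ-≤ (r M U) (skew Y FY d) ⟩
    r M (S ∪ Y) ℕ.+ r M U        ≤⟨ ℕP.+-monoˡ-≤ (r M U) (mono (∪-lub {A = S} S⊆E UY⊆E) (∪-mono {A = S} {Y} id (q⊆p∪q U Y))) ⟩
    r M (S ∪ (U ∪ Y)) ℕ.+ r M U  ≤⟨ submod-⊆ S⊆E UY⊆E U⊆S (p⊆p∪q Y) ⟩
    r M S ℕ.+ r M (U ∪ Y)        ∎))
    where
    open ℕP.≤-Reasoning
    U⊆E : U ⊆ E M
    U⊆E m = S⊆E (U⊆S m)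
    UY⊆E : U ∪ Y ⊆ E M
    UY⊆E = ∪-lub {A = U} U⊆E (proj₁ FY)

  -- With μ = ν, the flat spanned by (U, Y) has corank equal to the sum of the exponents of U and of
  -- Y in the two factors, so the double sum is the product of the two polynomials.
  χ-factor : ∀ k → χ M k ≡ (χ (M ∣ S) ⊛ cofactor M S) k
  χ-factor k = begin
    χ M k
      ≡⟨ χ-gen M k ⟩
    ∑ L (λ V → (⟦ fl V ⟧ *ℤ μ M V) *ℤ ⟦ (r M (E M) ∸ r M V) ≡ᵇ k ⟧)
      ≡⟨ ∑-cong L (λ V → trans (mid ⟦ fl V ⟧ (μ M V) ⟦ (r M (E M) ∸ r M V) ≡ᵇ k ⟧)
           (guard (fl V) (λ e → cong (⟦ (r M (E M) ∸ r M V) ≡ᵇ k ⟧ *ℤ_)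
             (MöbiusLaw-unique fl (μ M) ν (μ-law M (cl∅ ll)) ν-law V e)))) ⟩
    ∑ L (λ V → ⟦ fl V ⟧ *ℤ (⟦ (r M (E M) ∸ r M V) ≡ᵇ k ⟧ *ℤ ν V))
      ≡⟨ sum-ν (λ V → ⟦ (r M (E M) ∸ r M V) ≡ᵇ k ⟧) ⟩
    ∑ L (λ U → ∑ L (λ Y → (u U *ℤ v Y) *ℤ ⟦ (r M (E M) ∸ r M (cl M (U ∪ Y))) ≡ᵇ k ⟧))
      ≡⟨ ∑-cong L (λ U → ∑-cong L (λ Y →
           guard₃ (flS U) (fl Y) ((Y ∩ S) ==ˢ ∅) (μ (M ∣ S) U) (μ M Y) (λ a b c → cong (λ z → ⟦ z ≡ᵇ k ⟧)
             (corank (isFlatᵇ⇒Flat {M = M ∣ S} a) (isFlatᵇ⇒Flat {M = M} b) (==ˢ⇒≡ (Y ∩ S) ∅ c))))) ⟩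
    ∑ L (λ U → ∑ L (λ Y → (u U *ℤ v Y) *ℤ ⟦ ((r M S ∸ r M U) ℕ.+ ((r M (E M) ∸ r M S) ∸ r M Y)) ≡ᵇ k ⟧))
      ≡⟨ sym (gen-⊛ L L (λ U → r M S ∸ r M U) u (λ Y → (r M (E M) ∸ r M S) ∸ r M Y) v k) ⟩
    (gen L (λ U → r M S ∸ r M U) u ⊛ cofactor M S) k
      ≡⟨ ⊛-cong {q = cofactor M S} (λ j → sym (χ-gen (M ∣ S) j)) (λ _ → refl) k ⟩
    (χ (M ∣ S) ⊛ cofactor M S) k ∎
    where
    open ≡-Reasoning
    mid : ∀ a b c → (a *ℤ b) *ℤ c ≡ a *ℤ (c *ℤ b)
    mid = solve-∀
    corank : ∀ {U Y} → Flat (M ∣ S) U → Flat M Y → Y ∩ S ≡ ∅ →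
      r M (E M) ∸ r M (cl M (U ∪ Y)) ≡ (r M S ∸ r M U) ℕ.+ ((r M (E M) ∸ r M S) ∸ r M Y)
    corank {U} {Y} FU FY d = trans
      (cong (r M (E M) ∸_) (trans (r-cl (∪-lub {A = U} (λ m → S⊆E (proj₁ FU m)) (proj₁ FY))) (r-skew (proj₁ FU) FY d)))
      -- The bounds r(U) ≤ r(S) and r(S) + r(Y) ≤ r(E) make the truncated subtractions behave as
      -- true ones.
      (arith (mono S⊆E (proj₁ FU)) (ℕP.≤-trans (skew Y FY d) (mono id (∪-lub {A = S} S⊆E (proj₁ FY)))))
      where
      arith : ∀ {e s u y} → u ≤ s → s ℕ.+ y ≤ e → e ∸ (u ℕ.+ y) ≡ (s ∸ u) ℕ.+ ((e ∸ s) ∸ y)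
      arith {e} {s} {u} {y} u≤s sy≤e = begin
        e ∸ (u ℕ.+ y)  ≡⟨ cong (_∸ (u ℕ.+ y)) (ℕP.m+[n∸m]≡n sy≤e) ⟨
        (s ℕ.+ y) ℕ.+ (e ∸ (s ℕ.+ y)) ∸ (u ℕ.+ y) ≡⟨ ℕP.+-∸-comm (e ∸ (s ℕ.+ y)) (ℕP.+-monoˡ-≤ y u≤s) ⟩
        ((s ℕ.+ y) ∸ (u ℕ.+ y)) ℕ.+ (e ∸ (s ℕ.+ y)) ≡⟨ cong₂ ℕ._+_ (trans (cong₂ _∸_ (ℕP.+-comm s y) (ℕP.+-comm u y)) (ℕP.[m+n]∸[m+o]≡n∸o y s u)) (sym (ℕP.∸-+-assoc e s y)) ⟩
        (s ∸ u) ℕ.+ ((e ∸ s) ∸ y) ∎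

∪⁅⁆-pull : ∀ {n} (A B : Subset n) x → A ∪ (B ∪ ⁅ x ⁆) ≡ (A ∪ B) ∪ ⁅ x ⁆
∪⁅⁆-pull A B x = sym (∪-assoc A B ⁅ x ⁆)

-∪⁅⁆ : ∀ {n} {A : Subset n} {x} → x ∈ A → (A - x) ∪ ⁅ x ⁆ ≡ A
-∪⁅⁆ {n} {A} {x} x∈A = ⊆-antisym (∪⁅⁆-lub {A = A - x} (p─q⊆p A ⁅ x ⁆) x∈A) back
  where
  back : A ⊆ (A - x) ∪ ⁅ x ⁆
  back {y} m with y Data.Fin.≟ x
  ... | yes refl = q⊆p∪q (A - x) ⁅ x ⁆ (x∈⁅x⁆ x)
  ... | no y≢x = p⊆p∪q ⁅ x ⁆ (x∈p∧x≢y⇒x∈p-y m y≢x)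

module Simple {N : ℕ} {M : RawMatroid N} (simple : IsSimple M) where
  open IsSimple simple public
  open Rank isMatroid public

  loopless : Loopless M
  loopless e e∈E h with () ← trans (sym h) (noLoop e e∈E)

  simple-restrict : ∀ {X} → X ⊆ E M → IsSimple (M ∣ X)
  simple-restrict X⊆E = record
    { isMatroid = restrict X⊆E
    ; noLoop = λ e m → noLoop e (X⊆E m)
    ; noParallel = λ e f m n → noParallel e f (X⊆E m) (X⊆E n) }

  ∅-flat : Flat M ∅
  ∅-flat = ⊥⊆ , cl∅ loopless

  ⁅⁆-flat : ∀ {e} → e ∈ E M → Flat M ⁅ e ⁆
  ⁅⁆-flat {e} e∈E = flat-intro (⁅⁆-⊆ e∈E) λ f f∈E h → inside f f∈E h
    where
    inside : ∀ f → f ∈ E M → r M (⁅ e ⁆ ∪ ⁅ f ⁆) ≤ r M ⁅ e ⁆ → f ∈ ⁅ e ⁆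
    inside f f∈E h with e Data.Fin.≟ f
    ... | yes refl = x∈⁅x⁆ e
    ... | no e≢f with s≤s () ← subst₂ _≤_ (noParallel e f e∈E f∈E e≢f) (noLoop e e∈E) h

-- Contraction of a point

module Contract {N : ℕ} {M : RawMatroid N} (simple : IsSimple M) {e : Fin N} (e∈E : e ∈ E M) where
  open Simple simple

  -- The successor form avoids the truncated subtraction in `M / e`: inequalities in the contraction
  -- are proved with the units added back and then cancelled.
  r-contract : ∀ {X} → X ⊆ E M → suc (r (M / e) X) ≡ r M (X ∪ ⁅ e ⁆)
  r-contract {X} X⊆E = trans (cong (λ z → suc (r M (X ∪ ⁅ e ⁆) ∸ z)) (noLoop e e∈E))
    (ℕP.m+[n∸m]≡n (subst (_≤ r M (X ∪ ⁅ e ⁆)) (noLoop e e∈E) (mono (∪⁅⁆-lub {A = X} X⊆E e∈E) (q⊆p∪q X ⁅ e ⁆))))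

  -e⊆E : E M - e ⊆ E M
  -e⊆E = p─q⊆p (E M) ⁅ e ⁆

  isMatroid-contract : IsMatroid (M / e)
  isMatroid-contract = record
    { r-card = λ X X⊆ → s≤s⁻¹ (begin
        suc (r (M / e) X)     ≡⟨ r-contract (λ m → -e⊆E (X⊆ m)) ⟩
        r M (X ∪ ⁅ e ⁆)       ≤⟨ r-∪⁅⁆≤suc (λ m → -e⊆E (X⊆ m)) e∈E ⟩
        suc (r M X)           ≤⟨ s≤s (IsMatroid.r-card isMatroid X (λ m → -e⊆E (X⊆ m))) ⟩
        suc ∣ X ∣             ∎)
    ; r-mono = λ X Y Y⊆ X⊆Y → ℕP.∸-monoˡ-≤ (r M ⁅ e ⁆)
        (mono (∪⁅⁆-lub {A = Y} (λ m → -e⊆E (Y⊆ m)) e∈E) (∪-mono {A = X} {⁅ e ⁆} X⊆Y id))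
    ; r-submod = λ X Y X⊆ Y⊆ → sub X Y (λ m → -e⊆E (X⊆ m)) (λ m → -e⊆E (Y⊆ m)) }
    where
    open ℕP.≤-Reasoning
    sub : ∀ X Y → X ⊆ E M → Y ⊆ E M → r (M / e) (X ∪ Y) ℕ.+ r (M / e) (X ∩ Y) ≤ r (M / e) X ℕ.+ r (M / e) Y
    sub X Y X⊆E Y⊆E = s≤s⁻¹ (s≤s⁻¹ (begin
      suc (suc (r (M / e) (X ∪ Y) ℕ.+ r (M / e) (X ∩ Y)))
        ≡⟨ cong suc (sym (ℕP.+-suc _ _)) ⟩
      suc (r (M / e) (X ∪ Y)) ℕ.+ suc (r (M / e) (X ∩ Y))
        ≡⟨ cong₂ ℕ._+_ (r-contract {X ∪ Y} (∪-lub {A = X} X⊆E Y⊆E)) (r-contract {X ∩ Y} (λ m → X⊆E (p∩q⊆p X Y m))) ⟩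
      r M ((X ∪ Y) ∪ ⁅ e ⁆) ℕ.+ r M ((X ∩ Y) ∪ ⁅ e ⁆)
        ≤⟨ ℕP.+-monoˡ-≤ _ (mono (∪-lub {A = X ∪ ⁅ e ⁆} Xe⊆E Ye⊆E)
             (∪-lub {A = X ∪ Y} (∪-mono {A = X} {Y} (p⊆p∪q _) (p⊆p∪q _)) (λ m → p⊆p∪q (Y ∪ ⁅ e ⁆) (q⊆p∪q X ⁅ e ⁆ m)))) ⟩
      r M ((X ∪ ⁅ e ⁆) ∪ (Y ∪ ⁅ e ⁆)) ℕ.+ r M ((X ∩ Y) ∪ ⁅ e ⁆)
        ≤⟨ submod-⊆ Xe⊆E Ye⊆E (∪-mono {A = X ∩ Y} {⁅ e ⁆} (p∩q⊆p X Y) id) (∪-mono {A = X ∩ Y} {⁅ e ⁆} (p∩q⊆q X Y) id) ⟩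
      r M (X ∪ ⁅ e ⁆) ℕ.+ r M (Y ∪ ⁅ e ⁆)
        ≡⟨ cong₂ ℕ._+_ (r-contract X⊆E) (r-contract Y⊆E) ⟨
      suc (r (M / e) X) ℕ.+ suc (r (M / e) Y)
        ≡⟨ cong suc (ℕP.+-suc _ _) ⟩
      suc (suc (r (M / e) X ℕ.+ r (M / e) Y)) ∎))
      where
      Xe⊆E : X ∪ ⁅ e ⁆ ⊆ E M
      Xe⊆E = ∪⁅⁆-lub {A = X} X⊆E e∈E
      Ye⊆E : Y ∪ ⁅ e ⁆ ⊆ E M
      Ye⊆E = ∪⁅⁆-lub {A = Y} Y⊆E e∈E

  r-contract-⁅⁆ : ∀ {f} → f ∈ E M - e → r (M / e) ⁅ f ⁆ ≡ 1
  r-contract-⁅⁆ {f} m with ∈-⁻ m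
  ... | f∈E , f≢e = ℕP.suc-injective (trans (r-contract (⁅⁆-⊆ f∈E)) (noParallel f e f∈E e∈E f≢e))

  loopless-contract : Loopless (M / e)
  loopless-contract f m h with () ← trans (sym h) (r-contract-⁅⁆ m)

  -- Together with `flat-contract` this is the correspondence between the flats of `M / e` and the
  -- flats of M through e.
  flat-uncontract : ∀ {Y} → Flat (M / e) Y → Flat M (Y ∪ ⁅ e ⁆)
  flat-uncontract {Y} FY = flat-intro Ye⊆E closed
    where
    Y⊆E : Y ⊆ E M
    Y⊆E m = -e⊆E (proj₁ FY m)
    Ye⊆E : Y ∪ ⁅ e ⁆ ⊆ E M
    Ye⊆E = ∪⁅⁆-lub {A = Y} Y⊆E e∈E
    closed : ∀ f → f ∈ E M → r M ((Y ∪ ⁅ e ⁆) ∪ ⁅ f ⁆) ≤ r M (Y ∪ ⁅ e ⁆) → f ∈ Y ∪ ⁅ e ⁆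
    closed f f∈E h with f Data.Fin.≟ e
    ... | yes refl = q⊆p∪q Y ⁅ f ⁆ (x∈⁅x⁆ f)
    ... | no f≢e = p⊆p∪q ⁅ e ⁆ (Rank.flat-closed isMatroid-contract FY (x∈p∧x≢y⇒x∈p-y f∈E f≢e)
      (s≤s⁻¹ (subst₂ _≤_
        (trans (cong (r M) (trans (∪-assoc Y ⁅ e ⁆ ⁅ f ⁆) (trans (cong (Y ∪_) (∪-comm ⁅ e ⁆ ⁅ f ⁆)) (∪⁅⁆-pull Y ⁅ f ⁆ e))))
          (sym (r-contract {Y ∪ ⁅ f ⁆} (∪⁅⁆-lub {A = Y} Y⊆E f∈E))))
        (sym (r-contract Y⊆E)) h)))

  flat-contract : ∀ {F} → Flat M F → e ∈ F → Flat (M / e) (F - e)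
  flat-contract {F} FF e∈F = Rank.flat-intro isMatroid-contract
    (λ m → let (a , b) = ∈-⁻ m in x∈p∧x≢y⇒x∈p-y (proj₁ FF a) b)
    λ f f∈E h → let (a , b) = ∈-⁻ f∈E in x∈p∧x≢y⇒x∈p-y (flat-closed FF a (begin
      r M (F ∪ ⁅ f ⁆)                    ≡⟨ cong (λ z → r M (z ∪ ⁅ f ⁆)) (-∪⁅⁆ e∈F) ⟨
      r M (((F - e) ∪ ⁅ e ⁆) ∪ ⁅ f ⁆)    ≡⟨ cong (r M) (trans (∪-assoc (F - e) ⁅ e ⁆ ⁅ f ⁆) (trans (cong ((F - e) ∪_) (∪-comm ⁅ e ⁆ ⁅ f ⁆)) (∪⁅⁆-pull (F - e) ⁅ f ⁆ e))) ⟩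
      r M (((F - e) ∪ ⁅ f ⁆) ∪ ⁅ e ⁆)    ≡⟨ r-contract {(F - e) ∪ ⁅ f ⁆} (∪⁅⁆-lub {A = F - e} F-e⊆E a) ⟨
      suc (r (M / e) ((F - e) ∪ ⁅ f ⁆))  ≤⟨ s≤s h ⟩
      suc (r (M / e) (F - e))            ≡⟨ r-contract F-e⊆E ⟩
      r M ((F - e) ∪ ⁅ e ⁆)              ≡⟨ cong (r M) (-∪⁅⁆ e∈F) ⟩
      r M F                              ∎)) b
    where
    open ℕP.≤-Reasoning
    F-e⊆E : F - e ⊆ E M
    F-e⊆E m = proj₁ FF (proj₁ (∈-⁻ m))

  r-contract-∋ : ∀ {F} → F ⊆ E M → e ∈ F → suc (r (M / e) (F - e)) ≡ r M F
  r-contract-∋ F⊆E e∈F = trans (r-contract (λ m → F⊆E (proj₁ (∈-⁻ m)))) (cong (r M) (-∪⁅⁆ e∈F))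

  module _ {S : Subset N} (S⊆E : S ⊆ E M) (skew : Skew M S) (e∉S : e ∉ S) where

    private
      -- The point e is by itself a flat of the simple matroid M and avoids S, so skewness makes it
      -- independent of every subset of S.
      r-∪e : ∀ {X} → X ⊆ S → r M (X ∪ ⁅ e ⁆) ≡ suc (r M X)
      r-∪e {X} X⊆S = trans (Factor.r-skew isMatroid loopless S⊆E skew X⊆S (⁅⁆-flat e∈E)
          (Disjoint⇒∅ λ a b → e∉S (subst (_∈ S) (x∈⁅y⁆⇒x≡y e a) b)))
        (trans (cong (r M X ℕ.+_) (noLoop e e∈E)) (ℕP.+-comm (r M X) 1))

    r-contract-skew : ∀ X → X ⊆ S → r (M / e) X ≡ r M X
    r-contract-skew X X⊆S = ℕP.suc-injective (trans (r-contract (λ m → S⊆E (X⊆S m))) (r-∪e X⊆S))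

    S⊆E-e : S ⊆ E M - e
    S⊆E-e m = x∈p∧x≢y⇒x∈p-y (S⊆E m) λ { refl → e∉S m }

    -- Y ∪ e is a flat of M and, as e ∉ S, still disjoint from S. Its skewness inequality in M loses
    -- one unit on each side.
    skew-contract : Skew (M / e) S
    skew-contract Y FY d = s≤s⁻¹ (begin
      suc (r (M / e) S ℕ.+ r (M / e) Y)  ≡⟨ sym (ℕP.+-suc _ _) ⟩
      r (M / e) S ℕ.+ suc (r (M / e) Y)  ≡⟨ cong₂ ℕ._+_ (r-contract-skew S id) (r-contract Y⊆E) ⟩
      r M S ℕ.+ r M (Y ∪ ⁅ e ⁆)          ≤⟨ skew (Y ∪ ⁅ e ⁆) (flat-uncontract FY) (Disjoint⇒∅ disj) ⟩
      r M (S ∪ (Y ∪ ⁅ e ⁆))              ≡⟨ cong (r M) (∪⁅⁆-pull S Y e) ⟩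
      r M ((S ∪ Y) ∪ ⁅ e ⁆)              ≡⟨ r-contract (∪-lub {A = S} S⊆E Y⊆E) ⟨
      suc (r (M / e) (S ∪ Y))            ∎)
      where
      open ℕP.≤-Reasoning
      Y⊆E : Y ⊆ E M
      Y⊆E m = -e⊆E (proj₁ FY m)
      disj : ∀ {x} → x ∈ Y ∪ ⁅ e ⁆ → x ∈ S → ⊥
      disj {x} m s with x∈p∪q⁻ Y ⁅ e ⁆ m
      ... | inj₁ y = ∅⇒Disjoint d y s
      ... | inj₂ x∈e = e∉S (subst (_∈ S) (x∈⁅y⁆⇒x≡y e x∈e) s)

    -- The first factor is the same as for χ(M), because contracting e leaves `M ∣ S` unchanged;
    -- only the cofactors remain to be compared.
    χ-contract-factor : ∀ k → χ (M / e) k ≡ (χ (M ∣ S) ⊛ cofactor (M / e) S) k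
    χ-contract-factor k = trans (Factor.χ-factor isMatroid-contract loopless-contract S⊆E-e skew-contract k)
      (⊛-cong {q = cofactor (M / e) S} (λ j → sym (χ-cong (λ X X⊆S → sym (r-contract-skew X X⊆S))
        (Rank.cl∅ (restrict S⊆E) (Loopless-restrict {M = M} S⊆E loopless)) j)) (λ _ → refl) k)

-- A flat Y inside F that avoids S ∩ F avoids S. Submodularity for S and (S ∩ F) ∪ Y then passes
-- from S to S ∩ F.
skew-restrict : ∀ {N} {M : RawMatroid N} (mat : IsMatroid M) {S F : Subset N} → S ⊆ E M → Skew M S → Flat M F →
  Skew (M ∣ F) (S ∩ F)
skew-restrict {M = M} mat {S} {F} S⊆E skew FF Y FY d = ℕP.+-cancelˡ-≤ (r M S) _ _ (begin
  r M S ℕ.+ (r M Z ℕ.+ r M Y)  ≡⟨ cong (r M S ℕ.+_) (ℕP.+-comm (r M Z) (r M Y)) ⟩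
  r M S ℕ.+ (r M Y ℕ.+ r M Z)  ≡⟨ ℕP.+-assoc (r M S) (r M Y) (r M Z) ⟨
  r M S ℕ.+ r M Y ℕ.+ r M Z    ≤⟨ ℕP.+-monoˡ-≤ (r M Z) (skew Y (flat-unrestrict mat FF FY) disj) ⟩
  r M (S ∪ Y) ℕ.+ r M Z        ≤⟨ ℕP.+-monoˡ-≤ (r M Z) (mono (∪-lub {A = S} S⊆E ZY⊆E) (∪-mono {A = S} {Y} id (q⊆p∪q Z Y))) ⟩
  r M (S ∪ (Z ∪ Y)) ℕ.+ r M Z  ≤⟨ submod-⊆ S⊆E ZY⊆E (p∩q⊆p S F) (p⊆p∪q Y) ⟩
  r M S ℕ.+ r M (Z ∪ Y)        ∎)
  where
  open Rank mat
  open ℕP.≤-Reasoning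
  Z = S ∩ F
  ZY⊆E : Z ∪ Y ⊆ E M
  ZY⊆E = ∪-lub {A = Z} (λ m → S⊆E (p∩q⊆p S F m)) (λ m → proj₁ FF (proj₁ FY m))
  disj : Y ∩ S ≡ ∅
  disj = Disjoint⇒∅ λ y s → ∅⇒Disjoint d y (x∈p∩q⁺ (s , proj₁ FY y))

-- Divisibility of the characteristic polynomial

m∸n≡m⇒n≡0 : ∀ {m n} → n ≤ m → m ∸ n ≡ m → n ≡ 0
m∸n≡m⇒n≡0 {m} {n} n≤m h = ℕP.+-cancelʳ-≡ m n 0 (trans (cong (n ℕ.+_) (sym h)) (ℕP.m+[n∸m]≡n n≤m))

rank0⇒∅ : ∀ {N} {M : RawMatroid N} (mat : IsMatroid M) → Loopless M → ∀ {Y} → Y ⊆ E M → r M Y ≡ 0 → Y ≡ ∅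
rank0⇒∅ {M = M} mat ll {Y} Y⊆E h = Empty-unique λ (x , m) → ll x (Y⊆E m)
  (ℕP.n≤0⇒n≡0 (subst (r M ⁅ x ⁆ ≤_) h (Rank.mono mat Y⊆E (⁅⁆-⊆ m))))

module _ {N : ℕ} {M : RawMatroid N} (mat : IsMatroid M) (ll : Loopless M) where
  open Rank mat

  isFlatᵇ-∅ : isFlatᵇ M ∅ ≡ true
  isFlatᵇ-∅ = Flat⇒isFlatᵇ {M = M} (⊥⊆ , cl∅ ll)

  μ-∅ : μ M ∅ ≡ 1ℤ
  μ-∅ = trans (μ-rec M ∅) (cong (λ b → if b then 1ℤ else -ℤ ∑ˢ (λ V → ⟦ isFlatᵇ M V ⟧ *ℤ (⟦ V ⊊ᵇ ∅ ⟧ *ℤ μ M V)))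
    (≡⇒==ˢ ∅ (bottom M) (sym (cl∅ ll))))

  -- Only the flat ∅ has full corank, and μ(∅) = 1. The nonzero coefficient is what allows χ to be
  -- cancelled from a product.
  χ-leading : χ M (r M (E M)) ≡ 1ℤ
  χ-leading = trans (χ-gen M (r M (E M))) (trans (∑ˢ-single ∅ _ other) (trans
    (cong₂ (λ a b → (⟦ a ⟧ *ℤ μ M ∅) *ℤ ⟦ b ⟧) isFlatᵇ-∅ (≡⇒≡ᵇ (cong (r M (E M) ∸_) r∅)))
    (trans (ℤP.*-identityʳ _) (trans (ℤP.*-identityˡ (μ M ∅)) μ-∅))))
    where
    other : ∀ V → V ≢ ∅ → (⟦ isFlatᵇ M V ⟧ *ℤ μ M V) *ℤ ⟦ (r M (E M) ∸ r M V) ≡ᵇ r M (E M) ⟧ ≡ 0ℤ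
    other V V≢∅ = trans (ℤP.*-assoc ⟦ isFlatᵇ M V ⟧ (μ M V) _) (trans
      (guard (isFlatᵇ M V) {y = 0ℤ} (λ e → trans (cong (λ b → μ M V *ℤ ⟦ b ⟧) (fails (isFlatᵇ⇒Flat {M = M} e))) (ℤP.*-zeroʳ (μ M V))))
      (ℤP.*-zeroʳ ⟦ isFlatᵇ M V ⟧))
      where
      fails : Flat M V → ((r M (E M) ∸ r M V) ≡ᵇ r M (E M)) ≡ false
      fails FV with (r M (E M) ∸ r M V) ≡ᵇ r M (E M) in e
      ... | false = refl
      ... | true = ⊥-elim (V≢∅ (rank0⇒∅ mat ll (proj₁ FV) (m∸n≡m⇒n≡0 (mono id (proj₁ FV)) (≡ᵇ⇒≡ e))))

  -- Only flats inside F contribute to the cofactor when E = S ∪ F.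
  cofactor-restrict : ∀ {S F Z} → S ⊆ E M → Flat M F → E M ⊆ S ∪ F → S ∩ F ≡ Z →
    r M (E M) ℕ.+ r M Z ≡ r M S ℕ.+ r M F → ∀ k → cofactor M S k ≡ cofactor (M ∣ F) Z k
  cofactor-restrict {S} {F} {Z} S⊆E FF cover refl ranks k = ∑-cong (allSubsets N) pt
    where
    corank : r M (E M) ∸ r M S ≡ r M F ∸ r M (S ∩ F)
    corank = trans (sym (ℕP.[m+n]∸[m+o]≡n∸o (r M (S ∩ F)) (r M (E M)) (r M S))) (trans
      (cong₂ _∸_ (trans (ℕP.+-comm (r M (S ∩ F)) _) ranks) (ℕP.+-comm (r M (S ∩ F)) (r M S)))
      (ℕP.[m+n]∸[m+o]≡n∸o (r M S) (r M F) (r M (S ∩ F))))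
    inF : ∀ {Y} → Flat M Y → Y ∩ S ≡ ∅ → Y ⊆ F
    inF {Y} FY d m with x∈p∪q⁻ S F (cover (proj₁ FY m))
    ... | inj₁ s = ⊥-elim (∅⇒Disjoint d m s)
    ... | inj₂ f = f
    c : Subset N → ℤ
    c Y = ⟦ ((r M (E M) ∸ r M S) ∸ r M Y) ≡ᵇ k ⟧
    test : ∀ Y → isFlatᵇ M Y ∧ ((Y ∩ S) ==ˢ ∅) ≡ isFlatᵇ (M ∣ F) Y ∧ ((Y ∩ (S ∩ F)) ==ˢ ∅)
    test Y = ≡-from-⇔
      (λ e → let (a , b) = ∧⁻ {isFlatᵇ M Y} e
                 FY = isFlatᵇ⇒Flat {M = M} a
                 d = ==ˢ⇒≡ (Y ∩ S) ∅ b
             in ∧⁺ {isFlatᵇ (M ∣ F) Y} (Flat⇒isFlatᵇ {M = M ∣ F} (flat-restrict-⊆ mat (proj₁ FF) (inF FY d) FY))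
                  (≡⇒==ˢ (Y ∩ (S ∩ F)) ∅ (Disjoint⇒∅ λ y z → ∅⇒Disjoint d y (p∩q⊆p S F z))))
      (λ e → let (a , b) = ∧⁻ {isFlatᵇ (M ∣ F) Y} e
                 FY = isFlatᵇ⇒Flat {M = M ∣ F} a
                 d = ==ˢ⇒≡ (Y ∩ (S ∩ F)) ∅ b
             in ∧⁺ {isFlatᵇ M Y} (Flat⇒isFlatᵇ {M = M} (flat-unrestrict mat FF FY))
                  (≡⇒==ˢ (Y ∩ S) ∅ (Disjoint⇒∅ λ y z → ∅⇒Disjoint d y (x∈p∩q⁺ (z , proj₁ FY y)))))
    join : ∀ a b z x → (⟦ a ⟧ *ℤ (⟦ b ⟧ *ℤ z)) *ℤ x ≡ ⟦ a ∧ b ⟧ *ℤ (z *ℤ x)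
    join a b z x = trans (assoc ⟦ a ⟧ ⟦ b ⟧ z x) (cong (_*ℤ (z *ℤ x)) (sym (⟦∧⟧ a b)))
      where
      assoc : ∀ a b z x → (a *ℤ (b *ℤ z)) *ℤ x ≡ (a *ℤ b) *ℤ (z *ℤ x)
      assoc = solve-∀
    pt : ∀ Y → (⟦ isFlatᵇ M Y ⟧ *ℤ (⟦ (Y ∩ S) ==ˢ ∅ ⟧ *ℤ μ M Y)) *ℤ c Y ≡
      (⟦ isFlatᵇ (M ∣ F) Y ⟧ *ℤ (⟦ (Y ∩ (S ∩ F)) ==ˢ ∅ ⟧ *ℤ μ (M ∣ F) Y)) *ℤ ⟦ ((r M F ∸ r M (S ∩ F)) ∸ r M Y) ≡ᵇ k ⟧
    pt Y = trans (join (isFlatᵇ M Y) ((Y ∩ S) ==ˢ ∅) (μ M Y) (c Y)) (trans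
      (trans (cong (λ b → ⟦ b ⟧ *ℤ (μ M Y *ℤ c Y)) (test Y))
        (guard (isFlatᵇ (M ∣ F) Y ∧ ((Y ∩ (S ∩ F)) ==ˢ ∅)) (λ e → cong₂ (λ m z → m *ℤ ⟦ (z ∸ r M Y) ≡ᵇ k ⟧)
          (μ-restrict mat ll FF Y (isFlatᵇ⇒Flat {M = M ∣ F} (proj₁ (∧⁻ {isFlatᵇ (M ∣ F) Y} e)))) corank)))
      (sym (join (isFlatᵇ (M ∣ F) Y) ((Y ∩ (S ∩ F)) ==ˢ ∅) (μ (M ∣ F) Y) _)))

  -- No exponent exceeds r(E), so the first r(E) + 1 coefficients determine the cofactor.
  cofactor-vanishes : ∀ S k → suc (r M (E M)) ≤ k → cofactor M S k ≡ 0ℤ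
  cofactor-vanishes S k r<k = ∑-zero (allSubsets N) λ Y → trans
    (cong (λ b → (⟦ isFlatᵇ M Y ⟧ *ℤ (⟦ (Y ∩ S) ==ˢ ∅ ⟧ *ℤ μ M Y)) *ℤ ⟦ b ⟧) (fails Y)) (ℤP.*-zeroʳ (⟦ isFlatᵇ M Y ⟧ *ℤ (⟦ (Y ∩ S) ==ˢ ∅ ⟧ *ℤ μ M Y)))
    where
    fails : ∀ Y → (((r M (E M) ∸ r M S) ∸ r M Y) ≡ᵇ k) ≡ false
    fails Y with ((r M (E M) ∸ r M S) ∸ r M Y) ≡ᵇ k in e
    ... | false = refl
    ... | true = ⊥-elim (ℕP.<-irrefl refl (ℕP.<-≤-trans r<k (subst (_≤ r M (E M)) (≡ᵇ⇒≡ e)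
      (ℕP.≤-trans (ℕP.m∸n≤m _ (r M Y)) (ℕP.m∸n≤m _ (r M S))))))

  -- A flat Y avoiding S has r(S) + r(Y) ≤ r(E) = r(S), hence is empty; only the term of ∅ survives.
  cofactor-spanning : ∀ {S} → Skew M S → r M S ≡ r M (E M) → S ⊆ E M → ∀ k → cofactor M S k ≡ δ 0 k
  cofactor-spanning {S} skew rS S⊆E k = trans (∑ˢ-single ∅ _ other) (trans
    (cong₂ (λ a b → (⟦ a ⟧ *ℤ (⟦ b ⟧ *ℤ μ M ∅)) *ℤ ⟦ ((r M (E M) ∸ r M S) ∸ r M ∅) ≡ᵇ k ⟧) isFlatᵇ-∅
      (≡⇒==ˢ (∅ ∩ S) ∅ (∩-zeroˡ S)))
    (trans (cong₂ (λ m z → (1ℤ *ℤ (1ℤ *ℤ m)) *ℤ ⟦ z ≡ᵇ k ⟧) μ-∅ zeroexp) (ℤP.*-identityˡ (δ 0 k))))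
    where
    zeroexp : (r M (E M) ∸ r M S) ∸ r M ∅ ≡ 0
    zeroexp = trans (cong (_∸ r M ∅) (trans (cong (r M (E M) ∸_) rS) (ℕP.n∸n≡0 (r M (E M))))) (ℕP.0∸n≡0 (r M ∅))
    other : ∀ Y → Y ≢ ∅ → (⟦ isFlatᵇ M Y ⟧ *ℤ (⟦ (Y ∩ S) ==ˢ ∅ ⟧ *ℤ μ M Y)) *ℤ ⟦ ((r M (E M) ∸ r M S) ∸ r M Y) ≡ᵇ k ⟧ ≡ 0ℤ
    other Y Y≢∅ with isFlatᵇ M Y in e₁ | (Y ∩ S) ==ˢ ∅ in e₂
    ... | false | b = trans (cong (_*ℤ c) (ℤP.*-zeroˡ (⟦ b ⟧ *ℤ μ M Y))) (ℤP.*-zeroˡ c)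
      where c = ⟦ ((r M (E M) ∸ r M S) ∸ r M Y) ≡ᵇ k ⟧
    ... | true | false = trans (cong (λ z → (1ℤ *ℤ z) *ℤ c) (ℤP.*-zeroˡ (μ M Y))) (ℤP.*-zeroˡ c)
      where c = ⟦ ((r M (E M) ∸ r M S) ∸ r M Y) ≡ᵇ k ⟧
    ... | true | true = ⊥-elim (Y≢∅ (rank0⇒∅ mat ll (proj₁ FY) (ℕP.n≤0⇒n≡0 (ℕP.+-cancelˡ-≤ (r M S) _ _ (begin
      r M S ℕ.+ r M Y ≤⟨ skew Y FY (==ˢ⇒≡ (Y ∩ S) ∅ e₂) ⟩
      r M (S ∪ Y)     ≤⟨ mono id (∪-lub {A = S} S⊆E (proj₁ FY)) ⟩
      r M (E M)       ≡⟨ sym rS ⟩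
      r M S           ≡⟨ sym (ℕP.+-identityʳ _) ⟩
      r M S ℕ.+ 0     ∎)))))
      where
      open ℕP.≤-Reasoning
      FY = isFlatᵇ⇒Flat {M = M} e₁

module _ {N : ℕ} {M : RawMatroid N} (simple : IsSimple M) {e : Fin N} (e∈E : e ∈ E M) where
  open Simple simple
  open Contract simple e∈E

  -- H spans `M / e`, so its cofactor there is 1 and χ(M/e) = χ(M|H), a factor of χ(M). The quotient
  -- is the cofactor of H in M.
  divisional-coatom : ∀ {H} → H ⊆ E M → Skew M H → suc (r M H) ≡ r M (E M) → e ∉ H → Divisional M e
  divisional-coatom {H} H⊆E skew co e∉H = applyUpTo (cofactor M H) (suc (r M (E M))) , λ k → begin
    χ M k
      ≡⟨ Factor.χ-factor isMatroid loopless H⊆E skew k ⟩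
    (χ (M ∣ H) ⊛ cofactor M H) k
      ≡⟨ ⊛-cong {q = cofactor M H} (λ j → sym (χ/ j))
           (λ j → sym (coeffs-applyUpTo (cofactor M H) (suc (r M (E M))) (cofactor-vanishes isMatroid loopless H) j)) k ⟩
    (χ (M / e) ⊛ coeffs (applyUpTo (cofactor M H) (suc (r M (E M))))) k ∎
    where
    open ≡-Reasoning
    rH : r (M / e) H ≡ r (M / e) (E M - e)
    rH = ℕP.suc-injective (trans (cong suc (r-contract-skew H⊆E skew e∉H H id)) (trans co (sym (r-contract-∋ id e∈E))))
    χ/ : ∀ j → χ (M / e) j ≡ χ (M ∣ H) j
    χ/ j = trans (χ-contract-factor H⊆E skew e∉H j) (trans
      (⊛-cong {p = χ (M ∣ H)} (λ _ → refl) (cofactor-spanning isMatroid-contract loopless-contract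
        (skew-contract H⊆E skew e∉H) rH (S⊆E-e H⊆E skew e∉H)) j)
      (⊛-δ0 (χ (M ∣ H)) j))

  -- Let B and B′ be the cofactors of S in M and in M/e. They are also the cofactors of Z in M|F and
  -- in (M|F)/e, so divisibility in M|F reads χ(M|Z) B = χ(M|Z) B′ c. Cancelling χ(M|Z) and
  -- multiplying by χ(M|S) gives χ(M) = χ(M/e) c with the same quotient c.
  divisional-join : ∀ {S F Z} → S ⊆ E M → Skew M S → Flat M F → E M ⊆ S ∪ F → S ∩ F ≡ Z →
    r M (E M) ℕ.+ r M Z ≡ r M S ℕ.+ r M F → e ∉ S → e ∈ F → Divisional (M ∣ F) e → Divisional M e
  divisional-join {S} {F} {Z} S⊆E skew FF cover Z≡ ranks e∉S e∈F (c , hc) = c , λ k → begin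
    χ M k
      ≡⟨ Factor.χ-factor isMatroid loopless S⊆E skew k ⟩
    (χ (M ∣ S) ⊛ cofactor M S) k
      ≡⟨ ⊛-cong {p = χ (M ∣ S)} (λ _ → refl) cofactors k ⟩
    (χ (M ∣ S) ⊛ (cofactor (M / e) S ⊛ coeffs c)) k
      ≡⟨ ⊛-assoc (χ (M ∣ S)) (cofactor (M / e) S) (coeffs c) k ⟨
    ((χ (M ∣ S) ⊛ cofactor (M / e) S) ⊛ coeffs c) k
      ≡⟨ ⊛-cong {q = coeffs c} (λ j → sym (χ-contract-factor S⊆E skew e∉S j)) (λ _ → refl) k ⟩
    (χ (M / e) ⊛ coeffs c) k ∎
    where
    open ≡-Reasoning
    Z⊆S : Z ⊆ S
    Z⊆S m = p∩q⊆p S F (subst (_ ∈_) (sym Z≡) m)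
    Z⊆F : Z ⊆ F
    Z⊆F m = p∩q⊆q S F (subst (_ ∈_) (sym Z≡) m)
    simpleF : IsSimple (M ∣ F)
    simpleF = simple-restrict (proj₁ FF)
    e∉Z : e ∉ Z
    e∉Z m = e∉S (Z⊆S m)
    skewZ : Skew (M ∣ F) Z
    skewZ = subst (Skew (M ∣ F)) Z≡ (skew-restrict isMatroid S⊆E skew FF)
    χF : ∀ k → χ (M ∣ F) k ≡ (χ (M ∣ Z) ⊛ cofactor M S) k
    χF k = trans (Factor.χ-factor (restrict (proj₁ FF)) (Loopless-restrict {M = M} (proj₁ FF) loopless) Z⊆F skewZ k)
      (⊛-cong {p = χ (M ∣ Z)} (λ _ → refl)
        (λ j → sym (cofactor-restrict isMatroid loopless S⊆E FF cover Z≡ ranks j)) k)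
    contracted-ranks : r (M / e) (E M - e) ℕ.+ r (M / e) Z ≡ r (M / e) S ℕ.+ r (M / e) (F - e)
    contracted-ranks = ℕP.suc-injective (trans
      (cong₂ ℕ._+_ (r-contract-∋ id e∈E) (r-contract-skew S⊆E skew e∉S Z Z⊆S))
      (trans ranks (trans (sym (cong₂ ℕ._+_ (r-contract-skew S⊆E skew e∉S S id) (r-contract-∋ (proj₁ FF) e∈F))) (ℕP.+-suc _ _))))
    cover-e : E M - e ⊆ S ∪ (F - e)
    cover-e m with ∈-⁻ m
    ... | a , b with x∈p∪q⁻ S F (cover a)
    ...   | inj₁ s = p⊆p∪q (F - e) s
    ...   | inj₂ f = q⊆p∪q S (F - e) (x∈p∧x≢y⇒x∈p-y f b)
    S∩F-e : S ∩ (F - e) ≡ Z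
    S∩F-e = trans (⊆-antisym
      (λ m → let (a , b) = x∈p∩q⁻ S (F - e) m in x∈p∩q⁺ (a , proj₁ (∈-⁻ b)))
      (λ m → let (a , b) = x∈p∩q⁻ S F m in x∈p∩q⁺ (a , x∈p∧x≢y⇒x∈p-y b λ { refl → e∉S a }))) Z≡
    χF/ : ∀ k → χ ((M ∣ F) / e) k ≡ (χ (M ∣ Z) ⊛ cofactor (M / e) S) k
    χF/ k = trans (Contract.χ-contract-factor simpleF e∈F Z⊆F skewZ e∉Z k)
      (⊛-cong {p = χ (M ∣ Z)} (λ _ → refl)
        (λ j → sym (cofactor-restrict isMatroid-contract loopless-contract (S⊆E-e S⊆E skew e∉S)
          (flat-contract FF e∈F) cover-e S∩F-e contracted-ranks j)) k)
    cofactors : ∀ k → cofactor M S k ≡ (cofactor (M / e) S ⊛ coeffs c) k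
    cofactors = ⊛-cancelˡ (r M Z) (χ (M ∣ Z)) (cofactor M S) (cofactor (M / e) S ⊛ coeffs c)
      (λ z → 1≢0 (trans (sym (χ-leading (restrict Z⊆E) (Loopless-restrict {M = M} Z⊆E loopless))) z))
      (λ k → trans (sym (χF k)) (trans (hc k) (trans
        (⊛-cong {q = coeffs c} χF/ (λ _ → refl) k)
        (⊛-assoc (χ (M ∣ Z)) (cofactor (M / e) S) (coeffs c) k))))
      where
      Z⊆E : Z ⊆ E M
      Z⊆E m = S⊆E (Z⊆S m)
      1≢0 : 1ℤ ≢ 0ℤ
      1≢0 ()

-- Modularity and isomorphisms

-- Modularity with the union in place of the join: both have the same rank, so closures drop out of
-- the computations.
ModularSum : ∀ {N} → RawMatroid N → Subset N → Set
ModularSum M X = ∀ Y → Flat M Y → r M X ℕ.+ r M Y ≡ r M (X ∩ Y) ℕ.+ r M (X ∪ Y)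

module _ {N : ℕ} {M : RawMatroid N} (mat : IsMatroid M) where
  open Rank mat

  Modular⇒Sum : ∀ {X} → Modular M X → ModularSum M X
  Modular⇒Sum {X} (FX , h) Y FY = trans (h Y FY)
    (cong (r M (X ∩ Y) ℕ.+_) (r-cl (∪-lub {A = X} (proj₁ FX) (proj₁ FY))))

  Sum⇒Modular : ∀ {X} → Flat M X → ModularSum M X → Modular M X
  Sum⇒Modular {X} FX h = FX , λ Y FY → trans (h Y FY)
    (cong (r M (X ∩ Y) ℕ.+_) (sym (r-cl (∪-lub {A = X} (proj₁ FX) (proj₁ FY)))))

  ≤⇒Sum : ∀ {X} → X ⊆ E M → (∀ Y → Flat M Y → r M X ℕ.+ r M Y ≤ r M (X ∩ Y) ℕ.+ r M (X ∪ Y)) → ModularSum M X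
  ≤⇒Sum {X} X⊆E h Y FY = ℕP.≤-antisym (h Y FY) (subst (_≤ r M X ℕ.+ r M Y) (ℕP.+-comm (r M (X ∪ Y)) (r M (X ∩ Y)))
    (IsMatroid.r-submod mat X Y X⊆E (proj₁ FY)))

  Sum⇒Skew : ∀ {X} → ModularSum M X → Skew M X
  Sum⇒Skew {X} h Y FY d = ℕP.≤-reflexive (trans (h Y FY)
    (cong (ℕ._+ r M (X ∪ Y)) (trans (cong (r M) (trans (∩-comm X Y) d)) r∅)))

-- abstract, since otherwise preimage unfolds to tabulate and its arguments can no longer be inferred.
abstract
  preimage : ∀ {m n} → (Fin m → Fin n) → Subset m → Subset n → Subset m
  preimage h D A = tabulate (λ x → lookup D x ∧ lookup A (h x))

  ∈-preimage⁺ : ∀ {m n} {h : Fin m → Fin n} {D A x} → x ∈ D → h x ∈ A → x ∈ preimage h D A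
  ∈-preimage⁺ d a = ∈-tabulate⁺ (∧⁺ (∈⇒lookup d) (∈⇒lookup a))

  ∈-preimage⁻ : ∀ {m n} {h : Fin m → Fin n} {D A x} → x ∈ preimage h D A → x ∈ D × h x ∈ A
  ∈-preimage⁻ {D = D} {x = x} m with ∧⁻ {lookup D x} (∈-tabulate⁻ m)
  ... | a , b = lookup⇒∈ a , lookup⇒∈ b

-- The maps live on all of `Fin N` and are constrained on the ground sets alone. The image of A is
-- encoded as its preimage under `from`, which commutes with unions and intersections at once.
record Iso {N : ℕ} (M M′ : RawMatroid N) : Set where
  field
    to from : Fin N → Fin N
    to-∈ : ∀ {x} → x ∈ E M → to x ∈ E M′
    from-∈ : ∀ {y} → y ∈ E M′ → from y ∈ E M
    from-to : ∀ {x} → x ∈ E M → from (to x) ≡ x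
    to-from : ∀ {y} → y ∈ E M′ → to (from y) ≡ y
    rank : ∀ {A} → A ⊆ E M → r M′ (preimage from (E M′) A) ≡ r M A

module IsoImage {N : ℕ} {M M′ : RawMatroid N} (iso : Iso M M′) where
  open Iso iso public

  img : Subset N → Subset N
  img = preimage from (E M′)

  img⊆E : ∀ {A} → img A ⊆ E M′
  img⊆E m = proj₁ (∈-preimage⁻ m)

  to-img : ∀ {A x} → A ⊆ E M → x ∈ A → to x ∈ img A
  to-img {A} {x} A⊆E m = ∈-preimage⁺ (to-∈ (A⊆E m)) (subst (_∈ A) (sym (from-to (A⊆E m))) m)

  img-∪ : ∀ A B → img (A ∪ B) ≡ img A ∪ img B
  img-∪ A B = ⊆-antisym
    (λ {x} m → let (a , b) = ∈-preimage⁻ m in split a (x∈p∪q⁻ A B b))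
    (∪-lub {A = img A}
      (λ m → let (a , b) = ∈-preimage⁻ m in ∈-preimage⁺ a (p⊆p∪q B b))
      (λ m → let (a , b) = ∈-preimage⁻ m in ∈-preimage⁺ a (q⊆p∪q A B b)))
    where
    split : ∀ {x} → x ∈ E M′ → from x ∈ A ⊎ from x ∈ B → x ∈ img A ∪ img B
    split a (inj₁ b) = p⊆p∪q (img B) (∈-preimage⁺ a b)
    split a (inj₂ b) = q⊆p∪q (img A) (img B) (∈-preimage⁺ a b)

  img-∩ : ∀ A B → img (A ∩ B) ≡ img A ∩ img B
  img-∩ A B = ⊆-antisym
    (λ m → let (a , b) = ∈-preimage⁻ m ; (c , d) = x∈p∩q⁻ A B b in x∈p∩q⁺ (∈-preimage⁺ a c , ∈-preimage⁺ a d))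
    (λ m → let (a , b) = x∈p∩q⁻ (img A) (img B) m ; (c , d) = ∈-preimage⁻ a in
      ∈-preimage⁺ c (x∈p∩q⁺ (d , proj₂ (∈-preimage⁻ b))))

  img-E : img (E M) ≡ E M′
  img-E = ⊆-antisym img⊆E (λ m → ∈-preimage⁺ m (from-∈ m))

  img-preimage : ∀ {B} → B ⊆ E M′ → img (preimage to (E M) B) ≡ B
  img-preimage {B} B⊆E = ⊆-antisym
    (λ m → let (a , b) = ∈-preimage⁻ m in subst (_∈ B) (to-from a) (proj₂ (∈-preimage⁻ b)))
    (λ m → ∈-preimage⁺ (B⊆E m) (∈-preimage⁺ (from-∈ (B⊆E m)) (subst (_∈ B) (sym (to-from (B⊆E m))) m)))

  img-∅ : E M ≡ ∅ → E M′ ≡ ∅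
  img-∅ e = Empty-unique λ (x , m) → ∉⊥ (subst (from x ∈_) e (from-∈ m))

  img-flat : IsMatroid M → IsMatroid M′ → ∀ {A} → Flat M A → Flat M′ (img A)
  img-flat mat mat′ {A} FA = Rank.flat-intro mat′ img⊆E λ f f∈E h → ∈-preimage⁺ f∈E
    (Rank.flat-closed mat FA (from-∈ f∈E) (begin
      r M (A ∪ ⁅ from f ⁆)          ≡⟨ rank (∪⁅⁆-lub {A = A} (proj₁ FA) (from-∈ f∈E)) ⟨
      r M′ (img (A ∪ ⁅ from f ⁆))   ≤⟨ Rank.mono mat′ (∪⁅⁆-lub {A = img A} img⊆E f∈E) (λ m → sub f m f∈E) ⟩
      r M′ (img A ∪ ⁅ f ⁆)          ≤⟨ h ⟩
      r M′ (img A)                  ≡⟨ rank (proj₁ FA) ⟩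
      r M A                         ∎))
    where
    open ℕP.≤-Reasoning
    sub : ∀ f {x} → x ∈ img (A ∪ ⁅ from f ⁆) → f ∈ E M′ → x ∈ img A ∪ ⁅ f ⁆
    sub f {x} m f∈E with ∈-preimage⁻ m
    ... | a , b with x∈p∪q⁻ A ⁅ from f ⁆ b
    ...   | inj₁ c = p⊆p∪q ⁅ f ⁆ (∈-preimage⁺ a c)
    ...   | inj₂ c = q⊆p∪q (img A) ⁅ f ⁆ (subst (_∈ ⁅ f ⁆)
      (trans (sym (to-from f∈E)) (trans (cong to (sym (x∈⁅y⁆⇒x≡y (from f) c))) (to-from a))) (x∈⁅x⁆ f))

Iso-sym : ∀ {N} {M M′ : RawMatroid N} → Iso M M′ → Iso M′ M
Iso-sym {M = M} {M′} iso = record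
  { to = from ; from = to ; to-∈ = from-∈ ; from-∈ = to-∈ ; from-to = to-from ; to-from = from-to
  ; rank = λ {B} B⊆E → trans (sym (rank (λ m → proj₁ (∈-preimage⁻ m)))) (cong (r M′) (img-preimage B⊆E)) }
  where open IsoImage iso

Iso-restrict : ∀ {N} {M M′ : RawMatroid N} (iso : Iso M M′) {A : Subset N} → A ⊆ E M →
  Iso (M ∣ A) (M′ ∣ IsoImage.img iso A)
Iso-restrict {M = M} {M′} iso {A} A⊆E = record
  { to = to ; from = from ; to-∈ = to-img A⊆E ; from-∈ = λ m → proj₂ (∈-preimage⁻ m)
  ; from-to = λ m → from-to (A⊆E m) ; to-from = λ m → to-from (img⊆E m)
  ; rank = λ {B} B⊆A → trans (cong (r M′) (⊆-antisym
      (λ m → let (a , b) = ∈-preimage⁻ m in ∈-preimage⁺ (img⊆E a) b)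
      (λ m → let (a , b) = ∈-preimage⁻ m in ∈-preimage⁺ (∈-preimage⁺ a (B⊆A b)) b)))
      (rank (λ m → A⊆E (B⊆A m))) }
  where open IsoImage iso

module _ {N : ℕ} {M M′ : RawMatroid N} (iso : Iso M M′) (mat : IsMatroid M) (mat′ : IsMatroid M′) where
  open IsoImage iso

  img-modular : ∀ {A} → Modular M A → Modular M′ (img A)
  img-modular {A} mod@(FA , _) = Sum⇒Modular mat′ (img-flat mat mat′ FA) λ Y FY →
    let B = IsoImage.img (Iso-sym iso) Y
        FB = IsoImage.img-flat (Iso-sym iso) mat′ mat FY
        img-B = img-preimage (proj₁ FY)
    in subst (λ Z → r M′ (img A) ℕ.+ r M′ Z ≡ r M′ (img A ∩ Z) ℕ.+ r M′ (img A ∪ Z)) img-B (begin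
      r M′ (img A) ℕ.+ r M′ (img B)
        ≡⟨ cong₂ ℕ._+_ (rank (proj₁ FA)) (rank (proj₁ FB)) ⟩
      r M A ℕ.+ r M B
        ≡⟨ Modular⇒Sum mat mod B FB ⟩
      r M (A ∩ B) ℕ.+ r M (A ∪ B)
        ≡⟨ cong₂ ℕ._+_ (rank (λ m → proj₁ FA (p∩q⊆p A B m))) (rank (∪-lub {A = A} (proj₁ FA) (proj₁ FB))) ⟨
      r M′ (img (A ∩ B)) ℕ.+ r M′ (img (A ∪ B))
        ≡⟨ cong₂ (λ x y → r M′ x ℕ.+ r M′ y) (img-∩ A B) (img-∪ A B) ⟩
      r M′ (img A ∩ img B) ℕ.+ r M′ (img A ∪ img B) ∎)
    where open ≡-Reasoning

  img-proper : ∀ {A} → ProperFlat M A → ProperFlat M′ (img A)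
  img-proper {A} (FA , A≢E) = img-flat mat mat′ FA , λ e → A≢E (⊆-antisym (proj₁ FA) λ {x} m →
    subst (_∈ A) (from-to m) (proj₂ (∈-preimage⁻ (subst (to x ∈_) (sym e) (to-∈ m)))))

Iso-round : ∀ {N} {M M′ : RawMatroid N} → Iso M M′ → IsMatroid M → IsMatroid M′ → Round M → Round M′
Iso-round {M = M} {M′} iso mat mat′ round (F₁ , F₂ , p₁ , p₂ , cover) = round
  (img F₁ , img F₂ , img-proper (Iso-sym iso) mat′ mat p₁ , img-proper (Iso-sym iso) mat′ mat p₂ ,
   trans (sym (img-∪ F₁ F₂)) (trans (cong img cover) img-E))
  where open IsoImage (Iso-sym iso)

-- The whole derivation is transported, each modular flat being replaced by its image and the
-- isomorphism being restricted to it.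
ME-iso : ∀ {N} {M M′ : RawMatroid N} → ME M → Iso M M′ → IsSimple M′ → ME M′
ME-iso (me-empty _ e) iso simple′ = me-empty simple′ (IsoImage.img-∅ iso e)
ME-iso {M = M} {M′} (me-coatom X simple (FX , co) mod me) iso simple′ =
  me-coatom (img X) simple′
    (img-flat mat mat′ FX , trans (cong suc (rank (proj₁ FX))) (trans co (trans (sym (rank id)) (cong (r M′) img-E))))
    (img-modular iso mat mat′ mod)
    (ME-iso me (Iso-restrict iso (proj₁ FX)) (Simple.simple-restrict simple′ img⊆E))
  where
  open IsoImage iso
  mat = IsSimple.isMatroid simple
  mat′ = IsSimple.isMatroid simple′
ME-iso {M = M} {M′} (me-join E₁ E₂ simple p₁ m₁ p₂ m₂ cover (FZ , round) me₁ me₂) iso simple′ =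
  me-join (img E₁) (img E₂) simple′
    (img-proper iso mat mat′ p₁) (img-modular iso mat mat′ m₁)
    (img-proper iso mat mat′ p₂) (img-modular iso mat mat′ m₂)
    (trans (sym (img-∪ E₁ E₂)) (trans (cong img cover) img-E))
    (subst (RoundFlat M′) (img-∩ E₁ E₂) (img-flat mat mat′ FZ ,
      Iso-round (Iso-restrict iso (proj₁ FZ)) (Rank.restrict mat (proj₁ FZ)) (Rank.restrict mat′ img⊆E) round))
    (ME-iso me₁ (Iso-restrict iso (proj₁ (proj₁ p₁))) (Simple.simple-restrict simple′ img⊆E))
    (ME-iso me₂ (Iso-restrict iso (proj₁ (proj₁ p₂))) (Simple.simple-restrict simple′ img⊆E))
  where
  open IsoImage iso
  mat = IsSimple.isMatroid simple
  mat′ = IsSimple.isMatroid simple′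

-- Simplification

allᵇ⁻ : {A : Set} (p : A → Bool) (xs : List A) → allᵇ p xs ≡ true → ∀ {x} → x ∈ᴸ xs → p x ≡ true
allᵇ⁻ p (y ∷ ys) h (Any.here refl) = proj₁ (∧⁻ h)
allᵇ⁻ p (y ∷ ys) h (Any.there m) = allᵇ⁻ p ys (proj₂ (∧⁻ {p y} h)) m

allᵇ⁺ : {A : Set} (p : A → Bool) (xs : List A) → (∀ x → p x ≡ true) → allᵇ p xs ≡ true
allᵇ⁺ p [] h = refl
allᵇ⁺ p (y ∷ ys) h = ∧⁺ (h y) (allᵇ⁺ p ys h)

<⇒<ᵇ : ∀ {m n} → m < n → (m ℕ.<ᵇ n) ≡ true
<⇒<ᵇ {m} {n} h with m ℕ.<ᵇ n | ℕP.<⇒<ᵇ h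
... | true | _ = refl

module Simplify {N : ℕ} {L : RawMatroid N} (mat : IsMatroid L) (ll : Loopless L) where
  open Rank mat

  r⁅⁆≡1 : ∀ {f} → f ∈ E L → r L ⁅ f ⁆ ≡ 1
  r⁅⁆≡1 {f} f∈E = ℕP.≤-antisym (r⁅⁆≤1 f∈E) (ℕP.n≢0⇒n>0 (ll f f∈E))

  private
    nonloop : ∀ {f} → f ∈ E L → lookup (E L) f ∧ not (r L ⁅ f ⁆ ≡ᵇ 0) ≡ true
    nonloop {f} f∈E = ∧⁺ (∈⇒lookup f∈E) (cong (λ n → not (n ≡ᵇ 0)) (r⁅⁆≡1 f∈E))

  si-∈⁻ : ∀ {f} → f ∈ E (si L) → f ∈ E L × (∀ g → g ∈ E L → toℕ g < toℕ f → r L (⁅ g ⁆ ∪ ⁅ f ⁆) ≢ 1)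
  si-∈⁻ {f} m with ∧⁻ {lookup (E L) f ∧ not (r L ⁅ f ⁆ ≡ᵇ 0)} (∈-tabulate⁻ m)
  ... | a , b = f∈E , λ g g∈E g<f par → lem (<⇒<ᵇ g<f) (nonloop g∈E) (nonloop f∈E) (≡⇒≡ᵇ par) (allᵇ⁻ _ (allFin N) b (∈-allFin g))
    where
    f∈E : f ∈ E L
    f∈E = lookup⇒∈ (proj₁ (∧⁻ a))
    lem : ∀ {a b c d} → a ≡ true → b ≡ true → c ≡ true → d ≡ true → not (a ∧ (b ∧ c ∧ d)) ≡ true → ⊥
    lem refl refl refl refl ()

  si-∈⁺ : ∀ {f} → f ∈ E L → (∀ g → g ∈ E L → toℕ g < toℕ f → r L (⁅ g ⁆ ∪ ⁅ f ⁆) ≢ 1) → f ∈ E (si L)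
  si-∈⁺ {f} f∈E h = ∈-tabulate⁺ (∧⁺ (nonloop f∈E) (allᵇ⁺ _ (allFin N) λ g →
    lem λ a b d → h g (lookup⇒∈ (proj₁ (∧⁻ b))) (ℕP.<ᵇ⇒< _ _ (subst T (sym a) _)) (≡ᵇ⇒≡ d)))
    where
    lem : ∀ {a b c d} → (a ≡ true → b ≡ true → d ≡ true → ⊥) → not (a ∧ (b ∧ c ∧ d)) ≡ true
    lem {false} k = refl
    lem {true} {false} k = refl
    lem {true} {true} {false} k = refl
    lem {true} {true} {true} {false} k = refl
    lem {true} {true} {true} {true} k = ⊥-elim (k refl refl refl)

  si⊆E : E (si L) ⊆ E L
  si⊆E m = proj₁ (si-∈⁻ m)

  pair⊆E : ∀ {f g} → f ∈ E L → g ∈ E L → ⁅ f ⁆ ∪ ⁅ g ⁆ ⊆ E L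
  pair⊆E {f} f∈E g∈E = ∪⁅⁆-lub {A = ⁅ f ⁆} (⁅⁆-⊆ f∈E) g∈E

  par-refl : ∀ {f} → f ∈ E L → r L (⁅ f ⁆ ∪ ⁅ f ⁆) ≡ 1
  par-refl {f} f∈E = trans (cong (r L) (∪-idem ⁅ f ⁆)) (r⁅⁆≡1 f∈E)

  par-sym : ∀ {f g} → r L (⁅ f ⁆ ∪ ⁅ g ⁆) ≡ 1 → r L (⁅ g ⁆ ∪ ⁅ f ⁆) ≡ 1
  par-sym {f} {g} h = trans (cong (r L) (∪-comm ⁅ g ⁆ ⁅ f ⁆)) h

  par-trans : ∀ {f g h} → f ∈ E L → g ∈ E L → h ∈ E L →
    r L (⁅ f ⁆ ∪ ⁅ g ⁆) ≡ 1 → r L (⁅ g ⁆ ∪ ⁅ h ⁆) ≡ 1 → r L (⁅ f ⁆ ∪ ⁅ h ⁆) ≡ 1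
  par-trans {f} {g} {h} f∈E g∈E h∈E fg gh = ℕP.≤-antisym
    (ℕP.+-cancelʳ-≤ 1 _ _ (begin
      r L (⁅ f ⁆ ∪ ⁅ h ⁆) ℕ.+ 1
        ≡⟨ cong (r L (⁅ f ⁆ ∪ ⁅ h ⁆) ℕ.+_) (r⁅⁆≡1 g∈E) ⟨
      r L (⁅ f ⁆ ∪ ⁅ h ⁆) ℕ.+ r L ⁅ g ⁆
        ≤⟨ ℕP.+-monoˡ-≤ _ (mono (∪-lub {A = ⁅ f ⁆ ∪ ⁅ g ⁆} (pair⊆E f∈E g∈E) (pair⊆E g∈E h∈E))
             (∪-mono {A = ⁅ f ⁆} {⁅ h ⁆} (p⊆p∪q ⁅ g ⁆) (q⊆p∪q ⁅ g ⁆ ⁅ h ⁆))) ⟩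
      r L ((⁅ f ⁆ ∪ ⁅ g ⁆) ∪ (⁅ g ⁆ ∪ ⁅ h ⁆)) ℕ.+ r L ⁅ g ⁆
        ≤⟨ submod-⊆ (pair⊆E f∈E g∈E) (pair⊆E g∈E h∈E) (q⊆p∪q ⁅ f ⁆ ⁅ g ⁆) (p⊆p∪q ⁅ h ⁆) ⟩
      r L (⁅ f ⁆ ∪ ⁅ g ⁆) ℕ.+ r L (⁅ g ⁆ ∪ ⁅ h ⁆)
        ≡⟨ cong₂ ℕ._+_ fg gh ⟩
      2 ∎))
    (ℕP.≤-trans (ℕP.≤-reflexive (sym (r⁅⁆≡1 f∈E))) (mono (pair⊆E f∈E h∈E) (p⊆p∪q ⁅ h ⁆)))
    where open ℕP.≤-Reasoning

  -- Pass to a parallel element of smaller index as long as there is one.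
  si-rep : ∀ {f} → f ∈ E L → ∃ λ g → g ∈ E (si L) × r L (⁅ g ⁆ ∪ ⁅ f ⁆) ≡ 1
  si-rep {f} f∈E = go f f∈E (<-wellFounded (toℕ f))
    where
    go : ∀ f → f ∈ E L → Acc _<_ (toℕ f) → ∃ λ g → g ∈ E (si L) × r L (⁅ g ⁆ ∪ ⁅ f ⁆) ≡ 1
    go f f∈E (acc rs) with FinP.any? (λ g → (g ∈? E L) ×-dec ((toℕ g ℕP.<? toℕ f) ×-dec (r L (⁅ g ⁆ ∪ ⁅ f ⁆) ℕP.≟ 1)))
    ... | yes (g , g∈E , g<f , par) with go g g∈E (rs g<f)
    ...   | h , h∈ , par′ = h , h∈ , par-trans (si⊆E h∈) g∈E f∈E par′ par
    go f f∈E (acc rs) | no none = f , si-∈⁺ f∈E (λ g g∈E g<f par → none (g , g∈E , g<f , par)) , par-refl f∈E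

  si-unique : ∀ {f g} → f ∈ E (si L) → g ∈ E (si L) → r L (⁅ f ⁆ ∪ ⁅ g ⁆) ≡ 1 → f ≡ g
  si-unique {f} {g} f∈ g∈ par with ℕP.<-cmp (toℕ f) (toℕ g)
  ... | tri< f<g _ _ = ⊥-elim (proj₂ (si-∈⁻ g∈) f (si⊆E f∈) f<g par)
  ... | tri≈ _ e _ = FinP.toℕ-injective e
  ... | tri> _ _ g<f = ⊥-elim (proj₂ (si-∈⁻ f∈) g (si⊆E g∈) g<f (par-sym par))

  si-simple : IsSimple (si L)
  si-simple = record
    { isMatroid = restrict si⊆E
    ; noLoop = λ e m → r⁅⁆≡1 (si⊆E m)
    ; noParallel = λ e f e∈ f∈ e≢f → ℕP.≤-antisym
        (ℕP.≤-trans (r-∪⁅⁆≤suc (⁅⁆-⊆ (si⊆E e∈)) (si⊆E f∈)) (s≤s (r⁅⁆≤1 (si⊆E e∈))))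
        (ℕP.≤∧≢⇒< (ℕP.≤-trans (ℕP.≤-reflexive (sym (r⁅⁆≡1 (si⊆E e∈))))
            (mono (pair⊆E (si⊆E e∈) (si⊆E f∈)) (p⊆p∪q ⁅ f ⁆)))
          (λ h → e≢f (si-unique e∈ f∈ (sym h)))) }

  par-∪ : ∀ {A a b} → A ⊆ E L → b ∈ E L → a ∈ A → r L (⁅ a ⁆ ∪ ⁅ b ⁆) ≡ 1 → r L (A ∪ ⁅ b ⁆) ≤ r L A
  par-∪ {A} {a} {b} A⊆E b∈E a∈A par = spanned-mono A⊆E (⁅⁆-⊆ b∈E) (⁅⁆-⊆ a∈A)
    (ℕP.≤-reflexive (trans par (sym (r⁅⁆≡1 (A⊆E a∈A)))))

  r-par-≤ : ∀ {A B} → A ⊆ E L → B ⊆ E L → (∀ {b} → b ∈ B → ∃ λ a → a ∈ A × r L (⁅ a ⁆ ∪ ⁅ b ⁆) ≡ 1) → r L B ≤ r L A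
  r-par-≤ {A} {B} A⊆E B⊆E h = ℕP.≤-trans (mono (∪-lub {A = A} A⊆E B⊆E) (q⊆p∪q A B))
    (∪-absorb A⊆E B⊆E λ b b∈B → let (a , a∈A , par) = h b∈B in par-∪ A⊆E (B⊆E b∈B) a∈A par)

  flat-par : ∀ {F a b} → Flat L F → b ∈ E L → a ∈ F → r L (⁅ a ⁆ ∪ ⁅ b ⁆) ≡ 1 → b ∈ F
  flat-par FF b∈E a∈F par = flat-closed FF b∈E (par-∪ (proj₁ FF) b∈E a∈F par)

  flat-rep : ∀ {F b} → Flat L F → b ∈ F → ∃ λ a → a ∈ F ∩ E (si L) × r L (⁅ a ⁆ ∪ ⁅ b ⁆) ≡ 1
  flat-rep FF b∈F with si-rep (proj₁ FF b∈F)
  ... | a , a∈ , par = a , x∈p∩q⁺ (flat-par FF (si⊆E a∈) b∈F (par-sym par) , a∈) , par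

  r-∩si : ∀ {F} → Flat L F → r L (F ∩ E (si L)) ≡ r L F
  r-∩si {F} FF = ℕP.≤-antisym (mono (proj₁ FF) (p∩q⊆p F _))
    (r-par-≤ (λ m → proj₁ FF (p∩q⊆p F _ m)) (proj₁ FF) (flat-rep FF))

  si-flat : ∀ {F} → Flat L F → Flat (si L) (F ∩ E (si L))
  si-flat = flat-restrict mat si⊆E

  -- With `si-flat`, every flat of `si L` is the trace of a flat of L, namely of its closure.
  cl-∩si : ∀ {W} → Flat (si L) W → cl L W ∩ E (si L) ≡ W
  cl-∩si {W} FW = ⊆-antisym
    (λ m → let (a , b) = x∈p∩q⁻ (cl L W) (E (si L)) m in
      Rank.flat-closed (restrict si⊆E) FW b (ℕP.≤-reflexive (proj₂ (∈-cl⁻ {M = L} a))))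
    (λ m → x∈p∩q⁺ (⊆cl (λ n → si⊆E (proj₁ FW n)) m , proj₁ FW m))

  -- Modularity of F is applied to the closure of W. Passing to traces on `si L` changes no rank,
  -- since every element has a parallel representative there.
  si-modular : ∀ {F} → Flat L F → ModularSum L F → Modular (si L) (F ∩ E (si L))
  si-modular {F} FF mod = Sum⇒Modular (restrict si⊆E) (si-flat FF) λ W FW → sum W FW
    where
    open ≡-Reasoning
    S = E (si L)
    sum : ∀ W → Flat (si L) W → r L (F ∩ S) ℕ.+ r L W ≡ r L ((F ∩ S) ∩ W) ℕ.+ r L ((F ∩ S) ∪ W)
    sum W FW = begin
      r L (F ∩ S) ℕ.+ r L W                      ≡⟨ cong₂ ℕ._+_ (r-∩si FF) (sym (r-cl W⊆E)) ⟩
      r L F ℕ.+ r L (cl L W)                     ≡⟨ mod (cl L W) (cl-flat W⊆E) ⟩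
      r L (F ∩ cl L W) ℕ.+ r L (F ∪ cl L W)      ≡⟨ cong₂ ℕ._+_ meet join ⟩
      r L ((F ∩ S) ∩ W) ℕ.+ r L ((F ∩ S) ∪ W)    ∎
      where
      W⊆E : W ⊆ E L
      W⊆E m = si⊆E (proj₁ FW m)
      meet : r L (F ∩ cl L W) ≡ r L ((F ∩ S) ∩ W)
      meet = trans (sym (r-∩si (∩-flat FF (cl-flat W⊆E)))) (cong (r L) (begin
        (F ∩ cl L W) ∩ S        ≡⟨ ∩-assoc F (cl L W) S ⟩
        F ∩ (cl L W ∩ S)        ≡⟨ cong (F ∩_) (cl-∩si FW) ⟩
        F ∩ W                   ≡⟨ cong (F ∩_) (⊆-antisym (λ m → x∈p∩q⁺ (proj₁ FW m , m)) (p∩q⊆q S W)) ⟩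
        F ∩ (S ∩ W)             ≡⟨ ∩-assoc F S W ⟨
        (F ∩ S) ∩ W             ∎))
      FSW⊆E : (F ∩ S) ∪ W ⊆ E L
      FSW⊆E = ∪-lub {A = F ∩ S} (λ m → proj₁ FF (p∩q⊆p F S m)) W⊆E
      join : r L (F ∪ cl L W) ≡ r L ((F ∩ S) ∪ W)
      join = trans (r-∪cl (proj₁ FF) W⊆E) (ℕP.≤-antisym
        (r-par-≤ FSW⊆E (∪-lub {A = F} (proj₁ FF) W⊆E) λ m → reps (x∈p∪q⁻ F W m))
        (mono (∪-lub {A = F} (proj₁ FF) W⊆E) (∪-mono {A = F ∩ S} {W} (p∩q⊆p F S) id)))
        where
        reps : ∀ {b} → b ∈ F ⊎ b ∈ W → ∃ λ a → a ∈ (F ∩ S) ∪ W × r L (⁅ a ⁆ ∪ ⁅ b ⁆) ≡ 1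
        reps (inj₁ b∈F) = let (a , a∈ , par) = flat-rep FF b∈F in a , p⊆p∪q W a∈ , par
        reps {b} (inj₂ b∈W) = b , q⊆p∪q (F ∩ S) W b∈W , par-refl (W⊆E b∈W)

-- A flat contains the whole parallel class of each of its elements, so the representative of least
-- index is the same whether computed in F or in L. The two matroids are equal and not merely
-- isomorphic.
si-restrict : ∀ {N} {L : RawMatroid N} (mat : IsMatroid L) → Loopless L → ∀ {F} → Flat L F →
  si (L ∣ F) ≡ si L ∣ (F ∩ E (si L))
si-restrict {L = L} mat ll {F} FF = cong (λ S → mkM S (r L)) (⊆-antisym
  (λ m → let (f∈F , least) = F.si-∈⁻ m in x∈p∩q⁺ (f∈F ,
    L.si-∈⁺ (proj₁ FF f∈F) λ g g∈E g<f par → least g (L.flat-par FF g∈E f∈F (L.par-sym par)) g<f par))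
  (λ m → let (f∈F , f∈S) = x∈p∩q⁻ F (E (si L)) m in
    F.si-∈⁺ f∈F λ g g∈F → proj₂ (L.si-∈⁻ f∈S) g (proj₁ FF g∈F)))
  where
  module L = Simplify mat ll
  module F = Simplify (Rank.restrict mat (proj₁ FF)) (Loopless-restrict {M = L} (proj₁ FF) ll)

-- Modular flats under contraction of a point

-- The default i only makes the function total, as the maps of `Iso` are; `choose-spec` is applied
-- where a witness exists.
choose : ∀ {n} {P : Fin n → Set} → (∀ i → Dec (P i)) → Fin n → Fin n
choose P? i with FinP.any? P?
... | yes (j , _) = j
... | no _ = i

choose-spec : ∀ {n} {P : Fin n → Set} (P? : ∀ i → Dec (P i)) i → ∃ P → P (choose P? i)
choose-spec P? i w with FinP.any? P?
... | yes (_ , p) = p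
... | no none = ⊥-elim (none w)

-- Modularity of X against Y, followed by submodularity for X and (X ∩ F) ∪ Y, which both contain X
-- ∩ F.
modular-restrict : ∀ {N} {M : RawMatroid N} (mat : IsMatroid M) {X F : Subset N} → Modular M X → Flat M F →
  Modular (M ∣ F) (X ∩ F)
modular-restrict {M = M} mat {X} {F} mod@(FX , _) FF = Sum⇒Modular matF FXF (≤⇒Sum matF (proj₁ FXF) λ Y FY →
  let Y⊆E : Y ⊆ E M
      Y⊆E = λ m → proj₁ FF (proj₁ FY m)
      XFY⊆E : (X ∩ F) ∪ Y ⊆ E M
      XFY⊆E = ∪-lub {A = X ∩ F} (λ m → proj₁ FX (p∩q⊆p X F m)) Y⊆E
  in ℕP.+-cancelˡ-≤ (r M X) _ _ (begin
    r M X ℕ.+ (r M (X ∩ F) ℕ.+ r M Y)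
      ≡⟨ swap (r M X) (r M (X ∩ F)) (r M Y) ⟩
    r M (X ∩ F) ℕ.+ (r M X ℕ.+ r M Y)
      ≡⟨ cong (r M (X ∩ F) ℕ.+_) (Modular⇒Sum mat mod Y (flat-unrestrict mat FF FY)) ⟩
    r M (X ∩ F) ℕ.+ (r M (X ∩ Y) ℕ.+ r M (X ∪ Y))
      ≡⟨ rotate (r M (X ∩ F)) (r M (X ∩ Y)) (r M (X ∪ Y)) ⟩
    r M (X ∩ Y) ℕ.+ (r M (X ∪ Y) ℕ.+ r M (X ∩ F))
      ≤⟨ ℕP.+-mono-≤
           (mono (λ m → Y⊆E (p∩q⊆q (X ∩ F) Y m)) (λ m → let (a , b) = x∈p∩q⁻ X Y m in x∈p∩q⁺ (x∈p∩q⁺ (a , proj₁ FY b) , b)))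
           (ℕP.≤-trans
             (ℕP.+-monoˡ-≤ (r M (X ∩ F)) (mono (∪-lub {A = X} (proj₁ FX) XFY⊆E) (∪-mono {A = X} {Y} id (q⊆p∪q (X ∩ F) Y))))
             (submod-⊆ (proj₁ FX) XFY⊆E (p∩q⊆p X F) (p⊆p∪q Y))) ⟩
    r M ((X ∩ F) ∩ Y) ℕ.+ (r M X ℕ.+ r M ((X ∩ F) ∪ Y))
      ≡⟨ swap (r M ((X ∩ F) ∩ Y)) (r M X) (r M ((X ∩ F) ∪ Y)) ⟩
    r M X ℕ.+ (r M ((X ∩ F) ∩ Y) ℕ.+ r M ((X ∩ F) ∪ Y)) ∎))
  where
  open Rank mat
  open ℕP.≤-Reasoning
  matF = restrict (proj₁ FF)
  FXF : Flat (M ∣ F) (X ∩ F)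
  FXF = flat-restrict mat (proj₁ FF) FX
  swap : ∀ a b c → a ℕ.+ (b ℕ.+ c) ≡ b ℕ.+ (a ℕ.+ c)
  swap = ℕ-solve-∀
  rotate : ∀ a b c → a ℕ.+ (b ℕ.+ c) ≡ b ℕ.+ (c ℕ.+ a)
  rotate = ℕ-solve-∀

r>0⇒nonempty : ∀ {N} {M : RawMatroid N} → IsMatroid M → ∀ {Y} → 1 ≤ r M Y → ∃ λ x → x ∈ Y
r>0⇒nonempty {M = M} mat {Y} h with nonempty? Y
... | yes w = w
... | no empty with () ← subst (1 ≤_) (trans (cong (r M) (Empty-unique empty)) (Rank.r∅ mat)) h

module _ {N : ℕ} {M : RawMatroid N} (simple : IsSimple M) where
  open Simple simple

  -- For the line W through p and q, r(F) + 2 = r(F ∩ W) + r(F ∪ W) ≤ r(F ∩ W) + r(F) + 1, so F ∩ W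
  -- has positive rank.
  line-meets-hyperplane : ∀ {F G} → Modular M F → F ⊆ G → Flat M G → r M G ≡ suc (r M F) →
    ∀ {p q} → p ∈ G → q ∈ G → p ≢ q → ∃ λ a → a ∈ F × r M (⁅ a ⁆ ∪ (⁅ p ⁆ ∪ ⁅ q ⁆)) ≡ 2
  line-meets-hyperplane {F} {G} mod F⊆G FG rG {p} {q} p∈G q∈G p≢q =
    on-line (r>0⇒nonempty isMatroid (ℕP.+-cancelʳ-≤ (suc (r M F)) 1 _ (begin
      1 ℕ.+ suc (r M F)               ≡⟨ ℕP.+-comm 2 (r M F) ⟩
      r M F ℕ.+ 2                     ≡⟨ cong (r M F ℕ.+_) (trans (r-cl pq⊆E) rpq) ⟨
      r M F ℕ.+ r M W                 ≡⟨ Modular⇒Sum isMatroid mod W (cl-flat pq⊆E) ⟩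
      r M (F ∩ W) ℕ.+ r M (F ∪ W)     ≤⟨ ℕP.+-monoʳ-≤ (r M (F ∩ W)) (mono (proj₁ FG) (∪-lub {A = F} F⊆G (cl-least pq⊆G FG))) ⟩
      r M (F ∩ W) ℕ.+ r M G           ≡⟨ cong (r M (F ∩ W) ℕ.+_) rG ⟩
      r M (F ∩ W) ℕ.+ suc (r M F)     ∎)))
    where
    open ℕP.≤-Reasoning
    W = cl M (⁅ p ⁆ ∪ ⁅ q ⁆)
    pq⊆G : ⁅ p ⁆ ∪ ⁅ q ⁆ ⊆ G
    pq⊆G = ∪⁅⁆-lub {A = ⁅ p ⁆} (⁅⁆-⊆ p∈G) q∈G
    pq⊆E : ⁅ p ⁆ ∪ ⁅ q ⁆ ⊆ E M
    pq⊆E m = proj₁ FG (pq⊆G m)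
    rpq : r M (⁅ p ⁆ ∪ ⁅ q ⁆) ≡ 2
    rpq = noParallel p q (proj₁ FG p∈G) (proj₁ FG q∈G) p≢q
    on-line : (∃ λ a → a ∈ F ∩ W) → ∃ λ a → a ∈ F × r M (⁅ a ⁆ ∪ (⁅ p ⁆ ∪ ⁅ q ⁆)) ≡ 2
    on-line (a , m) = a , p∩q⊆p F W m ,
      trans (cong (r M) (∪-comm ⁅ a ⁆ _)) (trans (proj₂ (∈-cl⁻ {M = M} (p∩q⊆q F W m))) rpq)

module ContractModular {N : ℕ} {M : RawMatroid N} (simple : IsSimple M) {e : Fin N} (e∈E : e ∈ E M) where
  open Simple simple
  open Contract simple e∈E
  open Simplify isMatroid-contract loopless-contract

  -- Flats of `M / e` come from flats of M through e, so the inequality is asked only of those. This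
  -- weaker form is what cl(F ∪ e) satisfies when F is modular and e ∉ F.
  contract-modular : ∀ {G} → Flat M G → e ∈ G →
    (∀ W → Flat M W → e ∈ W → r M G ℕ.+ r M W ≤ r M (G ∩ W) ℕ.+ r M (G ∪ W)) → ModularSum (M / e) (G - e)
  contract-modular {G} FG e∈G h = ≤⇒Sum isMatroid-contract (proj₁ (flat-contract FG e∈G)) λ W FW →
    let W⊆E : W ⊆ E M
        W⊆E = λ m → -e⊆E (proj₁ FW m)
    in s≤s⁻¹ (s≤s⁻¹ (begin
      suc (suc (r (M / e) (G - e) ℕ.+ r (M / e) W))
        ≡⟨ cong suc (ℕP.+-suc _ _) ⟨
      suc (r (M / e) (G - e)) ℕ.+ suc (r (M / e) W)
        ≡⟨ cong₂ ℕ._+_ (r-contract-∋ (proj₁ FG) e∈G) (r-contract W⊆E) ⟩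
      r M G ℕ.+ r M (W ∪ ⁅ e ⁆)
        ≤⟨ h (W ∪ ⁅ e ⁆) (flat-uncontract FW) (q⊆p∪q W ⁅ e ⁆ (x∈⁅x⁆ e)) ⟩
      r M (G ∩ (W ∪ ⁅ e ⁆)) ℕ.+ r M (G ∪ (W ∪ ⁅ e ⁆))
        ≤⟨ ℕP.+-mono-≤ (mono (∪⁅⁆-lub {A = (G - e) ∩ W} (λ m → W⊆E (p∩q⊆q (G - e) W m)) e∈E) (meet W))
             (mono (∪⁅⁆-lub {A = (G - e) ∪ W} (GW⊆E W⊆E) e∈E) (join W)) ⟩
      r M (((G - e) ∩ W) ∪ ⁅ e ⁆) ℕ.+ r M (((G - e) ∪ W) ∪ ⁅ e ⁆)
        ≡⟨ cong₂ ℕ._+_ (r-contract {(G - e) ∩ W} (λ m → W⊆E (p∩q⊆q (G - e) W m))) (r-contract {(G - e) ∪ W} (GW⊆E W⊆E)) ⟨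
      suc (r (M / e) ((G - e) ∩ W)) ℕ.+ suc (r (M / e) ((G - e) ∪ W))
        ≡⟨ cong suc (ℕP.+-suc _ _) ⟩
      suc (suc (r (M / e) ((G - e) ∩ W) ℕ.+ r (M / e) ((G - e) ∪ W))) ∎))
    where
    open ℕP.≤-Reasoning
    GW⊆E : ∀ {W} → W ⊆ E M → (G - e) ∪ W ⊆ E M
    GW⊆E W⊆E = ∪-lub {A = G - e} (λ m → proj₁ FG (proj₁ (∈-⁻ m))) W⊆E
    meet : ∀ W → G ∩ (W ∪ ⁅ e ⁆) ⊆ ((G - e) ∩ W) ∪ ⁅ e ⁆
    meet W {x} m with x∈p∩q⁻ G (W ∪ ⁅ e ⁆) m
    ... | g , w with x Data.Fin.≟ e | x∈p∪q⁻ W ⁅ e ⁆ w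
    ...   | yes refl | _ = q⊆p∪q ((G - e) ∩ W) ⁅ e ⁆ (x∈⁅x⁆ e)
    ...   | no x≢e | inj₁ x∈W = p⊆p∪q ⁅ e ⁆ (x∈p∩q⁺ (x∈p∧x≢y⇒x∈p-y g x≢e , x∈W))
    ...   | no x≢e | inj₂ x∈e = ⊥-elim (x≢e (x∈⁅y⁆⇒x≡y e x∈e))
    join : ∀ W → G ∪ (W ∪ ⁅ e ⁆) ⊆ ((G - e) ∪ W) ∪ ⁅ e ⁆
    join W {x} m with x Data.Fin.≟ e | x∈p∪q⁻ G (W ∪ ⁅ e ⁆) m
    ... | yes refl | _ = q⊆p∪q ((G - e) ∪ W) ⁅ e ⁆ (x∈⁅x⁆ e)
    ... | no x≢e | inj₁ g = p⊆p∪q ⁅ e ⁆ (p⊆p∪q W (x∈p∧x≢y⇒x∈p-y g x≢e))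
    ... | no x≢e | inj₂ w with x∈p∪q⁻ W ⁅ e ⁆ w
    ...   | inj₁ x∈W = p⊆p∪q ⁅ e ⁆ (q⊆p∪q (G - e) W x∈W)
    ...   | inj₂ x∈e = ⊥-elim (x≢e (x∈⁅y⁆⇒x≡y e x∈e))

  module Inside {F : Subset N} (mod : Modular M F) (e∈F : e ∈ F) where

    FF : Flat (M / e) (F - e)
    FF = flat-contract (proj₁ mod) e∈F

    modF : ModularSum (M / e) (F - e)
    modF = contract-modular (proj₁ mod) e∈F (λ W FW _ → ℕP.≤-reflexive (Modular⇒Sum isMatroid mod W FW))

    F′ : Subset N
    F′ = (F - e) ∩ E (si (M / e))

    ME-F′ : ME (si ((M ∣ F) / e)) → ME (si (M / e) ∣ F′)
    -- `(M ∣ F) / e` and `(M / e) ∣ (F - e)` are the same by definition.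
    ME-F′ = subst ME (si-restrict isMatroid-contract loopless-contract FF)

  -- Every line through e inside cl (F ∪ e) meets F in exactly one point, so F is a copy of the flat of si (M / e) it spans.
  module Outside {F : Subset N} (mod : Modular M F) (e∉F : e ∉ F) where

    F⊆E : F ⊆ E M
    F⊆E = proj₁ (proj₁ mod)

    sumF : ModularSum M F
    sumF = Modular⇒Sum isMatroid mod

    skewF : Skew M F
    skewF = Sum⇒Skew isMatroid sumF

    Fe⊆E : F ∪ ⁅ e ⁆ ⊆ E M
    Fe⊆E = ∪⁅⁆-lub {A = F} F⊆E e∈E

    G : Subset N
    G = cl M (F ∪ ⁅ e ⁆)

    flatG : Flat M G
    flatG = cl-flat Fe⊆E

    e∈G : e ∈ G
    e∈G = ⊆cl Fe⊆E (q⊆p∪q F ⁅ e ⁆ (x∈⁅x⁆ e))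

    F⊆G : F ⊆ G
    F⊆G m = ⊆cl Fe⊆E (p⊆p∪q ⁅ e ⁆ m)

    F⊆G-e : F ⊆ G - e
    F⊆G-e m = x∈p∧x≢y⇒x∈p-y (F⊆G m) λ { refl → e∉F m }

    rG : r M G ≡ suc (r M F)
    rG = trans (r-cl Fe⊆E) (r-flat∪⁅⁆ (proj₁ mod) e∈E e∉F)

    FF : Flat (M / e) (G - e)
    FF = flat-contract flatG e∈G

    -- For a flat W through e, passing from F to G adds one to the rank of F, and it adds at least
    -- one to that of F ∩ W, since G ∩ W contains e and F does not. So modularity of F against W
    -- yields the inequality for G.
    modF : ModularSum (M / e) (G - e)
    modF = contract-modular flatG e∈G λ W FW e∈W → begin
      r M G ℕ.+ r M W
        ≡⟨ cong (ℕ._+ r M W) rG ⟩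
      suc (r M F ℕ.+ r M W)
        ≡⟨ cong suc (sumF W FW) ⟩
      suc (r M (F ∩ W)) ℕ.+ r M (F ∪ W)
        ≡⟨ cong (ℕ._+ r M (F ∪ W)) (r-flat∪⁅⁆ (∩-flat (proj₁ mod) FW) e∈E (λ m → e∉F (p∩q⊆p F W m))) ⟨
      r M ((F ∩ W) ∪ ⁅ e ⁆) ℕ.+ r M (F ∪ W)
        ≤⟨ ℕP.+-mono-≤
             (mono (λ m → proj₁ FW (p∩q⊆q G W m)) (∪⁅⁆-lub {A = F ∩ W}
               (λ m → let (a , b) = x∈p∩q⁻ F W m in x∈p∩q⁺ (F⊆G a , b)) (x∈p∩q⁺ (e∈G , e∈W))))
             (mono (∪-lub {A = G} (proj₁ flatG) (proj₁ FW)) (∪-mono {A = F} {W} F⊆G id)) ⟩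
      r M (G ∩ W) ℕ.+ r M (G ∪ W) ∎
      where open ℕP.≤-Reasoning

    S F′ : Subset N
    S = E (si (M / e))
    F′ = (G - e) ∩ S

    F⊆E-e : F ⊆ E M - e
    F⊆E-e m = x∈p∧x≢y⇒x∈p-y (F⊆E m) λ { refl → e∉F m }

    -- F is a modular hyperplane of G, so it meets the line through y and e; the point found is
    -- parallel to y after contraction.
    project : ∀ {y} → y ∈ G - e → ∃ λ x → x ∈ F × r (M / e) (⁅ x ⁆ ∪ ⁅ y ⁆) ≡ 1
    project {y} m = onto (line-meets-hyperplane simple mod F⊆G flatG rG y∈G e∈G (proj₂ (∈-⁻ m)))
      where
      y∈G : y ∈ G
      y∈G = proj₁ (∈-⁻ m)
      onto : (∃ λ x → x ∈ F × r M (⁅ x ⁆ ∪ (⁅ y ⁆ ∪ ⁅ e ⁆)) ≡ 2) → ∃ λ x → x ∈ F × r (M / e) (⁅ x ⁆ ∪ ⁅ y ⁆) ≡ 1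
      onto (x , x∈F , line) = x , x∈F , ℕP.suc-injective (trans
        (r-contract (∪⁅⁆-lub {A = ⁅ x ⁆} (⁅⁆-⊆ (F⊆E x∈F)) (proj₁ flatG y∈G)))
        (trans (cong (r M) (∪-assoc ⁅ x ⁆ ⁅ y ⁆ ⁅ e ⁆)) line))

    r-F : ∀ X → X ⊆ F → r (M / e) X ≡ r M X
    r-F = r-contract-skew F⊆E skewF e∉F

    F-unique : ∀ {x y} → x ∈ F → y ∈ F → r (M / e) (⁅ x ⁆ ∪ ⁅ y ⁆) ≡ 1 → x ≡ y
    F-unique {x} {y} x∈F y∈F par with x Data.Fin.≟ y
    ... | yes x≡y = x≡y
    ... | no x≢y with () ← trans (sym par) (trans (r-F _ (∪⁅⁆-lub {A = ⁅ x ⁆} (⁅⁆-⊆ x∈F) y∈F))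
                             (noParallel x y (F⊆E x∈F) (F⊆E y∈F) x≢y))

    -- `to` takes the representative of a parallel class, `from` projects from e onto F. Both move
    -- points within their parallel classes in `M / e`, so ranks there are kept, and on F they equal
    -- those in M.
    F-iso : Iso (M ∣ F) (si (M / e) ∣ F′)
    F-iso = record
      { to = to ; from = from ; to-∈ = to-∈ ; from-∈ = λ m → proj₁ (from-spec m)
      ; from-to = from-to′
      ; to-from = λ {y} m → let (x∈F , xy) = from-spec m ; (z∈S , zx) = to-spec x∈F in
          si-unique z∈S (p∩q⊆q (G - e) S m) (par-trans (si⊆E z∈S) (F⊆E-e x∈F) (F′⊆E m) zx xy)
      ; rank = λ {A} A⊆F → trans (ℕP.≤-antisym
          (r-par-≤ (λ m → F⊆E-e (A⊆F m)) (λ m → F′⊆E (proj₁ (∈-preimage⁻ m)))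
            (λ {y} m → let (a , b) = ∈-preimage⁻ m in from y , b , proj₂ (from-spec a)))
          (r-par-≤ (λ m → F′⊆E (proj₁ (∈-preimage⁻ m))) (λ m → F⊆E-e (A⊆F m))
            (λ {x} m → to x , ∈-preimage⁺ (to-∈ (A⊆F m)) (subst (_∈ A) (sym (from-to′ (A⊆F m))) m) , proj₂ (to-spec (A⊆F m)))))
          (r-F A A⊆F) }
      where
      to? : ∀ x y → Dec (y ∈ S × r (M / e) (⁅ y ⁆ ∪ ⁅ x ⁆) ≡ 1)
      to? x y = (y ∈? S) ×-dec (r (M / e) (⁅ y ⁆ ∪ ⁅ x ⁆) ℕP.≟ 1)
      from? : ∀ y x → Dec (x ∈ F × r (M / e) (⁅ x ⁆ ∪ ⁅ y ⁆) ≡ 1)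
      from? y x = (x ∈? F) ×-dec (r (M / e) (⁅ x ⁆ ∪ ⁅ y ⁆) ℕP.≟ 1)
      to from : Fin N → Fin N
      to x = choose (to? x) x
      from y = choose (from? y) y
      to-spec : ∀ {x} → x ∈ F → to x ∈ S × r (M / e) (⁅ to x ⁆ ∪ ⁅ x ⁆) ≡ 1
      to-spec {x} x∈F = choose-spec (to? x) x (si-rep (F⊆E-e x∈F))
      from-spec : ∀ {y} → y ∈ F′ → from y ∈ F × r (M / e) (⁅ from y ⁆ ∪ ⁅ y ⁆) ≡ 1
      from-spec {y} m = choose-spec (from? y) y (project (p∩q⊆p (G - e) S m))
      F′⊆E : F′ ⊆ E (M / e)
      F′⊆E m = si⊆E (p∩q⊆q (G - e) S m)
      to-∈ : ∀ {x} → x ∈ F → to x ∈ F′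
      to-∈ x∈F = let (a , b) = to-spec x∈F in x∈p∩q⁺ (flat-par FF (si⊆E a) (F⊆G-e x∈F) (par-sym b) , a)
      from-to′ : ∀ {x} → x ∈ F → from (to x) ≡ x
      from-to′ x∈F = F-unique (proj₁ (from-spec (to-∈ x∈F))) x∈F
          (par-trans (F⊆E-e (proj₁ (from-spec (to-∈ x∈F)))) (si⊆E (proj₁ (to-spec x∈F))) (F⊆E-e x∈F)
            (proj₂ (from-spec (to-∈ x∈F))) (proj₂ (to-spec x∈F)))

    ME-F′ : ME (M ∣ F) → ME (si (M / e) ∣ F′)
    ME-F′ me = ME-iso me F-iso (Simple.simple-restrict si-simple (p∩q⊆q (G - e) S))

-- Existence of a divisional atom

GoodAtom : ∀ {N} → RawMatroid N → Subset N → Set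
GoodAtom M X = ∃ λ e → e ∈ E M × e ∉ X × Divisional M e × ME (si (M / e))

proper⇒r< : ∀ {N} {M : RawMatroid N} → IsMatroid M → ∀ {F} → Flat M F → F ≢ E M → suc (r M F) ≤ r M (E M)
proper⇒r< mat FF F≢E = ℕP.≰⇒> λ h → F≢E (⊆-antisym (proj₁ FF) (Rank.flat-maximal mat FF id (proj₁ FF) h))

modular-ranks : ∀ {N} {M : RawMatroid N} → IsMatroid M → ∀ {X Y} → Modular M X → Flat M Y → X ∪ Y ≡ E M →
  r M (E M) ℕ.+ r M (X ∩ Y) ≡ r M X ℕ.+ r M Y
modular-ranks {M = M} mat {X} {Y} mod FY cover = trans (ℕP.+-comm (r M (E M)) _)
  (sym (trans (Modular⇒Sum mat mod Y FY) (cong (λ U → r M (X ∩ Y) ℕ.+ r M U) cover)))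

-- If A ∪ B were a cover of X ∩ H by proper flats and p ∈ X \ H, then cl (A ∪ p) and cl (B ∪ p) would cover X:
-- a line through p in X meets the modular hyperplane X ∩ H of X in a point of A or of B.
module _ {N : ℕ} {M : RawMatroid N} (simple : IsSimple M) {X H : Subset N} (FX : Flat M X)
         (mod : Modular M H) (co : suc (r M H) ≡ r M (E M)) (cover : X ∪ H ≡ E M) where
  open Simple simple
  private
    FH = proj₁ mod
    Z : Subset N
    Z = X ∩ H
    FZ : Flat M Z
    FZ = ∩-flat FX FH

    rX : r M X ≡ suc (r M Z)
    rX = ℕP.+-cancelˡ-≡ (r M H) _ _ (begin
      r M H ℕ.+ r M X                 ≡⟨ Modular⇒Sum isMatroid mod X FX ⟩
      r M (H ∩ X) ℕ.+ r M (H ∪ X)     ≡⟨ cong₂ ℕ._+_ (cong (r M) (∩-comm H X)) (trans (cong (r M) (trans (∪-comm H X) cover)) (sym co)) ⟩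
      r M Z ℕ.+ suc (r M H)           ≡⟨ trans (ℕP.+-suc _ _) (trans (cong suc (ℕP.+-comm (r M Z) (r M H))) (sym (ℕP.+-suc _ _))) ⟩
      r M H ℕ.+ suc (r M Z)           ∎)
      where open ≡-Reasoning

    outside : ∃ λ p → p ∈ X × p ∉ H
    outside with FinP.any? (λ p → (p ∈? X) ×-dec ¬? (p ∈? H))
    ... | yes w = w
    ... | no none = ⊥-elim (ℕP.<-irrefl refl (ℕP.≤-trans (ℕP.≤-reflexive co) (mono (proj₁ FH) E⊆H)))
      where
      inside : ∀ {x} → x ∈ X → Dec (x ∈ H) → x ∈ H
      inside _ (yes h) = h
      inside {x} x∈X (no x∉H) = ⊥-elim (none (x , x∈X , x∉H))
      E⊆H : E M ⊆ H
      E⊆H {x} m = ∪-lub {A = X} (λ {y} y∈X → inside y∈X (y ∈? H)) id (subst (x ∈_) (sym cover) m)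

    module _ {p : Fin N} (p∈X : p ∈ X) (p∉H : p ∉ H) where
      p∈E : p ∈ E M
      p∈E = proj₁ FX p∈X

      module _ {C : Subset N} (FC : Flat (M ∣ Z) C) where
        C⊆E : C ⊆ E M
        C⊆E m = proj₁ FZ (proj₁ FC m)
        Cp⊆X : C ∪ ⁅ p ⁆ ⊆ X
        Cp⊆X = ∪⁅⁆-lub {A = C} (λ m → p∩q⊆p X H (proj₁ FC m)) p∈X
        Cp⊆E : C ∪ ⁅ p ⁆ ⊆ E M
        Cp⊆E m = proj₁ FX (Cp⊆X m)

        -- C has rank below r(Z) = r(X) - 1, so adjoining the single point p cannot reach the rank
        -- of X.
        cl-proper : C ≢ Z → ProperFlat (M ∣ X) (cl M (C ∪ ⁅ p ⁆))
        cl-proper C≢Z = flat-restrict-⊆ isMatroid (proj₁ FX) (cl-least Cp⊆X FX) (cl-flat Cp⊆E) ,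
          λ e → ℕP.<-irrefl refl (begin
            suc (r M X)                       ≡⟨ cong (λ Y → suc (r M Y)) e ⟨
            suc (r M (cl M (C ∪ ⁅ p ⁆)))      ≡⟨ cong suc (r-cl Cp⊆E) ⟩
            suc (r M (C ∪ ⁅ p ⁆))             ≤⟨ s≤s (r-∪⁅⁆≤suc C⊆E p∈E) ⟩
            suc (suc (r M C))                 ≤⟨ s≤s (proper⇒r< (restrict (proj₁ FZ)) FC C≢Z) ⟩
            suc (r M Z)                       ≡⟨ rX ⟨
            r M X                             ∎)
          where open ℕP.≤-Reasoning

        p∈cl : p ∈ cl M (C ∪ ⁅ p ⁆)
        p∈cl = ⊆cl Cp⊆E (q⊆p∪q C ⁅ p ⁆ (x∈⁅x⁆ p))

        C⊆cl : C ⊆ cl M (C ∪ ⁅ p ⁆)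
        C⊆cl m = ⊆cl Cp⊆E (p⊆p∪q ⁅ p ⁆ m)

        -- As a ∈ H and p ∉ H, the two points are distinct and span the line that carries q.
        on-line : ∀ {q a} → q ∈ E M → a ∈ C → r M (⁅ a ⁆ ∪ (⁅ p ⁆ ∪ ⁅ q ⁆)) ≡ 2 → q ∈ cl M (C ∪ ⁅ p ⁆)
        on-line {q} {a} q∈E a∈C h = flat-closed (cl-flat Cp⊆E) q∈E
          (spanned-mono {A = ⁅ a ⁆ ∪ ⁅ p ⁆} (cl⊆E {M = M}) (⁅⁆-⊆ q∈E)
            (∪⁅⁆-lub {A = ⁅ a ⁆} (⁅⁆-⊆ (C⊆cl a∈C)) p∈cl)
            (ℕP.≤-reflexive (trans (cong (r M) (∪-assoc ⁅ a ⁆ ⁅ p ⁆ ⁅ q ⁆)) (trans h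
              (sym (noParallel a p (C⊆E a∈C) p∈E λ { refl → p∉H (p∩q⊆q X H (proj₁ FC a∈C)) }))))))

      module _ {A B : Subset N} (FA : Flat (M ∣ Z) A) (FB : Flat (M ∣ Z) B) (AB≡Z : A ∪ B ≡ Z) where
        split : ∀ {x} → x ∈ Z → x ∈ A ⊎ x ∈ B
        split {x} m = x∈p∪q⁻ A B (subst (x ∈_) (sym AB≡Z) m)

        Z⊆ : ∀ {q} → q ∈ A ⊎ q ∈ B → q ∈ cl M (A ∪ ⁅ p ⁆) ∪ cl M (B ∪ ⁅ p ⁆)
        Z⊆ (inj₁ a) = p⊆p∪q (cl M (B ∪ ⁅ p ⁆)) (C⊆cl FA a)
        Z⊆ (inj₂ b) = q⊆p∪q (cl M (A ∪ ⁅ p ⁆)) (cl M (B ∪ ⁅ p ⁆)) (C⊆cl FB b)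

        line⊆ : ∀ {q a} → q ∈ E M → r M (⁅ a ⁆ ∪ (⁅ p ⁆ ∪ ⁅ q ⁆)) ≡ 2 → a ∈ A ⊎ a ∈ B → q ∈ cl M (A ∪ ⁅ p ⁆) ∪ cl M (B ∪ ⁅ p ⁆)
        line⊆ q∈E line (inj₁ a∈A) = p⊆p∪q (cl M (B ∪ ⁅ p ⁆)) (on-line FA q∈E a∈A line)
        line⊆ q∈E line (inj₂ a∈B) = q⊆p∪q (cl M (A ∪ ⁅ p ⁆)) (cl M (B ∪ ⁅ p ⁆)) (on-line FB q∈E a∈B line)

        modZ : Modular (M ∣ X) Z
        modZ = subst (Modular (M ∣ X)) (∩-comm H X) (modular-restrict isMatroid mod FX)

        covered : ∀ {q} → q ∈ X → Dec (q ∈ H) → Dec (p ≡ q) → q ∈ cl M (A ∪ ⁅ p ⁆) ∪ cl M (B ∪ ⁅ p ⁆)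
        covered q∈X (yes q∈H) _ = Z⊆ (split (x∈p∩q⁺ (q∈X , q∈H)))
        covered q∈X (no _) (yes refl) = p⊆p∪q (cl M (B ∪ ⁅ p ⁆)) (p∈cl FA)
        covered {q} q∈X (no _) (no p≢q) =
          let (a , a∈Z , line) = line-meets-hyperplane (simple-restrict (proj₁ FX)) modZ (p∩q⊆p X H)
                                   (Rank.E-flat (restrict (proj₁ FX))) rX p∈X q∈X p≢q
          in line⊆ (proj₁ FX q∈X) line (split a∈Z)

  round-∩coatom : Round (M ∣ X) → Round (M ∣ Z)
  round-∩coatom round (A , B , (FA , A≢Z) , (FB , B≢Z) , AB≡Z) = go outside
    where
    go : (∃ λ p → p ∈ X × p ∉ H) → ⊥
    go (p , p∈X , p∉H) = round (cl M (A ∪ ⁅ p ⁆) , cl M (B ∪ ⁅ p ⁆) , pA , pB , ⊆-antisym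
        (∪-lub {A = cl M (A ∪ ⁅ p ⁆)} (proj₁ (proj₁ pA)) (proj₁ (proj₁ pB)))
        (λ {q} q∈X → covered p∈X p∉H FA FB AB≡Z q∈X (q ∈? H) (p Data.Fin.≟ q)))
      where
      pA = cl-proper p∈X p∉H FA A≢Z
      pB = cl-proper p∈X p∉H FB B≢Z

-- Simplified contraction of a modular join

module JoinStep {N : ℕ} {M : RawMatroid N} (simple : IsSimple M) {E₁ E₂ : Subset N}
  (m₁ : Modular M E₁) (m₂ : Modular M E₂) (E₂≢E : E₂ ≢ E M) (cover : E₁ ∪ E₂ ≡ E M)
  (round : Round (M ∣ (E₁ ∩ E₂))) (me₁ : ME (M ∣ E₁))
  {e : Fin N} (e∈E₂ : e ∈ E₂) (e∉E₁ : e ∉ E₁) (me₂ : ME (si ((M ∣ E₂) / e))) where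

  open Simple simple
  private
    F₁ = proj₁ m₁
    F₂ = proj₁ m₂
    e∈E : e ∈ E M
    e∈E = proj₁ F₂ e∈E₂
  open Contract simple e∈E
  open ContractModular simple e∈E
  open Simplify isMatroid-contract loopless-contract
  private
    module E₁ = Outside m₁ e∉E₁
    module E₂ = Inside m₂ e∈E₂
    S Z Z′ : Subset N
    S = E (si (M / e))
    Z = E₁ ∩ E₂
    Z′ = E₁.F′ ∩ E₂.F′
    module L = Rank isMatroid-contract

    covered : ∀ {x} → x ∈ E M - e → x ∈ E₁ ⊎ x ∈ E₂ - e
    covered {x} m = Sum.map₂ (λ x∈E₂ → x∈p∧x≢y⇒x∈p-y x∈E₂ (proj₂ (∈-⁻ m)))
      (x∈p∪q⁻ E₁ E₂ (subst (x ∈_) (sym cover) (proj₁ (∈-⁻ m))))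

    cover′ : E₁.F′ ∪ E₂.F′ ≡ S
    cover′ = ⊆-antisym (∪-lub {A = E₁.F′} (p∩q⊆q (E₁.G - e) S) (p∩q⊆q (E₂ - e) S)) λ m → back m (covered (si⊆E m))
      where
      back : ∀ {x} → x ∈ S → x ∈ E₁ ⊎ x ∈ E₂ - e → x ∈ E₁.F′ ∪ E₂.F′
      back m (inj₁ a) = p⊆p∪q E₂.F′ (x∈p∩q⁺ (E₁.F⊆G-e a , m))
      back m (inj₂ b) = q⊆p∪q E₁.F′ E₂.F′ (x∈p∩q⁺ (b , m))

    -- Otherwise every point other than e would be parallel in `M / e` to a point of the flat E₂ -
    -- e, and so lie in E₂.
    proper₂ : E₂.F′ ≢ S
    proper₂ eq = E₂≢E (⊆-antisym (proj₁ F₂) λ {x} m → go (x Data.Fin.≟ e) m)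
      where
      go : ∀ {x} → Dec (x ≡ e) → x ∈ E M → x ∈ E₂
      go (yes refl) m = e∈E₂
      go {x} (no x≢e) m = let (g , g∈S , par) = si-rep (x∈p∧x≢y⇒x∈p-y m x≢e) in proj₁ (∈-⁻ (flat-par E₂.FF (x∈p∧x≢y⇒x∈p-y m x≢e) (p∩q⊆p (E₂ - e) S (subst (g ∈_) (sym eq) g∈S)) par))

    FZ′ : Flat (si (M / e)) Z′
    FZ′ = Rank.∩-flat (restrict-si) (si-flat E₁.FF) (si-flat E₂.FF)
      where restrict-si = IsSimple.isMatroid si-simple

    FZ : Flat M Z
    FZ = ∩-flat F₁ F₂

    -- The flat of M spanned by A and e, cut down to Z. It pulls flats of Z′ back to Z.
    trace : Subset N → Subset N
    trace A = (cl (M / e) A ∪ ⁅ e ⁆) ∩ Z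

    Z∌e : ∀ {x} → x ∈ Z → x ∉ ⁅ e ⁆
    Z∌e z x∈e = e∉E₁ (subst (_∈ E₁) (x∈⁅y⁆⇒x≡y e x∈e) (p∩q⊆p E₁ E₂ z))

    trace⁻ : ∀ {A x} → x ∈ trace A → x ∈ cl (M / e) A
    trace⁻ {A} {x} m = strip (x∈p∪q⁻ (cl (M / e) A) ⁅ e ⁆ (p∩q⊆p _ Z m))
      where
      strip : x ∈ cl (M / e) A ⊎ x ∈ ⁅ e ⁆ → x ∈ cl (M / e) A
      strip (inj₁ c) = c
      strip (inj₂ x∈e) = ⊥-elim (Z∌e (p∩q⊆q _ Z m) x∈e)

    Z⊆E-e : Z ⊆ E M - e
    Z⊆E-e m = E₁.F⊆E-e (p∩q⊆p E₁ E₂ m)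

    Z⊆E₂-e : Z ⊆ E₂ - e
    Z⊆E₂-e m = x∈p∧x≢y⇒x∈p-y (p∩q⊆q E₁ E₂ m) (proj₂ (∈-⁻ (Z⊆E-e m)))

    Z′⊆E : Z′ ⊆ E M - e
    Z′⊆E m = si⊆E (p∩q⊆q (E₂ - e) S (p∩q⊆q E₁.F′ E₂.F′ m))

    lift : ∀ {z} → z ∈ Z → ∃ λ g → g ∈ Z′ × r (M / e) (⁅ g ⁆ ∪ ⁅ z ⁆) ≡ 1
    lift {z} z∈Z = let (g , g∈S , par) = si-rep (Z⊆E-e z∈Z) in g , x∈p∩q⁺
      ( x∈p∩q⁺ (flat-par E₁.FF (si⊆E g∈S) (E₁.F⊆G-e (p∩q⊆p E₁ E₂ z∈Z)) (par-sym par) , g∈S)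
      , x∈p∩q⁺ (flat-par E₂.FF (si⊆E g∈S) (Z⊆E₂-e z∈Z) (par-sym par) , g∈S)) , par

    -- Projection from e gives a parallel point x of E₁; as y lies in the flat E₂ - e of `M / e`, so
    -- does x.
    drop : ∀ {y} → y ∈ Z′ → ∃ λ x → x ∈ Z × r (M / e) (⁅ x ⁆ ∪ ⁅ y ⁆) ≡ 1
    drop {y} m =
      let (y₁ , y₂) = x∈p∩q⁻ E₁.F′ E₂.F′ m
          (x , x∈E₁ , par) = E₁.project (p∩q⊆p (E₁.G - e) S y₁)
      in x , x∈p∩q⁺ (x∈E₁ , proj₁ (∈-⁻ (flat-par E₂.FF (E₁.F⊆E-e x∈E₁) (p∩q⊆p (E₂ - e) S y₂) (par-sym par)))) , par

    trace-proper : ∀ {A} → ProperFlat (si (M / e) ∣ Z′) A → ProperFlat (M ∣ Z) (trace A)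
    trace-proper {A} (FA , A≢Z′) =
      flat-restrict isMatroid (proj₁ FZ) (flat-uncontract (L.cl-flat A⊆E)) ,
      λ eq → A≢Z′ (⊆-antisym (proj₁ FA) λ m → let (x , x∈Z , par) = drop m in
        Rank.flat-closed (L.restrict Z′⊆E) FA m (ℕP.≤-reflexive (proj₂ (∈-cl⁻ {M = M / e}
          (flat-par (L.cl-flat A⊆E) (Z′⊆E m) (trace⁻ {A} (subst (x ∈_) (sym eq) x∈Z)) par)))))
      where
      A⊆E : A ⊆ E M - e
      A⊆E m = Z′⊆E (proj₁ FA m)

    -- By `lift` and `drop`, Z and Z′ meet the same parallel classes of `M / e`, so a cover of Z′ by
    -- proper flats would pull back along `trace` to one of Z.
    round′ : Round (si (M / e) ∣ Z′)
    round′ (A , B , pA , pB , AB) = round (trace A , trace B , trace-proper pA , trace-proper pB ,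
      ⊆-antisym (∪-lub {A = trace A} (p∩q⊆q _ Z) (p∩q⊆q _ Z)) λ m → go m (lift m))
      where
      ⊆E : ∀ {C} → C ⊆ Z′ → C ⊆ E M - e
      ⊆E C⊆Z′ m = Z′⊆E (C⊆Z′ m)
      in-trace : ∀ {C} → C ⊆ Z′ → ∀ {g z} → g ∈ C → z ∈ Z → r (M / e) (⁅ g ⁆ ∪ ⁅ z ⁆) ≡ 1 → z ∈ trace C
      in-trace {C} C⊆Z′ g∈C z∈Z par = x∈p∩q⁺ (p⊆p∪q ⁅ e ⁆
        (flat-par (L.cl-flat (⊆E C⊆Z′)) (Z⊆E-e z∈Z) (L.⊆cl (⊆E C⊆Z′) g∈C) par) , z∈Z)
      go : ∀ {z} → z ∈ Z → (∃ λ g → g ∈ Z′ × r (M / e) (⁅ g ⁆ ∪ ⁅ z ⁆) ≡ 1) → z ∈ trace A ∪ trace B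
      go z∈Z (g , g∈Z′ , par) = x∈p∪q⁺ (Sum.map
        (λ a → in-trace (proj₁ (proj₁ pA)) a z∈Z par) (λ b → in-trace (proj₁ (proj₁ pB)) b z∈Z par)
        (x∈p∪q⁻ A B (subst (g ∈_) (sym AB) g∈Z′)))

  ME-si : ME (si (M / e))
  ME-si = join-or-side (≡-dec BoolP._≟_ E₁.F′ S)
    where
    join-or-side : Dec (E₁.F′ ≡ S) → ME (si (M / e))
    -- E₁ and e may already span M. Then the image of E₁ is all of si(M/e), which is a copy of M|E₁
    -- and not a join with two proper sides.
    join-or-side (yes eq) = subst (λ U → ME (mkM U (r (M / e)))) eq (E₁.ME-F′ me₁)
    join-or-side (no E₁≢S) = me-join E₁.F′ E₂.F′ si-simple
      (si-flat E₁.FF , E₁≢S) (si-modular E₁.FF E₁.modF)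
      (si-flat E₂.FF , proper₂) (si-modular E₂.FF E₂.modF)
      cover′ (FZ′ , round′) (E₁.ME-F′ me₁) (E₂.ME-F′ me₂)

-- The flat to avoid in M|E₂ is E₁ ∩ E₂; an atom of E₂ off it is off E₁, hence off X. The induction
-- hypothesis enters as a function, so that the same argument serves for either side of the join.
join-side : ∀ {N} {M : RawMatroid N} → IsSimple M → ∀ {E₁ E₂} → Modular M E₁ → Modular M E₂ →
  E₁ ≢ E M → E₂ ≢ E M → E₁ ∪ E₂ ≡ E M → Round (M ∣ (E₁ ∩ E₂)) → ME (M ∣ E₁) → ∀ {X} → X ⊆ E₁ →
  (∀ {Z} → Modular (M ∣ E₂) Z → Round (M ∣ Z) → Z ≢ E₂ → GoodAtom (M ∣ E₂) Z) → GoodAtom M X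
join-side {M = M} simple {E₁} {E₂} m₁ m₂ E₁≢E E₂≢E cover round me₁ {X} X⊆E₁ ih =
  step (ih (modular-restrict isMatroid m₁ (proj₁ m₂)) round λ eq → E₁≢E (⊆-antisym (proj₁ (proj₁ m₁)) λ m →
    ∪-lub {A = E₁} id (λ {y} y∈E₂ → p∩q⊆p E₁ E₂ (subst (y ∈_) (sym eq) y∈E₂)) (E⊆∪ m)))
  where
  open Simple simple
  E⊆∪ : E M ⊆ E₁ ∪ E₂
  E⊆∪ {x} m = subst (x ∈_) (sym cover) m
  step : GoodAtom (M ∣ E₂) (E₁ ∩ E₂) → GoodAtom M X
  step (e , e∈E₂ , e∉Z , div , me₂) = e , e∈E , (λ m → e∉E₁ (X⊆E₁ m)) ,
    divisional-join simple e∈E (proj₁ (proj₁ m₁)) (Sum⇒Skew isMatroid (Modular⇒Sum isMatroid m₁)) (proj₁ m₂)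
      E⊆∪ refl (modular-ranks isMatroid m₁ (proj₁ m₂) cover) e∉E₁ e∈E₂ div ,
    JoinStep.ME-si simple m₁ m₂ E₂≢E cover round me₁ e∈E₂ e∉E₁ me₂
    where
    e∈E : e ∈ E M
    e∈E = proj₁ (proj₁ m₂) e∈E₂
    e∉E₁ : e ∉ E₁
    e∉E₁ m = e∉Z (x∈p∩q⁺ (m , e∈E₂))

-- Simplified contraction in the presence of a modular coatom

module CoatomStep {N : ℕ} {M : RawMatroid N} (simple : IsSimple M) {H : Subset N}
  (modH : Modular M H) (co : suc (r M H) ≡ r M (E M)) {e : Fin N} (e∈E : e ∈ E M) where

  open Simple simple
  open Contract simple e∈E
  open ContractModular simple e∈E
  open Simplify isMatroid-contract loopless-contract
  private
    FH = proj₁ modH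

  -- H and e span M, so the copy of H is the whole of si(M/e).
  ME-si-outside : e ∉ H → ME (M ∣ H) → ME (si (M / e))
  ME-si-outside e∉H me = subst (λ U → ME (mkM U (r (M / e)))) F′≡S (H.ME-F′ me)
    where
    module H = Outside modH e∉H
    E⊆G : E M ⊆ H.G
    E⊆G = flat-maximal H.flatG id (proj₁ H.flatG) (ℕP.≤-reflexive (trans (sym co) (sym H.rG)))
    F′≡S : H.F′ ≡ E (si (M / e))
    F′≡S = ⊆-antisym (p∩q⊆q (H.G - e) _) λ m → x∈p∩q⁺
      (x∈p∧x≢y⇒x∈p-y (E⊆G (proj₁ (∈-⁻ (si⊆E m)))) (proj₂ (∈-⁻ (si⊆E m))) , m)

  -- The ranks of H and of E both drop by one, so the image of H is again a modular coatom and rule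
  -- (ii) applies.
  ME-si-inside : e ∈ H → ME (si ((M ∣ H) / e)) → ME (si (M / e))
  ME-si-inside e∈H me = me-coatom H.F′ si-simple (si-flat H.FF , coatom) (si-modular H.FF H.modF) (H.ME-F′ me)
    where
    module H = Inside modH e∈H
    S = E (si (M / e))
    E∩S : (E M - e) ∩ S ≡ S
    E∩S = ⊆-antisym (p∩q⊆q (E M - e) S) (λ m → x∈p∩q⁺ (si⊆E m , m))
    coatom : suc (r (M / e) H.F′) ≡ r (M / e) S
    coatom = ℕP.suc-injective (begin
      suc (suc (r (M / e) H.F′))        ≡⟨ cong (λ n → suc (suc n)) (r-∩si H.FF) ⟩
      suc (suc (r (M / e) (H - e)))     ≡⟨ cong suc (r-contract-∋ (proj₁ FH) e∈H) ⟩
      suc (r M H)                       ≡⟨ co ⟩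
      r M (E M)                         ≡⟨ r-contract-∋ id e∈E ⟨
      suc (r (M / e) (E M - e))         ≡⟨ cong suc (r-∩si (Rank.E-flat isMatroid-contract)) ⟨
      suc (r (M / e) ((E M - e) ∩ S))   ≡⟨ cong (λ U → suc (r (M / e) U)) E∩S ⟩
      suc (r (M / e) S)                 ∎)
      where open ≡-Reasoning

-- Strengthening the theorem by avoiding a round modular flat X makes the induction go through:
-- in a join, X lies in one side, and the atom is taken in the other side, off the common flat.
good-atom : ∀ {N} {M : RawMatroid N} → ME M → ∀ {X} → Modular M X → Round (M ∣ X) → X ≢ E M → GoodAtom M X
good-atom (me-empty _ E≡∅) ((X⊆E , _) , _) _ X≢E =
  ⊥-elim (X≢E (⊆-antisym X⊆E λ m → ⊥-elim (∉⊥ (subst (_ ∈_) E≡∅ m))))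
good-atom {N} {M} (me-coatom H simple (FH , co) modH me) {X} modX round X≢E =
  by-cases (FinP.any? (λ e → (e ∈? E M) ×-dec (¬? (e ∈? H) ×-dec ¬? (e ∈? X))))
  where
  open Simple simple
  FX = proj₁ modX
  Z : Subset N
  Z = X ∩ H
  -- Here X and H cover E. Divisibility uses M as a join of X and H, with the atom taken in H,
  -- whereas membership in ME comes from the modular coatom H.
  step : X ∪ H ≡ E M → GoodAtom (M ∣ H) Z → GoodAtom M X
  step cover (e , e∈H , e∉Z , div , me-si) = e , e∈E , e∉X ,
    divisional-join simple e∈E (proj₁ FX) (Sum⇒Skew isMatroid (Modular⇒Sum isMatroid modX)) FH
      (λ {x} m → subst (x ∈_) (sym cover) m) refl (modular-ranks isMatroid modX FH cover) e∉X e∈H div ,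
    CoatomStep.ME-si-inside simple modH co e∈E e∈H me-si
    where
    e∈E : e ∈ E M
    e∈E = proj₁ FH e∈H
    e∉X : e ∉ X
    e∉X m = e∉Z (x∈p∩q⁺ (m , e∈H))
  Z≢H : X ∪ H ≡ E M → Z ≢ H
  Z≢H cover eq = X≢E (⊆-antisym (proj₁ FX) λ {x} m →
    ∪-lub {A = X} id (λ {y} h → p∩q⊆p X H (subst (y ∈_) (sym eq) h)) (subst (x ∈_) (sym cover) m))
  covered : ¬ (∃ λ e → e ∈ E M × e ∉ H × e ∉ X) → ∀ {x} → x ∈ E M → Dec (x ∈ H) → Dec (x ∈ X) → x ∈ X ∪ H
  covered none m (yes h) _ = q⊆p∪q X H h
  covered none m (no _) (yes x) = p⊆p∪q H x
  covered none {x} m (no x∉H) (no x∉X) = ⊥-elim (none (x , m , x∉H , x∉X))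
  by-cases : Dec (∃ λ e → e ∈ E M × e ∉ H × e ∉ X) → GoodAtom M X
  by-cases (yes (e , e∈E , e∉H , e∉X)) = e , e∈E , e∉X ,
    divisional-coatom simple e∈E (proj₁ FH) (Sum⇒Skew isMatroid (Modular⇒Sum isMatroid modH)) co e∉H ,
    CoatomStep.ME-si-outside simple modH co e∈E e∉H me
  by-cases (no none) = step cover
    (good-atom me (modular-restrict isMatroid modX FH) (round-∩coatom simple FX modH co cover round) (Z≢H cover))
    where
    cover : X ∪ H ≡ E M
    cover = ⊆-antisym (∪-lub {A = X} (proj₁ FX) (proj₁ FH)) λ {x} m → covered none m (x ∈? H) (x ∈? X)
good-atom {N} {M} (me-join E₁ E₂ simple (F₁ , E₁≢E) m₁ (F₂ , E₂≢E) m₂ cover (FZ , round) me₁ me₂) {X} modX roundX X≢E =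
  by-side (≡-dec BoolP._≟_ (X ∩ E₁) X) (≡-dec BoolP._≟_ (X ∩ E₂) X)
  where
  open Simple simple
  trace : ∀ F → Flat M F → Flat (M ∣ X) (X ∩ F)
  trace F FF = flat-restrict-⊆ isMatroid (proj₁ (proj₁ modX)) (p∩q⊆p X F) (∩-flat (proj₁ modX) FF)
  X-covered : (X ∩ E₁) ∪ (X ∩ E₂) ≡ X
  X-covered = trans (sym (∩-distribˡ-∪ X E₁ E₂)) (trans (cong (X ∩_) cover)
    (⊆-antisym (p∩q⊆p X (E M)) λ m → x∈p∩q⁺ (m , proj₁ (proj₁ modX) m)))
  inside : ∀ F → X ∩ F ≡ X → X ⊆ F
  inside F eq {x} m = p∩q⊆q X F (subst (x ∈_) (sym eq) m)
  by-side : Dec (X ∩ E₁ ≡ X) → Dec (X ∩ E₂ ≡ X) → GoodAtom M X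
  -- X is the union of its traces on E₁ and E₂; were both proper, X would not be round.
  by-side (no ne₁) (no ne₂) = ⊥-elim (roundX (X ∩ E₁ , X ∩ E₂ , (trace E₁ F₁ , ne₁) , (trace E₂ F₂ , ne₂) , X-covered))
  by-side (yes eq) _ = join-side simple m₁ m₂ E₁≢E E₂≢E cover round me₁ (inside E₁ eq) (good-atom me₂)
  by-side (no _) (yes eq) = join-side simple m₂ m₁ E₂≢E E₁≢E (trans (∪-comm E₂ E₁) cover)
    (subst (λ Z → Round (M ∣ Z)) (∩-comm E₁ E₂) round) me₂ (inside E₂ eq) (good-atom me₁)

theorem3p2 : ∀ {N : ℕ} (M : RawMatroid N) → IsSimple M → E M ≢ ∅ → ME M →
    ∃[ e ] (e ∈ E M × Divisional M e × ME (si (M / e)))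
theorem3p2 M simple E≢∅ me = forget (good-atom me (Sum⇒Modular isMatroid ∅-flat sum) round (λ e → E≢∅ (sym e)))
  where
  open Simple simple
  sum : ModularSum M ∅
  sum Y FY = cong₂ (λ A B → r M A ℕ.+ r M B) (sym (∩-zeroˡ Y)) (sym (∪-identityˡ Y))
  -- The empty matroid has no flat other than its ground set, so X = ∅ is admissible, and avoiding
  -- it is no restriction on the atom.
  round : Round (M ∣ ∅)
  round (F₁ , _ , ((F₁⊆∅ , _) , F₁≢∅) , _) = F₁≢∅ (⊆-antisym F₁⊆∅ ⊥⊆)
  forget : GoodAtom M ∅ → ∃[ e ] (e ∈ E M × Divisional M e × ME (si (M / e)))
  forget (e , e∈E , _ , div , me-si) = e , e∈E , div , me-si
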